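{- For every $k\geq 3$, every $k$-rose graph is determined by its Laplacian spectrum.
   Context: Graphs are finite, simple and undirected. For $k\ge2$, a $k$-rose graph is a connected graph with one vertex of degree $2k$ and all other vertices of degree $2$ (equivalently, $k$ cycles meeting in a single common vertex). The Laplacian spectrum of a graph is the multiset of eigenvalues of $L=D-A$, where $A$ is the adjacency matrix and $D$ the diagonal degree matrix. A graph is determined by its Laplacian spectrum if every graph with the same Laplacian spectrum is isomorphic to it. -}

module Defs where

open import Data.Nat using (ℕ; zero; suc; _*_)
open import Data.Integer as ℤ using (ℤ; +_; -_)
open import Data.Fin using (Fin; zero; suc; punchIn; _≟_)
open import Data.Bool using (Bool; true; false; if_then_else_)
open import Data.Product using (Σ; _×_; _,_)
open import Relation.Nullary using (¬_; yes; no)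
open import Relation.Binary.PropositionalEquality using (_≡_)
open import Function.Bundles using (_↔_; Inverse)

record Graph : Set where
  field
    n      : ℕ
    adj    : Fin n → Fin n → Bool
    sym    : ∀ i j → adj i j ≡ adj j i
    irrefl : ∀ i → adj i i ≡ false
open Graph public

sumFin : ∀ m → (Fin m → ℤ) → ℤ
sumFin zero    f = + 0
sumFin (suc m) f = f zero ℤ.+ sumFin m (λ i → f (suc i))

sumFinℕ : ∀ m → (Fin m → ℕ) → ℕ
sumFinℕ zero    f = 0
sumFinℕ (suc m) f = f zero Data.Nat.+ sumFinℕ m (λ i → f (suc i))

deg : (G : Graph) → Fin (n G) → ℕ
deg G i = sumFinℕ (n G) (λ j → if adj G i j then 1 else 0)

laplacian : (G : Graph) → Fin (n G) → Fin (n G) → ℤ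
laplacian G i j with i ≟ j
... | yes _ = + deg G i
... | no  _ = if adj G i j then - (+ 1) else + 0

det : ∀ m → (Fin m → Fin m → ℤ) → ℤ
det zero    M = + 1
det (suc m) M = altSum (suc m) (λ j → M zero j ℤ.* det m (λ r c → M (suc r) (punchIn j c)))
  where
  altSum : ∀ q → (Fin q → ℤ) → ℤ
  altSum zero    f = + 0
  altSum (suc q) f = f zero ℤ.- altSum q (λ i → f (suc i))

charPolyL : (G : Graph) → ℤ → ℤ
charPolyL G t = det (n G) (λ i j → (if ⌊ i ≟ j ⌋′ then t else + 0) ℤ.- laplacian G i j)
  where
  open import Relation.Nullary.Decidable using () renaming (⌊_⌋ to ⌊_⌋′)

-- Laplacian cospectral: equal Laplacian characteristic polynomials
-- (polynomials over ℤ, compared as functions ℤ → ℤ, which over the infinite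
--  domain ℤ is equality of polynomials)
LCospectral : Graph → Graph → Set
LCospectral G H = ∀ t → charPolyL G t ≡ charPolyL H t

data Reach (G : Graph) : Fin (n G) → Fin (n G) → Set where
  here : ∀ {u} → Reach G u u
  step : ∀ {u v w} → adj G u v ≡ true → Reach G v w → Reach G u w

Connected : Graph → Set
Connected G = ∀ u v → Reach G u v

IsRose : ℕ → Graph → Set
IsRose k G =
  Connected G ×
  Σ (Fin (n G)) (λ c → deg G c ≡ 2 * k × (∀ v → ¬ (v ≡ c) → deg G v ≡ 2))

_≅_ : Graph → Graph → Set
G ≅ H = Σ (Fin (n G) ↔ Fin (n H))
          (λ f → ∀ i j → adj H (Inverse.to f i) (Inverse.to f j) ≡ adj G i j)

DLS : Graph → Set
DLS G = ∀ H → LCospectral G H → G ≅ H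

{-# OPTIONS --safe #-}
-- Write P(s, u) = det (s - u L), which the Laplacian spectrum determines.
--
-- Degrees.  Expanding det (1 - w L) up to w³ yields Σ d, Σ d² and Σ d³ - tr A³.  In a k-rose every triangle passes
-- through the centre, so tr A³ ≤ 6k; hence Σ (d - 1)(d - 2)(2k - 1 - d) is negative for every cospectral H when
-- k ≥ 3, and H has a vertex of degree at least 2k.  Then Σ (d - 2)² = (2k - 2)² leaves degree 2 for all others.
--
-- Structure.  Walking away from a vertex c of degree 2k, all others having degree 2, one returns to c; the petals so
-- obtained together with c form a union of components.
--
-- Cycle lengths.  At s = (1 - y)², u = - y, a petal closing a cycle of length l changes the determinant D of a rose,
-- and the determinant A with the centre deleted, by
--   (1 - y²) D′ = (1 - yˡ) ((1 + yˡ) D - 2 (y² + yˡ) A),   (1 - y²) A′ = (1 - y²ˡ) A.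
-- As y → 1 this gives a zero of order exactly 2, whereas a disconnected H would give order at least 4.  As y → 0 the
-- number of cycles of length l is read off from the coefficient of yˡ once the shorter cycles are known.
module Submission where

open import Defs
open import Data.Nat as ℕ using (ℕ; zero; suc; _≤_; s≤s; z≤n)
import Data.Nat.Properties as ℕₚ
open import Data.Integer as ℤ using (ℤ; +_; -_; _+_; _*_; _-_; _^_; 0ℤ; 1ℤ; -1ℤ)
import Data.Integer.Properties as ℤₚ
open import Data.Integer.Tactic.RingSolver using (solve-∀)
open import Data.Fin as Fin using (Fin; zero; suc; punchIn; toℕ; _↑ˡ_; _↑ʳ_)
import Data.Fin.Properties as Finₚ
open import Data.Bool using (Bool; true; false; if_then_else_; _∧_; _∨_)
open import Data.Empty using (⊥; ⊥-elim)
open import Data.Unit using (⊤; tt)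
open import Data.Product using (Σ; ∃; _×_; _,_; proj₁; proj₂)
open import Data.Sum using (_⊎_; inj₁; inj₂)
open import Data.List using (List; []; _∷_; length; map; allFin)
open import Data.Vec as Vec using (Vec; []; _∷_)
open import Function using (_∘_; case_of_)
open import Function.Bundles using (mk↔ₛ′)
open import Relation.Nullary using (¬_; Dec; yes; no; contradiction)
open import Relation.Binary.PropositionalEquality using (_≡_; _≢_; refl; trans; cong; cong₂; subst; module ≡-Reasoning) renaming (sym to ≡-sym)
open import Data.List.Membership.Propositional.Properties using (∈-allFin)
open import Relation.Binary.Definitions using (tri<; tri≈; tri>)
open import Data.List.Relation.Unary.All as All using (All; []; _∷_)
open import Data.List.Relation.Unary.All.Properties using (¬Any⇒All¬)
open import Data.List.Relation.Unary.AllPairs using (AllPairs; []; _∷_)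
open import Data.List.Relation.Unary.Any as Any using (Any; here; there)
open import Relation.Nullary.Decidable using (⌊_⌋; ¬?; _×-dec_; _⊎-dec_)
import Data.Bool.Properties as Boolₚ

-- Determinants

-- All arguments take place in ℤ. Limits and coefficients are expressed by values at integers:
-- `y → 0` becomes congruences modulo powers of `y`, `y → 1` congruences modulo `1 - y`, and
-- equality is recovered because an integer divisible by every positive integer is 0. Divisions are
-- avoided by multiplying through, by `1 - y * y` or `1 + y ^ l`.
--
-- P has two variables because the point of evaluation, s / u = 2 - y - 1 / y, is in general not an
-- integer. It is the eigenvalue 2 - 2 cos θ of a cycle, with y in the role of exp (iθ): a vertex of
-- degree 2 gets the diagonal entry 1 + y², and the recurrence along a petal is solved by the powers
-- of y and 1 / y, so the cycle lengths appear as exponents.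
--
-- The factor 2k - 1 - d keeps the cubic nonnegative at all naturals up to 2k - 1. On the rose only
-- the centre contributes, namely - (2k - 1)(2k - 2); adding 6k for the triangles leaves - 4k(k - 3)
-- - 2, and here k ≥ 3 is used.
--
-- Neither the order nor the connectedness of H is given. The order follows because the
-- characteristic polynomial is monic; connectedness is settled only after the degrees are known.

∑ : ∀ {m} → (Fin m → ℤ) → ℤ
∑ {m} = sumFin m

∑-cong : ∀ {m} {f g : Fin m → ℤ} → (∀ i → f i ≡ g i) → ∑ f ≡ ∑ g
∑-cong {zero}  e = refl
∑-cong {suc m} e = cong₂ _+_ (e zero) (∑-cong (e ∘ suc))

∑-zero : ∀ {m} {f : Fin m → ℤ} → (∀ i → f i ≡ 0ℤ) → ∑ f ≡ 0ℤ
∑-zero {zero}  e = refl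
∑-zero {suc m} e = cong₂ _+_ (e zero) (∑-zero (e ∘ suc))

∑-+ : ∀ {m} (f g : Fin m → ℤ) → ∑ (λ i → f i + g i) ≡ ∑ f + ∑ g
∑-+ {zero}  f g = refl
∑-+ {suc m} f g = trans (cong (_+_ (f zero + g zero)) (∑-+ (f ∘ suc) (g ∘ suc))) (rearrange (f zero) (g zero) (∑ (f ∘ suc)) (∑ (g ∘ suc)))
  where
  rearrange : ∀ a b c d → a + b + (c + d) ≡ a + c + (b + d)
  rearrange = solve-∀

∑-* : ∀ {m} c (f : Fin m → ℤ) → ∑ (λ i → c * f i) ≡ c * ∑ f
∑-* {zero}  c f = ≡-sym (ℤₚ.*-zeroʳ c)
∑-* {suc m} c f = trans (cong (_+_ (c * f zero)) (∑-* c (f ∘ suc))) (≡-sym (ℤₚ.*-distribˡ-+ c _ _))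

∑-swap : ∀ {m p} (f : Fin m → Fin p → ℤ) → ∑ (λ i → ∑ (f i)) ≡ ∑ (λ j → ∑ (λ i → f i j))
∑-swap {zero} {p} f = ≡-sym (∑-zero {p} {λ _ → 0ℤ} (λ _ → refl))
∑-swap {suc m} f = trans (cong (_+_ (∑ (f zero))) (∑-swap (f ∘ suc))) (≡-sym (∑-+ (f zero) (λ j → ∑ (λ i → f (suc i) j))))

δ : ∀ {m} → Fin m → Fin m → ℤ
δ zero    zero    = 1ℤ
δ zero    (suc j) = 0ℤ
δ (suc i) zero    = 0ℤ
δ (suc i) (suc j) = δ i j

δ-refl : ∀ {m} (i : Fin m) → δ i i ≡ 1ℤ
δ-refl zero    = refl
δ-refl (suc i) = δ-refl i

δ-≢ : ∀ {m} {i j : Fin m} → i ≢ j → δ i j ≡ 0ℤ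
δ-≢ {i = zero}  {zero}  i≢j = contradiction refl i≢j
δ-≢ {i = zero}  {suc j} i≢j = refl
δ-≢ {i = suc i} {zero}  i≢j = refl
δ-≢ {i = suc i} {suc j} i≢j = δ-≢ (i≢j ∘ cong suc)

δ-sym : ∀ {m} (i j : Fin m) → δ i j ≡ δ j i
δ-sym zero    zero    = refl
δ-sym zero    (suc j) = refl
δ-sym (suc i) zero    = refl
δ-sym (suc i) (suc j) = δ-sym i j

δ-injective : ∀ {m p} {e : Fin m → Fin p} → (∀ {i j} → e i ≡ e j → i ≡ j) → ∀ i j → δ (e i) (e j) ≡ δ i j
δ-injective {e = e} e-injective i j with i Fin.≟ j
... | yes refl = trans (δ-refl (e i)) (≡-sym (δ-refl i))
... | no i≢j   = trans (δ-≢ (i≢j ∘ e-injective)) (≡-sym (δ-≢ i≢j))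

∑-δ : ∀ {m} (i : Fin m) (f : Fin m → ℤ) → ∑ (λ j → f j * δ i j) ≡ f i
∑-δ zero    f = trans (cong₂ _+_ (ℤₚ.*-identityʳ (f zero)) (∑-zero (λ j → ℤₚ.*-zeroʳ (f (suc j))))) (ℤₚ.+-identityʳ _)
∑-δ (suc i) f = trans (cong₂ _+_ (ℤₚ.*-zeroʳ (f zero)) (∑-δ i (f ∘ suc))) (ℤₚ.+-identityˡ _)

altSum : ∀ q → (Fin q → ℤ) → ℤ
altSum zero    f = 0ℤ
altSum (suc q) f = f zero - altSum q (λ i → f (suc i))

Mat : ℕ → ℕ → Set
Mat m p = Fin m → Fin p → ℤ

minor : ∀ {m} → Mat (suc m) (suc m) → Fin (suc m) → Mat m m
minor M j r c = M (suc r) (punchIn j c)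

-- The alternating sum inside det is local to Defs; the underscore below can only be resolved to it.
mutual
  det-suc : ∀ m M → det (suc m) M ≡ altSum (suc m) (λ j → M zero j * det m (minor M j))
  det-suc m M with (λ (j : Fin m) → M zero (suc j) * det m (λ r c → M (suc r) (punchIn (suc j) c)))
  ... | g = cong (λ z → M zero zero * det m (λ r c → M (suc r) (suc c)) - z) (altSum-local m M g)

  altSum-local : ∀ m (M : Mat (suc m) (suc m)) (g : Fin m → ℤ) → _ ≡ altSum m g
  altSum-local zero    M g = refl
  altSum-local (suc m) M g = cong (λ z → g zero - z) (altSum-local m (λ _ _ → 0ℤ) (λ j → g (suc j)))

altSum-cong : ∀ {q} {f g : Fin q → ℤ} → (∀ i → f i ≡ g i) → altSum q f ≡ altSum q g
altSum-cong {zero}  e = refl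
altSum-cong {suc q} e = cong₂ _-_ (e zero) (altSum-cong (e ∘ suc))

altSum-zero : ∀ {q} {f : Fin q → ℤ} → (∀ i → f i ≡ 0ℤ) → altSum q f ≡ 0ℤ
altSum-zero {zero}  e = refl
altSum-zero {suc q} e = cong₂ _-_ (e zero) (altSum-zero (e ∘ suc))

altSum-linear : ∀ {q} a (f g : Fin q → ℤ) → altSum q (λ i → a * f i + g i) ≡ a * altSum q f + altSum q g
altSum-linear {zero}  a f g = ≡-sym (trans (ℤₚ.+-identityʳ _) (ℤₚ.*-zeroʳ a))
altSum-linear {suc q} a f g = trans (cong (_-_ (a * f zero + g zero)) (altSum-linear a (f ∘ suc) (g ∘ suc))) (rearrange a (f zero) (g zero) (altSum q (f ∘ suc)) (altSum q (g ∘ suc)))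
  where
  rearrange : ∀ a x y s t → a * x + y - (a * s + t) ≡ a * (x - s) + (y - t)
  rearrange = solve-∀

altSum-neg : ∀ {q} (f : Fin q → ℤ) → altSum q (λ i → - f i) ≡ - altSum q f
altSum-neg {zero}  f = refl
altSum-neg {suc q} f = trans (cong (_-_ (- f zero)) (altSum-neg (f ∘ suc))) (rearrange (f zero) (altSum q (f ∘ suc)))
  where
  rearrange : ∀ x s → - x - (- s) ≡ - (x - s)
  rearrange = solve-∀

det-cong : ∀ {m} {M N : Mat m m} → (∀ i j → M i j ≡ N i j) → det m M ≡ det m N
det-cong {zero}          e = refl
det-cong {suc m} {M} {N} e = begin
  det (suc m) M                                        ≡⟨ det-suc m M ⟩
  altSum (suc m) (λ j → M zero j * det m (minor M j))  ≡⟨ altSum-cong (λ j → cong₂ _*_ (e zero j) (det-cong (λ r c → e (suc r) (punchIn j c)))) ⟩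
  altSum (suc m) (λ j → N zero j * det m (minor N j))  ≡⟨ det-suc m N ⟨
  det (suc m) N                                        ∎
  where open ≡-Reasoning

-- Row updates; multilinear and alternating functions of the rows

infixl 6 _[_]≔_
_[_]≔_ : ∀ {A : Set} {m} → (Fin m → A) → Fin m → A → Fin m → A
_[_]≔_ M zero    v zero    = v
_[_]≔_ M zero    v (suc r) = M (suc r)
_[_]≔_ M (suc i) v zero    = M zero
_[_]≔_ M (suc i) v (suc r) = ((M ∘ suc) [ i ]≔ v) r

≔-same : ∀ {A : Set} {m} (M : Fin m → A) i v → (M [ i ]≔ v) i ≡ v
≔-same M zero    v = refl
≔-same M (suc i) v = ≔-same (M ∘ suc) i v

≔-other : ∀ {A : Set} {m} (M : Fin m → A) {i r} v → r ≢ i → (M [ i ]≔ v) r ≡ M r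
≔-other M {zero}  {zero}  v r≢i = contradiction refl r≢i
≔-other M {zero}  {suc r} v r≢i = refl
≔-other M {suc i} {zero}  v r≢i = refl
≔-other M {suc i} {suc r} v r≢i = ≔-other (M ∘ suc) v (r≢i ∘ cong suc)

≔-self : ∀ {A : Set} {m} (M : Fin m → A) i r → (M [ i ]≔ M i) r ≡ M r
≔-self M zero    zero    = refl
≔-self M zero    (suc r) = refl
≔-self M (suc i) zero    = refl
≔-self M (suc i) (suc r) = ≔-self (M ∘ suc) i r

≔-map : ∀ {A B : Set} {m} (h : A → B) (M : Fin m → A) i v r → h ((M [ i ]≔ v) r) ≡ ((h ∘ M) [ i ]≔ h v) r
≔-map h M zero    v zero    = refl
≔-map h M zero    v (suc r) = refl
≔-map h M (suc i) v zero    = refl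
≔-map h M (suc i) v (suc r) = ≔-map h (M ∘ suc) i v r

≔-cong : ∀ {m p} (M : Mat m p) i {v w : Fin p → ℤ} → (∀ c → v c ≡ w c) → ∀ r c → (M [ i ]≔ v) r c ≡ (M [ i ]≔ w) r c
≔-cong M zero    e zero    c = e c
≔-cong M zero    e (suc r) c = refl
≔-cong M (suc i) e zero    c = refl
≔-cong M (suc i) e (suc r) c = ≔-cong (M ∘ suc) i e r c

-- The numbers of rows and columns are independent because fixing a row, as in
-- `prepend-multilinear`, leaves a function of matrices with one row fewer but equally many columns.
record Multilinear {m p} (f : Mat m p → ℤ) : Set where
  field
    respects : ∀ {M N} → (∀ i j → M i j ≡ N i j) → f M ≡ f N
    linear   : ∀ M i a u v → f (M [ i ]≔ (λ c → a * u c + v c)) ≡ a * f (M [ i ]≔ u) + f (M [ i ]≔ v)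

  additive : ∀ M i u v → f (M [ i ]≔ (λ c → u c + v c)) ≡ f (M [ i ]≔ u) + f (M [ i ]≔ v)
  additive M i u v = trans (respects (≔-cong M i (λ c → cong (_+ v c) (≡-sym (ℤₚ.*-identityˡ (u c))))))
                           (trans (linear M i 1ℤ u v) (cong (_+ f (M [ i ]≔ v)) (ℤₚ.*-identityˡ (f (M [ i ]≔ u)))))

  zero-row : ∀ M i → f (M [ i ]≔ (λ _ → 0ℤ)) ≡ 0ℤ
  zero-row M i = cancel _ (additive M i (λ _ → 0ℤ) (λ _ → 0ℤ))
    where
    cancel : ∀ x → x ≡ x + x → x ≡ 0ℤ
    cancel x e = trans (double x) (trans (cong (_- x) (≡-sym e)) (ℤₚ.+-inverseʳ x))
      where
      double : ∀ x → x ≡ x + x - x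
      double = solve-∀

  scale : ∀ M i a u → f (M [ i ]≔ (λ c → a * u c)) ≡ a * f (M [ i ]≔ u)
  scale M i a u = trans (respects (≔-cong M i (λ c → ≡-sym (ℤₚ.+-identityʳ (a * u c)))))
                  (trans (linear M i a u (λ _ → 0ℤ))
                  (trans (cong (_+_ (a * f (M [ i ]≔ u))) (zero-row M i)) (ℤₚ.+-identityʳ _)))

  combination : ∀ {q} M i (a : Fin q → ℤ) (v : Fin q → Fin p → ℤ) →
                f (M [ i ]≔ (λ c → ∑ (λ j → a j * v j c))) ≡ ∑ (λ j → a j * f (M [ i ]≔ v j))
  combination {zero}  M i a v = zero-row M i
  combination {suc q} M i a v = trans (linear M i (a zero) (v zero) _) (cong (_+_ (a zero * f (M [ i ]≔ v zero))) (combination M i (a ∘ suc) (v ∘ suc)))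

record Alternating {m p} (f : Mat m p → ℤ) : Set where
  field
    multilinear : Multilinear f
    vanishes    : ∀ {M i j} → i ≢ j → (∀ c → M i c ≡ M j c) → f M ≡ 0ℤ
  open Multilinear multilinear public

  repeated : ∀ M {i j} → i ≢ j → f (M [ i ]≔ M j) ≡ 0ℤ
  repeated M {i} {j} i≢j = vanishes i≢j (λ c → cong (λ row → row c)
    (trans (≔-same M i (M j)) (≡-sym (≔-other M (M j) (i≢j ∘ ≡-sym)))))

  -- In the expansion by linearity every term with `j ≢ i` has a repeated row, so only the
  -- coefficient of row `i` itself survives. This serves as a row operation when `a i` cannot be
  -- inverted.
  replace-row : ∀ M i (a : Fin m → ℤ) → f (M [ i ]≔ (λ c → ∑ (λ j → a j * M j c))) ≡ a i * f M
  replace-row M i a = begin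
    f (M [ i ]≔ (λ c → ∑ (λ j → a j * M j c)))  ≡⟨ combination M i a M ⟩
    ∑ (λ j → a j * f (M [ i ]≔ M j))            ≡⟨ ∑-cong term ⟩
    ∑ (λ j → (a j * f M) * δ i j)               ≡⟨ ∑-δ i (λ j → a j * f M) ⟩
    a i * f M                                   ∎
    where
    open ≡-Reasoning
    term : ∀ j → a j * f (M [ i ]≔ M j) ≡ (a j * f M) * δ i j
    term j with i Fin.≟ j
    ... | yes refl = trans (cong (a i *_) (respects (λ r c → cong (λ row → row c) (≔-self M i r))))
                           (≡-sym (trans (cong ((a i * f M) *_) (δ-refl i)) (ℤₚ.*-identityʳ (a i * f M))))
    ... | no i≢j   = trans (trans (cong (a j *_) (repeated M i≢j)) (ℤₚ.*-zeroʳ (a j)))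
                           (≡-sym (trans (cong ((a j * f M) *_) (δ-≢ i≢j)) (ℤₚ.*-zeroʳ (a j * f M))))

  -- Polarisation: with `u + v` in both rows the value is 0, and after expansion only the two mixed
  -- terms remain.
  swap-rows : ∀ M {i j} → i ≢ j → f ((M [ i ]≔ M j) [ j ]≔ M i) ≡ - f M
  swap-rows M {i} {j} i≢j = conclude (begin
    0ℤ                                          ≡⟨ vanishes i≢j same ⟨
    f (rows s s)                                ≡⟨ additive (M [ i ]≔ s) j u v ⟩
    f (rows s u) + f (rows s v)                 ≡⟨ cong₂ _+_ (split u) (split v) ⟩
    (f (rows u u) + f (rows v u)) + (f (rows u v) + f (rows v v)) ≡⟨ cong₂ _+_ (cong (_+ f (rows v u)) (diag u)) (cong (_+_ (f (rows u v))) (diag v)) ⟩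
    (0ℤ + f (rows v u)) + (f (rows u v) + 0ℤ)   ≡⟨ cong (λ z → (0ℤ + f (rows v u)) + (z + 0ℤ)) (respects back) ⟩
    (0ℤ + f (rows v u)) + (f M + 0ℤ)            ∎)
    where
    open ≡-Reasoning
    u = M i
    v = M j
    s = λ c → u c + v c
    rows : (Fin p → ℤ) → (Fin p → ℤ) → Mat m p
    rows x y = (M [ i ]≔ x) [ j ]≔ y
    rows-i : ∀ x y → rows x y i ≡ x
    rows-i x y = trans (≔-other (M [ i ]≔ x) y i≢j) (≔-same M i x)
    rows-j : ∀ x y → rows x y j ≡ y
    rows-j x y = ≔-same (M [ i ]≔ x) j y
    same : ∀ c → rows s s i c ≡ rows s s j c
    same c = cong (λ row → row c) (trans (rows-i s s) (≡-sym (rows-j s s)))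
    diag : ∀ x → f (rows x x) ≡ 0ℤ
    diag x = vanishes i≢j (λ c → cong (λ row → row c) (trans (rows-i x x) (≡-sym (rows-j x x))))
    commute : ∀ x y r c → rows x y r c ≡ ((M [ j ]≔ y) [ i ]≔ x) r c
    commute x y r c with r Fin.≟ i | r Fin.≟ j
    ... | yes refl | yes refl = contradiction refl i≢j
    ... | yes refl | no r≢j = cong (λ row → row c) (trans (rows-i x y) (≡-sym (≔-same (M [ j ]≔ y) i x)))
    ... | no r≢i | yes refl = cong (λ row → row c) (trans (rows-j x y) (≡-sym (trans (≔-other (M [ j ]≔ y) x r≢i) (≔-same M j y))))
    ... | no r≢i | no r≢j = cong (λ row → row c) (trans (trans (≔-other (M [ i ]≔ x) y r≢j) (≔-other M x r≢i))
                                                 (≡-sym (trans (≔-other (M [ j ]≔ y) x r≢i) (≔-other M y r≢j))))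
    split : ∀ y → f (rows s y) ≡ f (rows u y) + f (rows v y)
    split y = trans (respects (commute s y)) (trans (additive (M [ j ]≔ y) i u v)
              (≡-sym (cong₂ _+_ (respects (commute u y)) (respects (commute v y)))))
    back : ∀ r c → rows u v r c ≡ M r c
    back r c with r Fin.≟ i | r Fin.≟ j
    ... | yes refl | _ = cong (λ row → row c) (rows-i u v)
    ... | no _ | yes refl = cong (λ row → row c) (rows-j u v)
    ... | no r≢i | no r≢j = cong (λ row → row c) (trans (≔-other (M [ i ]≔ u) v r≢j) (≔-other M u r≢i))
    conclude : ∀ {x y} → 0ℤ ≡ (0ℤ + x) + (y + 0ℤ) → x ≡ - y
    conclude {x} {y} e = trans (solution x y) (trans (cong (_- y) (≡-sym e)) (ℤₚ.+-identityˡ (- y)))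
      where
      solution : ∀ x y → x ≡ (0ℤ + x) + (y + 0ℤ) - y
      solution = solve-∀

open Alternating using (respects; linear; scale; replace-row; vanishes; swap-rows)

infixr 5 _◂_
_◂_ : ∀ {A : Set} {m} → A → (Fin m → A) → Fin (suc m) → A
(v ◂ N) zero    = v
(v ◂ N) (suc r) = N r

prepend-multilinear : ∀ {m p} {f : Mat (suc m) p → ℤ} → Multilinear f → ∀ w → Multilinear (λ N → f (w ◂ N))
prepend-multilinear {f = f} F w = record
  { respects = λ e → resp (λ { zero c → refl ; (suc r) c → e r c })
  ; linear   = λ M i b x y → trans (resp (shift M i _)) (trans (Multilinear.linear F (w ◂ M) (suc i) b x y)
                 (≡-sym (cong₂ _+_ (cong (b *_) (resp (shift M i x))) (resp (shift M i y)))))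
  }
  where
  resp = Multilinear.respects F
  shift : ∀ M i x r c → (w ◂ (M [ i ]≔ x)) r c ≡ ((w ◂ M) [ suc i ]≔ x) r c
  shift M i x zero    c = refl
  shift M i x (suc r) c = refl

-- Intended for `v` a row already fixed inside `f`, where `kills` is the alternating law. The
-- induction absorbs the first row, in its sheared form `w`, into the function, and then removes the
-- multiple of `v` from it by linearity.
shear : ∀ {m p} (f : Mat m p → ℤ) → Multilinear f → (v : Fin p → ℤ) →
        (∀ {N} i → (∀ c → N i c ≡ v c) → f N ≡ 0ℤ) →
        ∀ (a : Fin m → ℤ) N → f (λ r c → N r c + a r * v c) ≡ f N
shear {zero}  f F v kills a N = Multilinear.respects F (λ ())
shear {suc m} f F v kills a N = begin
  f (λ r c → N r c + a r * v c)                  ≡⟨ resp (λ { zero c → refl ; (suc r) c → refl }) ⟩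
  f (w ◂ (λ r c → N (suc r) c + a (suc r) * v c)) ≡⟨ shear (λ N′ → f (w ◂ N′)) (prepend-multilinear F w) v (λ i e → kills (suc i) e) (a ∘ suc) (N ∘ suc) ⟩
  f (w ◂ N ∘ suc)                                ≡⟨ resp (λ { zero c → ℤₚ.+-comm (N zero c) _ ; (suc r) c → refl }) ⟩
  f (N [ zero ]≔ (λ c → a zero * v c + N zero c)) ≡⟨ Multilinear.linear F N zero (a zero) v (N zero) ⟩
  a zero * f (N [ zero ]≔ v) + f (N [ zero ]≔ N zero) ≡⟨ cong₂ _+_ (cong (a zero *_) (kills zero (λ _ → refl))) (resp (λ r c → cong (λ row → row c) (≔-self N zero r))) ⟩
  a zero * 0ℤ + f N                              ≡⟨ cong (_+ f N) (ℤₚ.*-zeroʳ (a zero)) ⟩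
  0ℤ + f N                                       ≡⟨ ℤₚ.+-identityˡ _ ⟩
  f N                                            ∎
  where
  open ≡-Reasoning
  resp = Multilinear.respects F
  w = λ c → N zero c + a zero * v c

-- The determinant is alternating

det-expand : ∀ {m} (M : Mat (suc m) (suc m)) {g : Fin (suc m) → ℤ} →
             (∀ j → M zero j * det m (minor M j) ≡ g j) → det (suc m) M ≡ altSum (suc m) g
det-expand {m} M e = trans (det-suc m M) (altSum-cong e)

det-linear : ∀ {m} (M : Mat m m) i a u v →
             det m (M [ i ]≔ (λ c → a * u c + v c)) ≡ a * det m (M [ i ]≔ u) + det m (M [ i ]≔ v)
det-linear {suc m} M i a u v =
  trans (det-expand (M [ i ]≔ (λ c → a * u c + v c)) (term i))
        (trans (altSum-linear a (λ j → (M [ i ]≔ u) zero j * det m (minor (M [ i ]≔ u) j))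
                                (λ j → (M [ i ]≔ v) zero j * det m (minor (M [ i ]≔ v) j)))
               (≡-sym (cong₂ (λ x y → a * x + y) (det-suc m (M [ i ]≔ u)) (det-suc m (M [ i ]≔ v)))))
  where
  distrib : ∀ a u v d → (a * u + v) * d ≡ a * (u * d) + v * d
  distrib = solve-∀
  distrib′ : ∀ a x u v → x * (a * u + v) ≡ a * (x * u) + x * v
  distrib′ = solve-∀
  restrict : ∀ i w j r c → (M [ suc i ]≔ w) (suc r) (punchIn j c) ≡ (minor M j [ i ]≔ (w ∘ punchIn j)) r c
  restrict i w j r c = cong (λ row → row c) (≔-map (λ row → row ∘ punchIn j) (M ∘ suc) i w r)
  term : ∀ i j → (M [ i ]≔ (λ c → a * u c + v c)) zero j * det m (minor (M [ i ]≔ (λ c → a * u c + v c)) j)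
       ≡ a * ((M [ i ]≔ u) zero j * det m (minor (M [ i ]≔ u) j)) + (M [ i ]≔ v) zero j * det m (minor (M [ i ]≔ v) j)
  term zero    j = distrib a (u j) (v j) (det m (minor M j))
  term (suc i) j = trans (cong (M zero j *_) (trans (det-cong (restrict i _ j)) (trans (det-linear (minor M j) i a (u ∘ punchIn j) (v ∘ punchIn j))
                     (≡-sym (cong₂ (λ x y → a * x + y) (det-cong (restrict i u j)) (det-cong (restrict i v j)))))))
                     (distrib′ a (M zero j) (det m (minor (M [ suc i ]≔ u) j)) (det m (minor (M [ suc i ]≔ v) j)))

-- h j k is thought of as indexed by the unordered pair {j , punchIn j k}.
Symmetric : ∀ q → (Fin (suc q) → Fin q → ℤ) → Set
Symmetric zero    h = ⊤
Symmetric (suc q) h = (∀ k → h zero k ≡ h (suc k) zero) × Symmetric q (λ j k → h (suc j) (suc k))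

Symmetric-cong : ∀ q (h h′ : Fin (suc q) → Fin q → ℤ) → (∀ j k → h j k ≡ h′ j k) → Symmetric q h → Symmetric q h′
Symmetric-cong zero    h h′ e s       = tt
Symmetric-cong (suc q) h h′ e (s , t) = (λ k → trans (≡-sym (e zero k)) (trans (s k) (e (suc k) zero))) , Symmetric-cong q _ _ (λ j k → e (suc j) (suc k)) t

-- Each unordered pair of columns occurs twice, with opposite signs. The induction peels off the
-- pairs containing column 0: those with 0 in first place sum to `A`, and by symmetry those with 0
-- in second place cancel it.
altSum-symmetric : ∀ q (h : Fin (suc q) → Fin q → ℤ) → Symmetric q h → altSum (suc q) (λ j → altSum q (h j)) ≡ 0ℤ
altSum-symmetric zero    h s       = refl
altSum-symmetric (suc q) h (s , t) = begin
  A - altSum (suc q) (λ j → h (suc j) zero - altSum q (λ k → h (suc j) (suc k)))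
    ≡⟨ cong (_-_ A) (altSum-cong {suc q} (λ j → flip (h (suc j) zero) (altSum q (λ k → h (suc j) (suc k))))) ⟩
  A - altSum (suc q) (λ j → -1ℤ * altSum q (λ k → h (suc j) (suc k)) + h (suc j) zero)
    ≡⟨ cong (_-_ A) (altSum-linear -1ℤ (λ j → altSum q (λ k → h (suc j) (suc k))) (λ j → h (suc j) zero)) ⟩
  A - (-1ℤ * altSum (suc q) (λ j → altSum q (λ k → h (suc j) (suc k))) + altSum (suc q) (λ j → h (suc j) zero))
    ≡⟨ cong₂ (λ x y → A - (-1ℤ * x + y)) (altSum-symmetric q (λ j k → h (suc j) (suc k)) t) (≡-sym (altSum-cong s)) ⟩
  A - (0ℤ + A)
    ≡⟨ cancel A ⟩
  0ℤ ∎
  where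
  open ≡-Reasoning
  A = altSum (suc q) (h zero)
  flip : ∀ x y → x - y ≡ -1ℤ * y + x
  flip = solve-∀
  cancel : ∀ x → x - (0ℤ + x) ≡ 0ℤ
  cancel = solve-∀

-- The columns that remain after two deletions, listed in increasing order, do not depend on the
-- order of deletion. When neither deleted column is 0, column 0 is kept in front of a smaller
-- instance. `F-cong` replaces function extensionality.
pair-symmetric : ∀ q (a : Fin (suc (suc q)) → ℤ) (F : (Fin q → Fin (suc (suc q))) → ℤ) →
                 (∀ {x y} → (∀ c → x c ≡ y c) → F x ≡ F y) →
                 Symmetric (suc q) (λ j k → a j * a (punchIn j k) * F (λ c → punchIn j (punchIn k c)))
pair-symmetric q a F F-cong = (λ k → cong (_* F (λ c → suc (punchIn k c))) (ℤₚ.*-comm (a zero) (a (suc k)))) , rest q a F F-cong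
  where
  rest : ∀ q (a : Fin (suc (suc q)) → ℤ) (F : (Fin q → Fin (suc (suc q))) → ℤ) →
         (∀ {x y} → (∀ c → x c ≡ y c) → F x ≡ F y) →
         Symmetric q (λ j k → a (suc j) * a (suc (punchIn j k)) * F (λ c → punchIn (suc j) (punchIn (suc k) c)))
  rest zero    a F F-cong = tt
  rest (suc q) a F F-cong = Symmetric-cong (suc q)
    (λ j k → a (suc j) * a (suc (punchIn j k)) * F (zero ◂ (λ c → suc (punchIn j (punchIn k c)))))
    (λ j k → a (suc j) * a (suc (punchIn j k)) * F (λ c → punchIn (suc j) (punchIn (suc k) c)))
    (λ j k → cong (a (suc j) * a (suc (punchIn j k)) *_)
       (F-cong {zero ◂ (λ c → suc (punchIn j (punchIn k c)))} {λ c → punchIn (suc j) (punchIn (suc k) c)} (λ { zero → refl ; (suc c) → refl })))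
    (pair-symmetric q (a ∘ suc) (λ x → F (zero ◂ (suc ∘ x))) (λ e → F-cong (λ { zero → refl ; (suc c) → cong suc (e c) })))

det-first-rows : ∀ {m} (M : Mat (suc (suc m)) (suc (suc m))) → (∀ c → M zero c ≡ M (suc zero) c) → det (suc (suc m)) M ≡ 0ℤ
det-first-rows {m} M e = begin
  det (suc (suc m)) M
    ≡⟨ det-expand M (λ j → trans (cong (M zero j *_) (det-suc m (minor M j))) (scaled (M zero j) (λ k → minor M j zero k * det m (minor (minor M j) k)))) ⟩
  altSum (suc (suc m)) (λ j → altSum (suc m) (λ k → M zero j * (M (suc zero) (punchIn j k) * det m (minor (minor M j) k))))
    ≡⟨ altSum-cong {suc (suc m)} (λ j → altSum-cong {suc m} (λ k → trans (cong (λ z → M zero j * (z * det m (minor (minor M j) k))) (≡-sym (e (punchIn j k))))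
                                                 (≡-sym (ℤₚ.*-assoc (M zero j) (M zero (punchIn j k)) (det m (minor (minor M j) k)))))) ⟩
  altSum (suc (suc m)) (λ j → altSum (suc m) (λ k → M zero j * M zero (punchIn j k) * F (λ c → punchIn j (punchIn k c))))
    ≡⟨ altSum-symmetric (suc m) (λ j k → M zero j * M zero (punchIn j k) * F (λ c → punchIn j (punchIn k c))) (pair-symmetric m (M zero) F (λ x≡y → det-cong (λ r c → cong (M (suc (suc r))) (x≡y c)))) ⟩
  0ℤ ∎
  where
  open ≡-Reasoning
  F : (Fin m → Fin (suc (suc m))) → ℤ
  F x = det m (λ r c → M (suc (suc r)) (x c))
  scaled : ∀ {q} a (f : Fin q → ℤ) → a * altSum q f ≡ altSum q (λ k → a * f k)
  scaled {q} a f = begin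
    a * altSum q f                          ≡⟨ ℤₚ.+-identityʳ (a * altSum q f) ⟨
    a * altSum q f + 0ℤ                     ≡⟨ cong (_+_ (a * altSum q f)) (altSum-zero {q} (λ _ → refl)) ⟨
    a * altSum q f + altSum q (λ _ → 0ℤ)    ≡⟨ altSum-linear a f (λ _ → 0ℤ) ⟨
    altSum q (λ k → a * f k + 0ℤ)           ≡⟨ altSum-cong (λ k → ℤₚ.+-identityʳ (a * f k)) ⟩
    altSum q (λ k → a * f k)                ∎

det-multilinear : ∀ m → Multilinear (det m)
det-multilinear m = record { respects = det-cong ; linear = det-linear }

-- The row equal to row 0 is brought next to it by exchanging it with row 1. Every minor of the
-- first row changes sign by `inner`, hence so does the determinant, and the case of two adjacent
-- equal rows applies.
det-first-row : ∀ m → Alternating (det m) → {M : Mat (suc m) (suc m)} → ∀ j → (∀ c → M zero c ≡ M (suc j) c) → det (suc m) M ≡ 0ℤ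
det-first-row (suc m) inner {M} zero    e = det-first-rows M e
det-first-row (suc m) inner {M} (suc j) e = begin
    det (suc (suc m)) M         ≡⟨ ℤₚ.neg-involutive (det (suc (suc m)) M) ⟨
    - (- det (suc (suc m)) M)   ≡⟨ cong -_ (trans (cong -_ (det-suc (suc m) M)) (≡-sym (altSum-neg (λ c → M zero c * det (suc m) (minor M c))))) ⟩
    - altSum (suc (suc m)) (λ c → - (M zero c * det (suc m) (minor M c)))
                                ≡⟨ cong -_ (det-expand swapped term) ⟨
    - det (suc (suc m)) swapped ≡⟨ cong -_ (det-first-rows swapped (λ c → trans (e c) (≡-sym (cong (λ row → row c) (≔-other (N [ zero ]≔ N (suc j)) {suc j} {zero} (N zero) (λ ())))))) ⟩
    0ℤ                          ∎
    where
    open ≡-Reasoning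
    N = M ∘ suc
    swapped = M zero ◂ ((N [ zero ]≔ N (suc j)) [ suc j ]≔ N zero)
    restrict : ∀ c r d → ((N [ zero ]≔ N (suc j)) [ suc j ]≔ N zero) r (punchIn c d)
                       ≡ ((minor M c [ zero ]≔ minor M c (suc j)) [ suc j ]≔ minor M c zero) r d
    restrict c r d = trans (cong (λ row → row d) (≔-map (λ row → row ∘ punchIn c) (N [ zero ]≔ N (suc j)) (suc j) (N zero) r)) (outer r)
      where
      outer : ∀ r → (((λ row → row ∘ punchIn c) ∘ (N [ zero ]≔ N (suc j))) [ suc j ]≔ (N zero ∘ punchIn c)) r d
                  ≡ ((minor M c [ zero ]≔ minor M c (suc j)) [ suc j ]≔ minor M c zero) r d
      outer zero    = refl
      outer (suc r) = refl
    term : ∀ c → M zero c * det (suc m) (minor swapped c) ≡ - (M zero c * det (suc m) (minor M c))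
    term c = trans (cong (M zero c *_) (trans (det-cong (restrict c)) (Alternating.swap-rows inner (minor M c) {zero} {suc j} (λ ()))))
                   (≡-sym (ℤₚ.neg-distribʳ-* (M zero c) (det (suc m) (minor M c))))

det-alternating : ∀ m → Alternating (det m)
det-alternating zero    = record { multilinear = det-multilinear zero ; vanishes = λ { {i = ()} } }
det-alternating (suc m) = record { multilinear = det-multilinear (suc m) ; vanishes = vanish }
  where
  inner = det-alternating m
  vanish : ∀ {M : Mat (suc m) (suc m)} {i j} → i ≢ j → (∀ c → M i c ≡ M j c) → det (suc m) M ≡ 0ℤ
  vanish     {i = zero}  {zero}  i≢j e = contradiction refl i≢j
  vanish {M} {zero}  {suc j} i≢j e = det-first-row m inner {M} j e
  vanish {M} {suc i} {zero}  i≢j e = det-first-row m inner {M} i (≡-sym ∘ e)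
  vanish {M} {suc i} {suc j} i≢j e =
    trans (det-expand M {λ _ → 0ℤ} (λ k → trans (cong (M zero k *_) (vanishes inner {minor M k} (i≢j ∘ cong suc) (λ c → e (punchIn k c)))) (ℤₚ.*-zeroʳ (M zero k))))
          (altSum-zero {suc m} (λ _ → refl))

det-δ : ∀ m → det m δ ≡ 1ℤ
det-δ zero    = refl
det-δ (suc m) = trans (det-suc m δ) (cong₂ _-_ (trans (ℤₚ.*-identityˡ (det m (λ i j → δ (suc i) (suc j)))) (det-δ m)) (altSum-zero {m} (λ i → refl)))

-- Uniqueness of alternating functions and invariance under relabelling

ins : ∀ {m} → Fin (suc m) → (Fin m → ℤ) → Fin (suc m) → ℤ
ins         zero    v zero    = 0ℤ
ins         zero    v (suc c) = v c
ins {suc m} (suc j) v zero    = v zero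
ins {suc m} (suc j) v (suc c) = ins j (v ∘ suc) c

ins-cong : ∀ {m} (j : Fin (suc m)) {v w} → (∀ c → v c ≡ w c) → ∀ c → ins j v c ≡ ins j w c
ins-cong         zero    e zero    = refl
ins-cong         zero    e (suc c) = e c
ins-cong {suc m} (suc j) e zero    = e zero
ins-cong {suc m} (suc j) e (suc c) = ins-cong j (e ∘ suc) c

ins-linear : ∀ {m} (j : Fin (suc m)) a v w c → ins j (λ d → a * v d + w d) c ≡ a * ins j v c + ins j w c
ins-linear         zero    a v w zero    = ≡-sym (trans (ℤₚ.+-identityʳ (a * 0ℤ)) (ℤₚ.*-zeroʳ a))
ins-linear         zero    a v w (suc c) = refl
ins-linear {suc m} (suc j) a v w zero    = refl
ins-linear {suc m} (suc j) a v w (suc c) = ins-linear j a (v ∘ suc) (w ∘ suc) c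

ins-punchIn : ∀ {m} (j : Fin (suc m)) (w : Fin (suc m) → ℤ) c → w c ≡ ins j (w ∘ punchIn j) c + w j * δ j c
ins-punchIn         zero    w zero    = ≡-sym (trans (ℤₚ.+-identityˡ (w zero * 1ℤ)) (ℤₚ.*-identityʳ (w zero)))
ins-punchIn         zero    w (suc c) = ≡-sym (trans (cong (_+_ (w (suc c))) (ℤₚ.*-zeroʳ (w zero))) (ℤₚ.+-identityʳ (w (suc c))))
ins-punchIn {suc m} (suc j) w zero    = ≡-sym (trans (cong (_+_ (w zero)) (ℤₚ.*-zeroʳ (w (suc j)))) (ℤₚ.+-identityʳ (w zero)))
ins-punchIn {suc m} (suc j) w (suc c) = ins-punchIn j (w ∘ suc) c

ins-δ : ∀ {m} (j : Fin (suc m)) r c → ins j (δ r) c ≡ δ (punchIn j r) c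
ins-δ zero    r       zero    = refl
ins-δ zero    r       (suc c) = refl
ins-δ (suc j) zero    zero    = refl
ins-δ (suc j) (suc r) zero    = refl
ins-δ {suc (suc m)} (suc j) zero    (suc c) = zeros j c
  where
  zeros : ∀ {m} (j : Fin (suc m)) c → ins j (λ _ → 0ℤ) c ≡ 0ℤ
  zeros         zero    zero    = refl
  zeros         zero    (suc c) = refl
  zeros {suc m} (suc j) zero    = refl
  zeros {suc m} (suc j) (suc c) = zeros j c
ins-δ {suc zero} (suc zero) zero (suc zero) = refl
ins-δ {suc m} (suc j) (suc r) (suc c) = ins-δ j r c

module _ {m} {f : Mat (suc m) (suc m) → ℤ} (F : Alternating f) where

  -- The function that `f` induces on minors: `δ j` is the first row, and `ins j` pads the other
  -- rows by a zero in column `j`. By `along-clear` the padding loses nothing, since multiples of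
  -- `δ j` can be subtracted from the other rows.
  along : Fin (suc m) → Mat m m → ℤ
  along j N = f (δ j ◂ (λ r → ins j (N r)))

  along-alternating : ∀ j → Alternating (along j)
  along-alternating j = record
    { multilinear = record
      { respects = λ e → respects F (λ { zero c → refl ; (suc r) c → ins-cong j (e r) c })
      ; linear   = λ M i a u v → trans (respects F (λ { zero c → refl ; (suc r) c → trans (shift M i _ r c) (≔-cong (λ r → ins j (M r)) i (ins-linear j a u v) r c) }))
                   (trans (linear F (δ j ◂ (λ r → ins j (M r))) (suc i) a (ins j u) (ins j v))
                          (≡-sym (cong₂ (λ x y → a * x + y) (move M i u) (move M i v))))
      }
    ; vanishes = λ {M} {i} {k} i≢k e → vanishes F {δ j ◂ (λ r → ins j (M r))} {suc i} {suc k} (i≢k ∘ Finₚ.suc-injective) (ins-cong j e)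
    }
    where
    shift : ∀ M i w r c → ins j ((M [ i ]≔ w) r) c ≡ ((λ r → ins j (M r)) [ i ]≔ ins j w) r c
    shift M i w r c = cong (λ row → row c) (≔-map (ins j) M i w r)
    move : ∀ M i w → along j (M [ i ]≔ w) ≡ f ((δ j ◂ (λ r → ins j (M r))) [ suc i ]≔ ins j w)
    move M i w = respects F (λ { zero c → refl ; (suc r) c → shift M i w r c })

  along-clear : ∀ j (N : Fin m → Fin (suc m) → ℤ) → f (δ j ◂ N) ≡ along j (λ r c → N r (punchIn j c))
  along-clear j N = trans (respects F {δ j ◂ N} {δ j ◂ (λ r c → ins j (N r ∘ punchIn j) c + N r j * δ j c)}
      (λ { zero c → refl ; (suc r) c → ins-punchIn j (N r) c }))
    (shear (λ N′ → f (δ j ◂ N′)) (prepend-multilinear (Alternating.multilinear F) (δ j)) (δ j) (λ i e → vanishes F {i = suc i} {zero} (λ ()) e) (λ r → N r j) (λ r → ins j (N r ∘ punchIn j)))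

sgn : ∀ {m} → Fin m → ℤ
sgn zero    = 1ℤ
sgn (suc j) = - sgn j

altSum-sgn : ∀ {q} (f : Fin q → ℤ) → altSum q f ≡ ∑ (λ j → sgn j * f j)
altSum-sgn {zero}  f = refl
altSum-sgn {suc q} f = cong₂ _+_ (≡-sym (ℤₚ.*-identityˡ (f zero))) (begin
  - altSum q (f ∘ suc)                 ≡⟨ cong -_ (altSum-sgn (f ∘ suc)) ⟩
  - ∑ (λ j → sgn j * f (suc j))        ≡⟨ ℤₚ.-1*i≡-i (∑ (λ j → sgn j * f (suc j))) ⟨
  -1ℤ * ∑ (λ j → sgn j * f (suc j))    ≡⟨ ∑-* -1ℤ (λ j → sgn j * f (suc j)) ⟨
  ∑ (λ j → -1ℤ * (sgn j * f (suc j)))  ≡⟨ ∑-cong (λ j → assoc (sgn j) (f (suc j))) ⟩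
  ∑ (λ j → - sgn j * f (suc j))        ∎)
  where
  open ≡-Reasoning
  assoc : ∀ s x → -1ℤ * (s * x) ≡ - s * x
  assoc = solve-∀

-- The rows are the permutation matrix of a cycle. Its second row is `δ zero`; exchanging the first
-- two rows leaves `δ zero` on top of the same kind of cycle, one size smaller.
cycle-sign : ∀ {m} {f : Mat (suc m) (suc m) → ℤ} → Alternating f → ∀ j → f (δ j ◂ (λ r → δ (punchIn j r))) ≡ sgn j * f δ
cycle-sign F zero = trans (respects F (λ { zero c → refl ; (suc r) c → refl })) (≡-sym (ℤₚ.*-identityˡ _))
cycle-sign {suc m} {f} F (suc j) = begin
  f Q                                                     ≡⟨ ℤₚ.neg-involutive (f Q) ⟨
  - (- f Q)                                               ≡⟨ cong -_ (swap-rows F Q {zero} {suc zero} (λ ())) ⟨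
  - f ((Q [ zero ]≔ Q (suc zero)) [ suc zero ]≔ Q zero)   ≡⟨ cong -_ (respects F reorder) ⟩
  - along F zero (δ j ◂ (λ r → δ (punchIn j r)))          ≡⟨ cong -_ (cycle-sign (along-alternating F zero) j) ⟩
  - (sgn j * along F zero δ)                              ≡⟨ cong (λ z → - (sgn j * z)) (respects F (λ { zero c → refl ; (suc r) c → ins-δ zero r c })) ⟩
  - (sgn j * f δ)                                         ≡⟨ ℤₚ.neg-distribˡ-* (sgn j) (f δ) ⟩
  - sgn j * f δ                                           ∎
  where
  open ≡-Reasoning
  Q : Mat (suc (suc m)) (suc (suc m))
  Q = δ (suc j) ◂ (λ r → δ (punchIn (suc j) r))
  reorder : ∀ r c → ((Q [ zero ]≔ Q (suc zero)) [ suc zero ]≔ Q zero) r c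
                  ≡ (δ zero ◂ (λ r → ins zero ((δ j ◂ (λ r → δ (punchIn j r))) r))) r c
  reorder zero          c       = refl
  reorder (suc zero)    zero    = refl
  reorder (suc zero)    (suc c) = refl
  reorder (suc (suc r)) zero    = refl
  reorder (suc (suc r)) (suc c) = refl

-- The first row is expanded in the basis `δ j`, and the induction hypothesis is applied to each
-- `along F j`; the signs from `cycle-sign` are those of the expansion of `det`.
alternating-unique : ∀ {m} {f : Mat m m → ℤ} → Alternating f → ∀ M → f M ≡ f δ * det m M
alternating-unique {zero}  {f} F M = trans (respects F (λ ())) (≡-sym (ℤₚ.*-identityʳ (f δ)))
alternating-unique {suc m} {f} F M = begin
  f M
    ≡⟨ respects F (λ { zero c → ≡-sym (trans (∑-cong (λ j → cong (M zero j *_) (δ-sym j c))) (∑-δ c (M zero))) ; (suc r) c → refl }) ⟩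
  f (M [ zero ]≔ (λ c → ∑ (λ j → M zero j * δ j c)))
    ≡⟨ Alternating.combination F M zero (M zero) δ ⟩
  ∑ (λ j → M zero j * f (M [ zero ]≔ δ j))
    ≡⟨ ∑-cong (λ j → trans (cong (M zero j *_) (minors j)) (rearrange (M zero j) (sgn j) (f δ) (det m (minor M j)))) ⟩
  ∑ (λ j → f δ * (sgn j * (M zero j * det m (minor M j))))
    ≡⟨ ∑-* (f δ) (λ j → sgn j * (M zero j * det m (minor M j))) ⟩
  f δ * ∑ (λ j → sgn j * (M zero j * det m (minor M j)))
    ≡⟨ cong (f δ *_) (trans (≡-sym (altSum-sgn (λ j → M zero j * det m (minor M j)))) (≡-sym (det-suc m M))) ⟩
  f δ * det (suc m) M ∎
  where
  open ≡-Reasoning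
  rearrange : ∀ x s d m → x * (s * d * m) ≡ d * (s * (x * m))
  rearrange = solve-∀
  minors : ∀ j → f (M [ zero ]≔ δ j) ≡ sgn j * f δ * det m (minor M j)
  minors j = begin
    f (M [ zero ]≔ δ j)                       ≡⟨ respects F (λ { zero c → refl ; (suc r) c → refl }) ⟩
    f (δ j ◂ M ∘ suc)                         ≡⟨ along-clear F j (M ∘ suc) ⟩
    along F j (minor M j)                     ≡⟨ alternating-unique (along-alternating F j) (minor M j) ⟩
    along F j δ * det m (minor M j)           ≡⟨ cong (_* det m (minor M j)) (respects F (λ { zero c → refl ; (suc r) c → ins-δ j r c })) ⟩
    f (δ j ◂ (λ r → δ (punchIn j r))) * det m (minor M j) ≡⟨ cong (_* det m (minor M j)) (cycle-sign F j) ⟩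
    sgn j * f δ * det m (minor M j)           ∎

-- No signs of permutations are needed: as a function of `M` the relabelled determinant is
-- alternating, and its value at `δ` is 1.
det-relabel : ∀ {m} (e e⁻¹ : Fin m → Fin m) → (∀ i → e⁻¹ (e i) ≡ i) → (∀ i → e (e⁻¹ i) ≡ i) →
              ∀ M → det m (λ i j → M (e i) (e j)) ≡ det m M
det-relabel {m} e e⁻¹ left right M = trans (alternating-unique f-alternating M) (trans (cong (_* det m M) f-δ) (ℤₚ.*-identityˡ (det m M)))
  where
  f : Mat m m → ℤ
  f M = det m (λ i j → M (e i) (e j))
  e-injective : ∀ {i j} → e i ≡ e j → i ≡ j
  e-injective {i} {j} p = trans (≡-sym (left i)) (trans (cong e⁻¹ p) (left j))
  f-δ : f δ ≡ 1ℤ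
  f-δ = trans (det-cong (δ-injective e-injective)) (det-δ m)
  update : ∀ (M : Mat m m) r w i j → (M [ r ]≔ w) (e i) (e j) ≡ ((λ i j → M (e i) (e j)) [ e⁻¹ r ]≔ (w ∘ e)) i j
  update M r w i j with i Fin.≟ e⁻¹ r
  ... | yes refl = trans (cong (λ k → (M [ r ]≔ w) k (e j)) (right r)) (trans (cong (λ row → row (e j)) (≔-same M r w))
                         (≡-sym (cong (λ row → row j) (≔-same (λ i j → M (e i) (e j)) (e⁻¹ r) (w ∘ e)))))
  ... | no i≢    = trans (cong (λ row → row (e j)) (≔-other M w (λ p → i≢ (trans (≡-sym (left i)) (cong e⁻¹ p)))))
                         (≡-sym (cong (λ row → row j) (≔-other (λ i j → M (e i) (e j)) (w ∘ e) i≢)))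
  f-alternating : Alternating f
  f-alternating = record
    { multilinear = record
      { respects = λ p → det-cong (λ i j → p (e i) (e j))
      ; linear = λ M i a u v → trans (det-cong (update M i _)) (trans (det-linear (λ i j → M (e i) (e j)) (e⁻¹ i) a (u ∘ e) (v ∘ e))
                   (≡-sym (cong₂ (λ x y → a * x + y) (det-cong (update M i u)) (det-cong (update M i v)))))
      }
    ; vanishes = λ {M} {i} {j} i≢j p → vanishes (det-alternating m) {λ i j → M (e i) (e j)} {e⁻¹ i} {e⁻¹ j}
        (λ q → i≢j (trans (≡-sym (right i)) (trans (cong e q) (right j))))
        (λ c → trans (cong (λ k → M k (e c)) (right i)) (trans (p (e c)) (cong (λ k → M k (e c)) (≡-sym (right j)))))
    }

-- Determinants of block triangular matrices

det-zero-column : ∀ {m} (M : Mat (suc m) (suc m)) → (∀ r → M r zero ≡ 0ℤ) → det (suc m) M ≡ 0ℤ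
det-zero-column {zero}  M e = trans (det-expand M {λ _ → 0ℤ} (λ { zero → cong (_* 1ℤ) (e zero) })) refl
det-zero-column {suc m} M e = trans (det-expand M {λ _ → 0ℤ} term) (altSum-zero {suc (suc m)} (λ _ → refl))
  where
  term : ∀ j → M zero j * det (suc m) (minor M j) ≡ 0ℤ
  term zero    = trans (cong (_* det (suc m) (minor M zero)) (e zero)) (ℤₚ.*-zeroˡ (det (suc m) (minor M zero)))
  term (suc j) = trans (cong (M zero (suc j) *_) (det-zero-column (minor M (suc j)) (e ∘ suc))) (ℤₚ.*-zeroʳ (M zero (suc j)))

det-pivot : ∀ {m} (M : Mat (suc m) (suc m)) → (∀ r → M (suc r) zero ≡ 0ℤ) →
            det (suc m) M ≡ M zero zero * det m (λ i j → M (suc i) (suc j))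
det-pivot {zero}  M e = trans (det-suc 0 M) (ℤₚ.+-identityʳ (M zero zero * 1ℤ))
det-pivot {suc m} M e = trans (det-suc (suc m) M) (trans (cong (_-_ (M zero zero * det (suc m) (minor M zero))) (altSum-zero term))
                                                         (ℤₚ.+-identityʳ (M zero zero * det (suc m) (minor M zero))))
  where
  term : ∀ j → M zero (suc j) * det (suc m) (minor M (suc j)) ≡ 0ℤ
  term j = trans (cong (M zero (suc j) *_) (det-zero-column (minor M (suc j)) e)) (ℤₚ.*-zeroʳ (M zero (suc j)))

punchIn-↑ˡ : ∀ {r} (j : Fin (suc r)) (c : Fin r) m → punchIn (j ↑ˡ m) (c ↑ˡ m) ≡ punchIn j c ↑ˡ m
punchIn-↑ˡ zero    c       m = refl
punchIn-↑ˡ (suc j) zero    m = refl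
punchIn-↑ˡ (suc j) (suc c) m = cong suc (punchIn-↑ˡ j c m)

punchIn-↑ʳ : ∀ {r m} (j : Fin (suc r)) (c : Fin m) → punchIn (j ↑ˡ m) (r ↑ʳ c) ≡ suc r ↑ʳ c
punchIn-↑ʳ {r}     zero    c = refl
punchIn-↑ʳ {suc r} (suc j) c = cong suc (punchIn-↑ʳ j c)

altSum-split : ∀ r m (f : Fin (r ℕ.+ m) → ℤ) → (∀ j → f (r ↑ʳ j) ≡ 0ℤ) → altSum (r ℕ.+ m) f ≡ altSum r (λ j → f (j ↑ˡ m))
altSum-split zero    m f e = altSum-zero e
altSum-split (suc r) m f e = cong (_-_ (f zero)) (altSum-split r m (f ∘ suc) e)

altSum-*ʳ : ∀ {q} (f : Fin q → ℤ) d → altSum q (λ j → f j * d) ≡ altSum q f * d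
altSum-*ʳ {zero}  f d = refl
altSum-*ʳ {suc q} f d = trans (cong (_-_ (f zero * d)) (altSum-*ʳ (f ∘ suc) d)) (rearrange (f zero) (altSum q (f ∘ suc)) d)
  where
  rearrange : ∀ x s d → x * d - s * d ≡ (x - s) * d
  rearrange = solve-∀

det-block : ∀ r m (M : Mat (r ℕ.+ m) (r ℕ.+ m)) → (∀ i j → M (i ↑ˡ m) (r ↑ʳ j) ≡ 0ℤ) →
            det (r ℕ.+ m) M ≡ det r (λ i j → M (i ↑ˡ m) (j ↑ˡ m)) * det m (λ i j → M (r ↑ʳ i) (r ↑ʳ j))
det-block zero    m M e = ≡-sym (ℤₚ.*-identityˡ (det m M))
det-block (suc r) m M e = begin
  det (suc r ℕ.+ m) M
    ≡⟨ det-suc (r ℕ.+ m) M ⟩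
  altSum (suc r ℕ.+ m) (λ j → M zero j * det (r ℕ.+ m) (minor M j))
    ≡⟨ altSum-split (suc r) m (λ j → M zero j * det (r ℕ.+ m) (minor M j))
         (λ j → trans (cong (_* det (r ℕ.+ m) (minor M (suc r ↑ʳ j))) (e zero j)) (ℤₚ.*-zeroˡ (det (r ℕ.+ m) (minor M (suc r ↑ʳ j))))) ⟩
  altSum (suc r) (λ j → M zero (j ↑ˡ m) * det (r ℕ.+ m) (minor M (j ↑ˡ m)))
    ≡⟨ altSum-cong {suc r} term ⟩
  altSum (suc r) (λ j → A zero j * det r (minor A j) * det m D)
    ≡⟨ altSum-*ʳ {suc r} (λ j → A zero j * det r (minor A j)) (det m D) ⟩
  altSum (suc r) (λ j → A zero j * det r (minor A j)) * det m D
    ≡⟨ cong (_* det m D) (det-suc r A) ⟨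
  det (suc r) A * det m D ∎
  where
  open ≡-Reasoning
  A : Mat (suc r) (suc r)
  A i j = M (i ↑ˡ m) (j ↑ˡ m)
  D : Mat m m
  D i j = M (suc r ↑ʳ i) (suc r ↑ʳ j)
  term : ∀ j → M zero (j ↑ˡ m) * det (r ℕ.+ m) (minor M (j ↑ˡ m)) ≡ A zero j * det r (minor A j) * det m D
  term j = trans (cong (A zero j *_) (trans (det-block r m (minor M (j ↑ˡ m)) (λ i c → trans (cong (M (suc (i ↑ˡ m))) (punchIn-↑ʳ j c)) (e (suc i) c)))
      (cong₂ _*_ (det-cong (λ i c → cong (M (suc (i ↑ˡ m))) (punchIn-↑ˡ j c m))) (det-cong (λ i c → cong (M (suc (r ↑ʳ i))) (punchIn-↑ʳ j c))))))
    (≡-sym (ℤₚ.*-assoc (A zero j) (det r (minor A j)) (det m D)))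

-- Congruences and Newton's identities

infix 4 _≈[_]_
-- The modulus may be any integer expression, such as `w * w * w * w` or a negative number, and the
-- quotient is explicit so that common factors can be cancelled from `equation`.
record _≈[_]_ (a N b : ℤ) : Set where
  constructor by
  field
    quotient : ℤ
    equation : a ≡ b + quotient * N

≈-reflexive : ∀ {N a b} → a ≡ b → a ≈[ N ] b
≈-reflexive {N} {a} {b} e = by 0ℤ (trans e (≡-sym (ℤₚ.+-identityʳ b)))

≈-refl : ∀ {N a} → a ≈[ N ] a
≈-refl = ≈-reflexive refl

≈-sym : ∀ {N a b} → a ≈[ N ] b → b ≈[ N ] a
≈-sym {N} {a} {b} (by q e) = by (- q) (trans (identity b q N) (cong (_+ - q * N) (≡-sym e)))
  where
  identity : ∀ b q N → b ≡ b + q * N + - q * N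
  identity = solve-∀

≈-trans : ∀ {N a b c} → a ≈[ N ] b → b ≈[ N ] c → a ≈[ N ] c
≈-trans {N} {a} {b} {c} (by q e) (by r f) = by (q + r) (trans e (trans (cong (_+ q * N) f) (identity c q r N)))
  where
  identity : ∀ c q r N → c + r * N + q * N ≡ c + (q + r) * N
  identity = solve-∀

≈-+ : ∀ {N a b c d} → a ≈[ N ] b → c ≈[ N ] d → a + c ≈[ N ] b + d
≈-+ {N} {a} {b} {c} {d} (by q e) (by r f) = by (q + r) (trans (cong₂ _+_ e f) (identity b d q r N))
  where
  identity : ∀ b d q r N → b + q * N + (d + r * N) ≡ b + d + (q + r) * N
  identity = solve-∀

≈-* : ∀ {N a b c d} → a ≈[ N ] b → c ≈[ N ] d → a * c ≈[ N ] b * d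
≈-* {N} {a} {b} {c} {d} (by q e) (by r f) = by (b * r + q * d + q * N * r) (trans (cong₂ _*_ e f) (identity b d q r N))
  where
  identity : ∀ b d q r N → (b + q * N) * (d + r * N) ≡ b * d + (b * r + q * d + q * N * r) * N
  identity = solve-∀

≈-neg : ∀ {N a b} → a ≈[ N ] b → - a ≈[ N ] - b
≈-neg {N} {a} {b} (by q e) = by (- q) (trans (cong -_ e) (identity b q N))
  where
  identity : ∀ b q N → - (b + q * N) ≡ - b + - q * N
  identity = solve-∀

≈-- : ∀ {N a b c d} → a ≈[ N ] b → c ≈[ N ] d → a - c ≈[ N ] b - d
≈-- p q = ≈-+ p (≈-neg q)

≈-scale : ∀ {N a b} c → a ≈[ N ] b → c * a ≈[ c * N ] c * b
≈-scale {N} {a} {b} c (by q e) = by q (trans (cong (c *_) e) (identity c b q N))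
  where
  identity : ∀ c b q N → c * (b + q * N) ≡ c * b + q * (c * N)
  identity = solve-∀

≈-modulus : ∀ {N N′ a b} → N ≡ N′ → a ≈[ N ] b → a ≈[ N′ ] b
≈-modulus refl p = p

∑-≈ : ∀ {m N} {f g : Fin m → ℤ} → (∀ i → f i ≈[ N ] g i) → ∑ f ≈[ N ] ∑ g
∑-≈ {zero}  e = ≈-refl
∑-≈ {suc m} e = ≈-+ (e zero) (∑-≈ (e ∘ suc))

altSum-≈ : ∀ {m N} {f g : Fin m → ℤ} → (∀ i → f i ≈[ N ] g i) → altSum m f ≈[ N ] altSum m g
altSum-≈ {zero}  e = ≈-refl
altSum-≈ {suc m} e = ≈-- (e zero) (altSum-≈ (e ∘ suc))

det-≈ : ∀ {m N} {M M′ : Mat m m} → (∀ i j → M i j ≈[ N ] M′ i j) → det m M ≈[ N ] det m M′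
det-≈ {zero}               e = ≈-refl
det-≈ {suc m} {N} {M} {M′} e = ≈-trans (≈-reflexive (det-suc m M))
  (≈-trans (altSum-≈ {suc m} (λ j → ≈-* (e zero j) (det-≈ (λ r c → e (suc r) (punchIn j c))))) (≈-reflexive (≡-sym (det-suc m M′))))

nat-multiple : ∀ d v → d ≡ v ℕ.* suc d → d ≡ 0
nat-multiple d zero    e = e
nat-multiple d (suc v) e = contradiction (ℕₚ.≤-trans (s≤s (ℕₚ.m≤m+n d (v ℕ.* suc d))) (ℕₚ.≤-reflexive (≡-sym e))) ℕₚ.1+n≰n

-- Only finitely many moduli can divide a nonzero difference.
≈-separated : ∀ {a b} → (∀ v → a ≈[ + suc v ] b) → a ≡ b
≈-separated {a} {b} e with e ℤ.∣ a - b ∣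
... | by q f = ℤₚ.i-j≡0⇒i≡j a b (ℤₚ.∣i∣≡0⇒i≡0 (nat-multiple ℤ.∣ a - b ∣ ℤ.∣ q ∣
  (trans (cong ℤ.∣_∣ (trans (cong (_- b) f) (identity b (q * + suc ℤ.∣ a - b ∣)))) (ℤₚ.abs-* q (+ suc ℤ.∣ a - b ∣)))))
  where
  identity : ∀ b x → b + x - b ≡ x
  identity = solve-∀

-- Gaussian elimination of the first column needs only an inverse `q` of the pivot modulo `N`. The
-- matrix on the right is the Schur complement.
det-eliminate : ∀ {m N} (M : Mat (suc m) (suc m)) q → q * M zero zero ≈[ N ] 1ℤ →
                det (suc m) M ≈[ N ] M zero zero * det m (λ i j → M (suc i) (suc j) - q * M (suc i) zero * M zero (suc j))
det-eliminate {m} {N} M q inverse = ≈-trans (≈-reflexive sheared) (≈-trans (det-≈ clear) (≈-reflexive (det-pivot cleared (λ _ → refl))))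
  where
  a : Fin m → ℤ
  a r = - (q * M (suc r) zero)
  S cleared : Mat (suc m) (suc m)
  S = M zero ◂ (λ r c → M (suc r) c + a r * M zero c)
  cleared = M zero ◂ (λ r → 0ℤ ◂ (λ c → M (suc r) (suc c) - q * M (suc r) zero * M zero (suc c)))
  F = det-alternating (suc m)
  sheared : det (suc m) M ≡ det (suc m) S
  sheared = trans (det-cong {M = M} {M zero ◂ (M ∘ suc)} (λ { zero c → refl ; (suc r) c → refl }))
    (≡-sym (shear (λ N → det (suc m) (M zero ◂ N)) (prepend-multilinear (Alternating.multilinear F) (M zero)) (M zero)
      (λ {N} i e → vanishes F {M zero ◂ N} {suc i} {zero} (λ ()) e) a (M ∘ suc)))
  identity₀ : ∀ x q y → x + - (q * x) * y ≡ x * (1ℤ - q * y)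
  identity₀ = solve-∀
  identity₁ : ∀ x q y z → x + - (q * y) * z ≡ x - q * y * z
  identity₁ = solve-∀
  clear : ∀ i j → S i j ≈[ N ] cleared i j
  clear zero    j       = ≈-refl
  clear (suc r) zero    = ≈-trans (≈-reflexive (identity₀ (M (suc r) zero) q (M zero zero)))
                          (≈-trans (≈-* (≈-refl {a = M (suc r) zero}) (≈-- (≈-refl {a = 1ℤ}) inverse)) (≈-reflexive (ℤₚ.*-zeroʳ (M (suc r) zero))))
  clear (suc r) (suc c) = ≈-reflexive (identity₁ (M (suc r) (suc c)) q (M (suc r) zero) (M zero (suc c)))

tr₁ tr₂ tr₃ : ∀ {m} → Mat m m → ℤ
tr₁ M = ∑ (λ i → M i i)
tr₂ M = ∑ (λ i → ∑ (λ j → M i j * M j i))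
tr₃ M = ∑ (λ i → ∑ (λ j → ∑ (λ k → M i j * M j k * M k i)))

-- Six times the cubic Taylor polynomial of det(1 - wM), by Newton's identities.
newton : ℤ → ℤ → ℤ → ℤ → ℤ
newton w t₁ t₂ t₃ = + 6 - + 6 * (w * t₁) + + 3 * (w * w * (t₁ * t₁ - t₂)) - w * w * w * (t₁ * t₁ * t₁ - + 3 * t₁ * t₂ + + 2 * t₃)

tr₂-suc : ∀ {m} (M : Mat (suc m) (suc m)) →
          let a = M zero zero ; M′ = λ i j → M (suc i) (suc j) ; β = ∑ (λ i → M zero (suc i) * M (suc i) zero)
          in tr₂ M ≡ a * a + + 2 * β + tr₂ M′
tr₂-suc {m} M = trans (cong (_+_ (a * a + β)) (trans (∑-+ (λ i → c i * b i) (λ i → ∑ (λ j → M′ i j * M′ j i)))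
                                                     (cong (_+ tr₂ M′) (∑-cong (λ i → ℤₚ.*-comm (c i) (b i))))))
                      (identity a β (tr₂ M′))
  where
  a = M zero zero
  b c : Fin m → ℤ
  b j = M zero (suc j)
  c i = M (suc i) zero
  M′ : Mat m m
  M′ i j = M (suc i) (suc j)
  β = ∑ (λ i → b i * c i)
  identity : ∀ a β t → a * a + β + (β + t) ≡ a * a + + 2 * β + t
  identity = solve-∀

-- The triples are sorted by how many of their members are the index 0: three give `a * a * a`, two
-- give `a * β` in three rotations, one gives `γ` in three rotations, none gives the trace of `M′`.
tr₃-suc : ∀ {m} (M : Mat (suc m) (suc m)) →
          let a = M zero zero ; M′ = λ i j → M (suc i) (suc j) ; β = ∑ (λ i → M zero (suc i) * M (suc i) zero)
              γ = ∑ (λ i → ∑ (λ j → M zero (suc i) * M′ i j * M (suc j) zero))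
          in tr₃ M ≡ a * a * a + + 3 * (a * β) + + 3 * γ + tr₃ M′
tr₃-suc {m} M = begin
  (a * a * a + ∑ (λ k → a * b k * c k)) + ∑ (λ j → b j * c j * a + ∑ (λ k → b j * M′ j k * c k))
    + ∑ (λ i → (c i * a * b i + ∑ (λ k → c i * b k * M′ k i)) + ∑ (λ j → M′ i j * c j * b i + ∑ (λ k → M′ i j * M′ j k * M′ k i)))
    ≡⟨ cong₂ _+_ (cong₂ _+_ (cong (_+_ (a * a * a)) e₁) e₂) e₃ ⟩
  (a * a * a + a * β) + (a * β + γ) + ((a * β + γ) + (γ + tr₃ M′))
    ≡⟨ identity (a * a * a) (a * β) γ (tr₃ M′) ⟩
  a * a * a + + 3 * (a * β) + + 3 * γ + tr₃ M′ ∎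
  where
  open ≡-Reasoning
  a = M zero zero
  b c : Fin m → ℤ
  b j = M zero (suc j)
  c i = M (suc i) zero
  M′ : Mat m m
  M′ i j = M (suc i) (suc j)
  β = ∑ (λ i → b i * c i)
  γ = ∑ (λ i → ∑ (λ j → b i * M′ i j * c j))
  identity : ∀ x y z t → (x + y) + (y + z) + ((y + z) + (z + t)) ≡ x + + 3 * y + + 3 * z + t
  identity = solve-∀
  p₁ : ∀ a b c → b * c * a ≡ a * (b * c)
  p₁ = solve-∀
  p₂ : ∀ a b c → c * a * b ≡ a * (b * c)
  p₂ = solve-∀
  p₃ : ∀ b c x → c * b * x ≡ b * x * c
  p₃ = solve-∀
  p₄ : ∀ b c x → x * c * b ≡ b * x * c
  p₄ = solve-∀
  e₁ : ∑ (λ k → a * b k * c k) ≡ a * β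
  e₁ = trans (∑-cong (λ k → ℤₚ.*-assoc a (b k) (c k))) (∑-* a (λ k → b k * c k))
  e₂ : ∑ (λ j → b j * c j * a + ∑ (λ k → b j * M′ j k * c k)) ≡ a * β + γ
  e₂ = trans (∑-+ (λ j → b j * c j * a) (λ j → ∑ (λ k → b j * M′ j k * c k)))
             (cong (_+ γ) (trans (∑-cong (λ j → p₁ a (b j) (c j))) (∑-* a (λ k → b k * c k))))
  e₃ : ∑ (λ i → (c i * a * b i + ∑ (λ k → c i * b k * M′ k i)) + ∑ (λ j → M′ i j * c j * b i + ∑ (λ k → M′ i j * M′ j k * M′ k i)))
     ≡ (a * β + γ) + (γ + tr₃ M′)
  e₃ = trans (∑-+ (λ i → c i * a * b i + ∑ (λ k → c i * b k * M′ k i)) (λ i → ∑ (λ j → M′ i j * c j * b i + ∑ (λ k → M′ i j * M′ j k * M′ k i))))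
    (cong₂ _+_
      (trans (∑-+ (λ i → c i * a * b i) (λ i → ∑ (λ k → c i * b k * M′ k i)))
        (cong₂ _+_ (trans (∑-cong (λ i → p₂ a (b i) (c i))) (∑-* a (λ k → b k * c k)))
                   (trans (∑-swap (λ i k → c i * b k * M′ k i)) (∑-cong (λ k → ∑-cong (λ i → p₃ (b k) (c i) (M′ k i)))))))
      (trans (∑-cong (λ i → ∑-+ (λ j → M′ i j * c j * b i) (λ j → ∑ (λ k → M′ i j * M′ j k * M′ k i))))
        (trans (∑-+ (λ i → ∑ (λ j → M′ i j * c j * b i)) (λ i → ∑ (λ j → ∑ (λ k → M′ i j * M′ j k * M′ k i))))
          (cong (_+ tr₃ M′) (∑-cong (λ i → ∑-cong (λ j → p₄ (b i) (c j) (M′ i j))))))))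

-- `X`, `Y`, `Z` stand for the power sums of the eliminated matrix. They enter `newton` with factors
-- `w`, w² and w³, so modulo w⁴ the term `X` is needed modulo w³, `X * X - Y` modulo w², and the
-- cubic expression only modulo `w`. Hence the coarse and the fine expansions of `X` and `Y`.
newton-step : ∀ w a t u v β γ ρ σ x y z {X Y Z} →
  X ≡ t + w * x → X ≡ t + w * β + w * w * (a * β + w * ρ) → Y ≡ u + w * y → Y ≡ u + + 2 * (w * γ) + w * w * σ → Z ≡ v + w * z →
  (1ℤ - w * a) * newton w X Y Z ≈[ w * w * w * w ] newton w (a + t) (a * a + + 2 * β + u) (a * a * a + + 3 * (a * β) + + 3 * γ + v)
newton-step w a t u v β γ ρ σ x y z {X} {Y} {Z} eX eX′ eY eY′ eZ =
  ≈-trans (≈-* (≈-refl {a = 1ℤ - w * a}) truncate) (by (+ 6 * (a * a * β) - a * (+ 6 * (t * β) - + 6 * γ - (t * t * t - + 3 * t * u + + 2 * v))) (expanded w a t u v β γ))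
  where
  N = w * w * w * w
  X² : X * X - Y ≈[ w * w ] t * t + + 2 * (w * (t * β)) - u - + 2 * (w * γ)
  X² = by (β * β + + 2 * (μ * (t + w * β)) + w * w * (μ * μ) - σ)
          (trans (cong₂ (λ X Y → X * X - Y) eX′ eY′) (identity w t u β γ μ σ))
    where
    μ = a * β + w * ρ
    identity : ∀ w t u β γ μ σ → (t + w * β + w * w * μ) * (t + w * β + w * w * μ) - (u + + 2 * (w * γ) + w * w * σ)
      ≡ t * t + + 2 * (w * (t * β)) - u - + 2 * (w * γ) + (β * β + + 2 * (μ * (t + w * β)) + w * w * (μ * μ) - σ) * (w * w)
    identity = solve-∀
  X¹ : X ≈[ w * w * w ] t + w * β + w * w * (a * β)
  X¹ = by ρ (trans eX′ (identity w t β (a * β) ρ))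
    where
    identity : ∀ w t β α ρ → t + w * β + w * w * (α + w * ρ) ≡ t + w * β + w * w * α + ρ * (w * w * w)
    identity = solve-∀
  X³ : X * X * X - + 3 * X * Y + + 2 * Z ≈[ w ] t * t * t - + 3 * t * u + + 2 * v
  X³ = ≈-+ (≈-- (≈-* (≈-* X≈ X≈) X≈) (≈-* (≈-* (≈-refl {a = + 3}) X≈) Y≈)) (≈-* (≈-refl {a = + 2}) Z≈)
    where
    lift : ∀ {A} b c → A ≡ b + w * c → A ≈[ w ] b
    lift b c e = by c (trans e (cong (_+_ b) (ℤₚ.*-comm w c)))
    X≈ = lift t x eX
    Y≈ = lift u y eY
    Z≈ = lift v z eZ
  truncate : newton w X Y Z ≈[ N ] + 6 - + 6 * (w * (t + w * β + w * w * (a * β))) + + 3 * (w * w * (t * t + + 2 * (w * (t * β)) - u - + 2 * (w * γ)))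
                                      - w * w * w * (t * t * t - + 3 * t * u + + 2 * v)
  truncate = ≈-- (≈-+ (≈-- (≈-refl {a = + 6}) (≈-* (≈-refl {a = + 6}) (≈-modulus (m₁ w) (≈-scale w X¹))))
                      (≈-* (≈-refl {a = + 3}) (≈-modulus (m₂ w) (≈-scale (w * w) X²))))
                 (≈-scale (w * w * w) X³)
    where
    m₁ : ∀ w → w * (w * w * w) ≡ w * w * w * w
    m₁ = solve-∀
    m₂ : ∀ w → w * w * (w * w) ≡ w * w * w * w
    m₂ = solve-∀
  expanded : ∀ w a t u v β γ →
    (1ℤ - w * a) * (+ 6 - + 6 * (w * (t + w * β + w * w * (a * β))) + + 3 * (w * w * (t * t + + 2 * (w * (t * β)) - u - + 2 * (w * γ)))
                                    - w * w * w * (t * t * t - + 3 * t * u + + 2 * v))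
    ≡ + 6 - + 6 * (w * (a + t)) + + 3 * (w * w * ((a + t) * (a + t) - (a * a + + 2 * β + u)))
      - w * w * w * ((a + t) * (a + t) * (a + t) - + 3 * (a + t) * (a * a + + 2 * β + u) + + 2 * (a * a * a + + 3 * (a * β) + + 3 * γ + v))
      + (+ 6 * (a * a * β) - a * (+ 6 * (t * β) - + 6 * γ - (t * t * t - + 3 * t * u + + 2 * v))) * (w * w * w * w)
  expanded = solve-∀

-- One Schur elimination step modulo w⁴ replaces M by M′ + w q c b, where q inverts 1 - wa.
det-newton : ∀ {m} w (M : Mat m m) → + 6 * det m (λ i j → δ i j - w * M i j) ≈[ w * w * w * w ] newton w (tr₁ M) (tr₂ M) (tr₃ M)
det-newton {zero}  w M = ≈-reflexive (base w)
  where
  base : ∀ w → + 6 * 1ℤ ≡ + 6 - + 6 * (w * 0ℤ) + + 3 * (w * w * (0ℤ * 0ℤ - 0ℤ)) - w * w * w * (0ℤ * 0ℤ * 0ℤ - + 3 * 0ℤ * 0ℤ + + 2 * 0ℤ)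
  base = solve-∀
det-newton {suc m} w M =
  ≈-trans (≈-* (≈-refl {a = + 6}) (det-eliminate (λ i j → δ i j - w * M i j) q inverse))
  (≈-trans (≈-reflexive (trans (pull (1ℤ - w * a) _) (cong (λ z → (1ℤ - w * a) * (+ 6 * z)) (det-cong entries))))
  (≈-trans (≈-* (≈-refl {a = 1ℤ - w * a}) (det-newton w M″))
  (≈-trans (newton-step w a (tr₁ M′) (tr₂ M′) (tr₃ M′) β γ ((a * a + w * a * a * a) * β) σ (q * β) (q * (γ + γ) + w * D) (quotient tr₃″)
             tr₁″ (trans tr₁″ (q-expand w a (tr₁ M′) β)) tr₂″ (trans tr₂″ (q-expand₂ w a (tr₂ M′) γ D)) (trans (equation tr₃″) (cong (_+_ (tr₃ M′)) (ℤₚ.*-comm (quotient tr₃″) w))))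
           (≈-reflexive (cong₂ (newton w (a + tr₁ M′)) (≡-sym (tr₂-suc M)) (≡-sym (tr₃-suc M)))))))
  where
  open _≈[_]_
  a = M zero zero
  b c : Fin m → ℤ
  b j = M zero (suc j)
  c i = M (suc i) zero
  M′ M″ : Mat m m
  M′ i j = M (suc i) (suc j)
  -- The geometric series of 1 / (1 - wa) up to w³, grouped so that the part beyond first order is
  -- visibly a multiple of w².
  q = 1ℤ + w * a + w * w * (a * a + w * a * a * a)
  M″ i j = M′ i j + w * (q * (c i * b j))
  β = ∑ (λ i → b i * c i)
  γ = ∑ (λ i → ∑ (λ j → b i * M′ i j * c j))
  pull : ∀ p d → + 6 * (p * d) ≡ p * (+ 6 * d)
  pull = solve-∀
  inverse : q * (1ℤ - w * a) ≈[ w * w * w * w ] 1ℤ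
  inverse = by (- (a * a * a * a)) (identity w a)
    where
    identity : ∀ w a → (1ℤ + w * a + w * w * (a * a + w * a * a * a)) * (1ℤ - w * a) ≡ 1ℤ + - (a * a * a * a) * (w * w * w * w)
    identity = solve-∀
  entries : ∀ i j → δ i j - w * M′ i j - q * (0ℤ - w * c i) * (0ℤ - w * b j) ≡ δ i j - w * M″ i j
  entries i j = identity (δ i j) w (M′ i j) q (c i) (b j)
    where
    identity : ∀ d w x q c b → d - w * x - q * (0ℤ - w * c) * (0ℤ - w * b) ≡ d - w * (x + w * (q * (c * b)))
    identity = solve-∀
  tr₁″ : tr₁ M″ ≡ tr₁ M′ + w * (q * β)
  tr₁″ = trans (∑-+ (λ i → M′ i i) (λ i → w * (q * (c i * b i)))) (cong (_+_ (tr₁ M′))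
    (trans (∑-* w (λ i → q * (c i * b i))) (cong (w *_) (trans (∑-* q (λ i → c i * b i)) (cong (q *_) (∑-cong (λ i → ℤₚ.*-comm (c i) (b i))))))))
  q-expand : ∀ w a t β → t + w * ((1ℤ + w * a + w * w * (a * a + w * a * a * a)) * β) ≡ t + w * β + w * w * (a * β + w * ((a * a + w * a * a * a) * β))
  q-expand = solve-∀
  D = ∑ (λ i → ∑ (λ j → q * (c i * b j) * (q * (c j * b i))))
  tr₂″ : tr₂ M″ ≡ tr₂ M′ + w * (q * (γ + γ) + w * D)
  tr₂″ = begin
    ∑ (λ i → ∑ (λ j → M″ i j * M″ j i))
      ≡⟨ ∑-cong (λ i → ∑-cong (λ j → expand (M′ i j) (M′ j i) w q (c i) (b j) (c j) (b i))) ⟩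
    ∑ (λ i → ∑ (λ j → M′ i j * M′ j i + w * (q * (b j * M′ j i * c i + b i * M′ i j * c j) + w * (q * (c i * b j) * (q * (c j * b i))))))
      ≡⟨ ∑∑-+ (λ i j → M′ i j * M′ j i) (λ i j → w * (q * (b j * M′ j i * c i + b i * M′ i j * c j) + w * (q * (c i * b j) * (q * (c j * b i))))) ⟩
    tr₂ M′ + ∑ (λ i → ∑ (λ j → w * (q * (b j * M′ j i * c i + b i * M′ i j * c j) + w * (q * (c i * b j) * (q * (c j * b i))))))
      ≡⟨ cong (_+_ (tr₂ M′)) (trans (∑∑-* w (λ i j → q * (b j * M′ j i * c i + b i * M′ i j * c j) + w * (q * (c i * b j) * (q * (c j * b i)))))
           (cong (w *_) (trans (∑∑-+ (λ i j → q * (b j * M′ j i * c i + b i * M′ i j * c j)) (λ i j → w * (q * (c i * b j) * (q * (c j * b i)))))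
             (cong₂ _+_ (trans (∑∑-* q (λ i j → b j * M′ j i * c i + b i * M′ i j * c j)) (cong (q *_)
                           (trans (∑∑-+ (λ i j → b j * M′ j i * c i) (λ i j → b i * M′ i j * c j)) (cong (_+ γ) (∑-swap (λ i j → b j * M′ j i * c i))))))
                        (∑∑-* w (λ i j → q * (c i * b j) * (q * (c j * b i)))))))) ⟩
    tr₂ M′ + w * (q * (γ + γ) + w * D) ∎
    where
    open ≡-Reasoning
    expand : ∀ x y w q ci bj cj bi → (x + w * (q * (ci * bj))) * (y + w * (q * (cj * bi)))
           ≡ x * y + w * (q * (bj * y * ci + bi * x * cj) + w * (q * (ci * bj) * (q * (cj * bi))))
    expand = solve-∀
    ∑∑-+ : ∀ (f g : Mat m m) → ∑ (λ i → ∑ (λ j → f i j + g i j)) ≡ ∑ (λ i → ∑ (f i)) + ∑ (λ i → ∑ (g i))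
    ∑∑-+ f g = trans (∑-cong (λ i → ∑-+ (f i) (g i))) (∑-+ (λ i → ∑ (f i)) (λ i → ∑ (g i)))
    ∑∑-* : ∀ x (f : Mat m m) → ∑ (λ i → ∑ (λ j → x * f i j)) ≡ x * ∑ (λ i → ∑ (f i))
    ∑∑-* x f = trans (∑-cong (λ i → ∑-* x (f i))) (∑-* x (λ i → ∑ (f i)))
  σ = (a + w * (a * a + w * a * a * a)) * (γ + γ) + D
  q-expand₂ : ∀ w a u γ D → u + w * ((1ℤ + w * a + w * w * (a * a + w * a * a * a)) * (γ + γ) + w * D)
            ≡ u + + 2 * (w * γ) + w * w * ((a + w * (a * a + w * a * a * a)) * (γ + γ) + D)
  q-expand₂ = solve-∀
  tr₃″ : tr₃ M″ ≈[ w ] tr₃ M′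
  tr₃″ = ∑-≈ (λ i → ∑-≈ (λ j → ∑-≈ (λ k → ≈-* (≈-* (near i j) (near j k)) (near k i))))
    where
    near : ∀ i j → M″ i j ≈[ w ] M′ i j
    near i j = by (q * (c i * b j)) (cong (_+_ (M′ i j)) (ℤₚ.*-comm w (q * (c i * b j))))

-- Laplacian moments

sumFinℕ-∑ : ∀ m (f : Fin m → ℕ) → + sumFinℕ m f ≡ ∑ (λ i → + f i)
sumFinℕ-∑ zero    f = refl
sumFinℕ-∑ (suc m) f = trans (ℤₚ.pos-+ (f zero) (sumFinℕ m (f ∘ suc))) (cong (_+_ (+ f zero)) (sumFinℕ-∑ m (f ∘ suc)))

module _ (G : Graph) where

  𝒟 : Fin (n G) → ℤ
  𝒟 i = + deg G i

  𝒜 ℒ : Mat (n G) (n G)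
  𝒜 i j = if adj G i j then 1ℤ else 0ℤ
  ℒ i j = 𝒟 i * δ i j - 𝒜 i j

  triangles : ℤ
  triangles = ∑ (λ i → ∑ (λ j → ∑ (λ k → 𝒜 i j * 𝒜 j k * 𝒜 k i)))

  P : ℤ → ℤ → ℤ
  P s u = det (n G) (λ i j → s * δ i j - u * ℒ i j)

  𝒜-diag : ∀ i → 𝒜 i i ≡ 0ℤ
  𝒜-diag i = cong (λ b → if b then 1ℤ else 0ℤ) (irrefl G i)

  𝒜-sym : ∀ i j → 𝒜 i j ≡ 𝒜 j i
  𝒜-sym i j = cong (λ b → if b then 1ℤ else 0ℤ) (sym G i j)

  𝒜-idem : ∀ i j → 𝒜 i j * 𝒜 j i ≡ 𝒜 i j
  𝒜-idem i j = trans (cong (𝒜 i j *_) (≡-sym (𝒜-sym i j))) idem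
    where
    idem : 𝒜 i j * 𝒜 i j ≡ 𝒜 i j
    idem with adj G i j
    ... | true  = refl
    ... | false = refl

  𝒟-∑ : ∀ i → 𝒟 i ≡ ∑ (𝒜 i)
  𝒟-∑ i = trans (sumFinℕ-∑ (n G) _) (∑-cong lift)
    where
    lift : ∀ j → + (if adj G i j then 1 else 0) ≡ 𝒜 i j
    lift j with adj G i j
    ... | true  = refl
    ... | false = refl

  adj⇒≢ : ∀ {i j} → adj G i j ≡ true → i ≢ j
  adj⇒≢ {i} e refl = case trans (≡-sym e) (irrefl G i) of λ ()

  ℒ-diag : ∀ i → ℒ i i ≡ 𝒟 i
  ℒ-diag i = trans (cong₂ (λ x y → 𝒟 i * x - y) (δ-refl i) (𝒜-diag i)) (identity (𝒟 i))
    where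
    identity : ∀ d → d * 1ℤ - 0ℤ ≡ d
    identity = solve-∀

  laplacian-ℒ : ∀ i j → laplacian G i j ≡ ℒ i j
  laplacian-ℒ i j with i Fin.≟ j
  ... | yes refl = ≡-sym (ℒ-diag i)
  ... | no i≢j = trans negated (≡-sym (trans (cong (λ x → 𝒟 i * x - 𝒜 i j) (δ-≢ i≢j)) (identity (𝒟 i) (𝒜 i j))))
    where
    identity : ∀ d a → d * 0ℤ - a ≡ - a
    identity = solve-∀
    negated : (if adj G i j then - 1ℤ else 0ℤ) ≡ - 𝒜 i j
    negated with adj G i j
    ... | true  = refl
    ... | false = refl

  charPoly-P : ∀ t → charPolyL G t ≡ P t 1ℤ
  charPoly-P t = det-cong (λ i j → cong₂ _-_ (diagonal i j) (trans (laplacian-ℒ i j) (≡-sym (ℤₚ.*-identityˡ (ℒ i j)))))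
    where
    diagonal : ∀ i j → (if ⌊ i Fin.≟ j ⌋ then t else 0ℤ) ≡ t * δ i j
    diagonal i j with i Fin.≟ j
    ... | yes refl = ≡-sym (trans (cong (t *_) (δ-refl i)) (ℤₚ.*-identityʳ t))
    ... | no i≢j   = ≡-sym (trans (cong (t *_) (δ-≢ i≢j)) (ℤₚ.*-zeroʳ t))

  𝒜ℒ : ∀ i j → 𝒜 i j * ℒ j i ≡ - 𝒜 i j
  𝒜ℒ i j = trans (expand (𝒜 i j) (𝒟 j) (δ j i) (𝒜 j i)) (trans (cong₂ (λ x y → 𝒟 j * x - y) (off i j) (𝒜-idem i j)) (identity (𝒟 j) (𝒜 i j)))
    where
    expand : ∀ a d x b → a * (d * x - b) ≡ d * (a * x) - a * b
    expand = solve-∀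
    identity : ∀ d a → d * 0ℤ - a ≡ - a
    identity = solve-∀
    off : ∀ i j → 𝒜 i j * δ j i ≡ 0ℤ
    off i j with i Fin.≟ j
    ... | yes refl = cong (_* δ i i) (𝒜-diag i)
    ... | no i≢j   = trans (cong (𝒜 i j *_) (δ-≢ (i≢j ∘ ≡-sym))) (ℤₚ.*-zeroʳ (𝒜 i j))

  ℒ-apply : ∀ i (x : Fin (n G) → ℤ) → ∑ (λ j → ℒ i j * x j) ≡ 𝒟 i * x i - ∑ (λ j → 𝒜 i j * x j)
  ℒ-apply i x = begin
    ∑ (λ j → ℒ i j * x j)                                        ≡⟨ ∑-cong (λ j → expand (𝒟 i) (δ i j) (𝒜 i j) (x j)) ⟩
    ∑ (λ j → 𝒟 i * x j * δ i j + -1ℤ * (𝒜 i j * x j))            ≡⟨ ∑-+ (λ j → 𝒟 i * x j * δ i j) (λ j → -1ℤ * (𝒜 i j * x j)) ⟩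
    ∑ (λ j → 𝒟 i * x j * δ i j) + ∑ (λ j → -1ℤ * (𝒜 i j * x j)) ≡⟨ cong₂ _+_ (∑-δ i (λ j → 𝒟 i * x j)) (trans (∑-* -1ℤ (λ j → 𝒜 i j * x j)) (ℤₚ.-1*i≡-i _)) ⟩
    𝒟 i * x i - ∑ (λ j → 𝒜 i j * x j)                           ∎
    where
    open ≡-Reasoning
    expand : ∀ d e a x → (d * e - a) * x ≡ d * x * e + -1ℤ * (a * x)
    expand = solve-∀

  ∑𝒜ℒ : ∀ i → ∑ (λ j → 𝒜 i j * ℒ j i) ≡ - 𝒟 i
  ∑𝒜ℒ i = trans (∑-cong (λ j → trans (𝒜ℒ i j) (≡-sym (ℤₚ.-1*i≡-i (𝒜 i j))))) (trans (∑-* -1ℤ (𝒜 i)) (trans (ℤₚ.-1*i≡-i _) (cong -_ (≡-sym (𝒟-∑ i)))))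

  square : ∀ i → ∑ (λ j → ℒ i j * ℒ j i) ≡ 𝒟 i * 𝒟 i + 𝒟 i
  square i = trans (ℒ-apply i (λ j → ℒ j i)) (trans (cong₂ (λ x y → 𝒟 i * x - y) (ℒ-diag i) (∑𝒜ℒ i)) (identity (𝒟 i)))
    where
    identity : ∀ d → d * d - - d ≡ d * d + d
    identity = solve-∀

  Σ𝒟² Σ𝒟³ : ℤ
  Σ𝒟² = ∑ (λ i → 𝒟 i * 𝒟 i)
  Σ𝒟³ = ∑ (λ i → 𝒟 i * 𝒟 i * 𝒟 i)

  tr₁-ℒ : tr₁ ℒ ≡ ∑ 𝒟
  tr₁-ℒ = ∑-cong ℒ-diag

  tr₂-ℒ : tr₂ ℒ ≡ Σ𝒟² + ∑ 𝒟
  tr₂-ℒ = trans (∑-cong square) (∑-+ (λ i → 𝒟 i * 𝒟 i) 𝒟)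

  -- In tr (D - A)³ the terms of type D²A vanish, because A has zero diagonal. The three of type DA²
  -- give Σ d² each, because A² has diagonal D.
  tr₃-ℒ : tr₃ ℒ ≡ Σ𝒟³ + + 3 * Σ𝒟² - triangles
  tr₃-ℒ = begin
    ∑ (λ i → ∑ (λ j → ∑ (λ k → ℒ i j * ℒ j k * ℒ k i)))
      ≡⟨ ∑-cong (λ i → ∑-cong (λ j → trans (∑-cong (λ k → ℤₚ.*-assoc (ℒ i j) (ℒ j k) (ℒ k i))) (∑-* (ℒ i j) (λ k → ℒ j k * ℒ k i)))) ⟩
    ∑ (λ i → ∑ (λ j → ℒ i j * S j i))
      ≡⟨ ∑-cong (λ i → trans (ℒ-apply i (λ j → S j i)) (cong (λ z → 𝒟 i * z - ∑ (λ j → 𝒜 i j * S j i)) (square i))) ⟩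
    ∑ (λ i → 𝒟 i * (𝒟 i * 𝒟 i + 𝒟 i) - ∑ (λ j → 𝒜 i j * S j i))
      ≡⟨ ∑-cong (λ i → trans (cong (_-_ (𝒟 i * (𝒟 i * 𝒟 i + 𝒟 i))) (inner i)) (collect (𝒟 i) (∑ (λ j → 𝒟 j * 𝒜 i j)) (T i))) ⟩
    ∑ (λ i → (𝒟 i * 𝒟 i * 𝒟 i + + 2 * (𝒟 i * 𝒟 i)) + (∑ (λ j → 𝒟 j * 𝒜 i j) + -1ℤ * T i))
      ≡⟨ ∑-+ (λ i → 𝒟 i * 𝒟 i * 𝒟 i + + 2 * (𝒟 i * 𝒟 i)) (λ i → ∑ (λ j → 𝒟 j * 𝒜 i j) + -1ℤ * T i) ⟩
    ∑ (λ i → 𝒟 i * 𝒟 i * 𝒟 i + + 2 * (𝒟 i * 𝒟 i)) + ∑ (λ i → ∑ (λ j → 𝒟 j * 𝒜 i j) + -1ℤ * T i)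
      ≡⟨ cong₂ _+_ (trans (∑-+ (λ i → 𝒟 i * 𝒟 i * 𝒟 i) (λ i → + 2 * (𝒟 i * 𝒟 i))) (cong (_+_ Σ𝒟³) (∑-* (+ 2) (λ i → 𝒟 i * 𝒟 i))))
                   (trans (∑-+ (λ i → ∑ (λ j → 𝒟 j * 𝒜 i j)) (λ i → -1ℤ * T i)) (cong₂ _+_ columns (∑-* -1ℤ T))) ⟩
    (Σ𝒟³ + + 2 * Σ𝒟²) + (Σ𝒟² + -1ℤ * ∑ T)
      ≡⟨ cong (λ z → (Σ𝒟³ + + 2 * Σ𝒟²) + (Σ𝒟² + -1ℤ * z)) (∑-cong (λ i → ∑-cong (λ j →
           trans (≡-sym (∑-* (𝒜 i j) (λ k → 𝒜 j k * 𝒜 k i))) (∑-cong (λ k → ≡-sym (ℤₚ.*-assoc (𝒜 i j) (𝒜 j k) (𝒜 k i))))))) ⟩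
    (Σ𝒟³ + + 2 * Σ𝒟²) + (Σ𝒟² + -1ℤ * triangles)
      ≡⟨ total Σ𝒟³ Σ𝒟² triangles ⟩
    Σ𝒟³ + + 3 * Σ𝒟² - triangles ∎
    where
    open ≡-Reasoning
    S : Mat (n G) (n G)
    S j i = ∑ (λ k → ℒ j k * ℒ k i)
    T : Fin (n G) → ℤ
    T i = ∑ (λ j → 𝒜 i j * ∑ (λ k → 𝒜 j k * 𝒜 k i))
    total : ∀ x y t → (x + + 2 * y) + (y + -1ℤ * t) ≡ x + + 3 * y - t
    total = solve-∀
    collect : ∀ d s t → d * (d * d + d) - (-1ℤ * s + (- (d * d) + t)) ≡ (d * d * d + + 2 * (d * d)) + (s + -1ℤ * t)
    collect = solve-∀
    columns : ∑ (λ i → ∑ (λ j → 𝒟 j * 𝒜 i j)) ≡ Σ𝒟²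
    columns = trans (∑-swap (λ i j → 𝒟 j * 𝒜 i j)) (∑-cong (λ j → trans (∑-* (𝒟 j) (λ i → 𝒜 i j))
                (cong (𝒟 j *_) (trans (∑-cong (λ i → 𝒜-sym i j)) (≡-sym (𝒟-∑ j))))))
    ∑𝒜ℒ′ : ∀ j i → ∑ (λ k → 𝒜 j k * ℒ k i) ≡ 𝒜 j i * 𝒟 i - ∑ (λ k → 𝒜 j k * 𝒜 k i)
    ∑𝒜ℒ′ j i = begin
      ∑ (λ k → 𝒜 j k * ℒ k i)
        ≡⟨ ∑-cong (λ k → trans (cong (λ z → 𝒜 j k * (𝒟 k * z - 𝒜 k i)) (δ-sym k i)) (split (𝒜 j k) (𝒟 k) (δ i k) (𝒜 k i))) ⟩
      ∑ (λ k → 𝒜 j k * 𝒟 k * δ i k + -1ℤ * (𝒜 j k * 𝒜 k i))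
        ≡⟨ ∑-+ (λ k → 𝒜 j k * 𝒟 k * δ i k) (λ k → -1ℤ * (𝒜 j k * 𝒜 k i)) ⟩
      ∑ (λ k → 𝒜 j k * 𝒟 k * δ i k) + ∑ (λ k → -1ℤ * (𝒜 j k * 𝒜 k i))
        ≡⟨ cong₂ _+_ (∑-δ i (λ k → 𝒜 j k * 𝒟 k)) (trans (∑-* -1ℤ (λ k → 𝒜 j k * 𝒜 k i)) (ℤₚ.-1*i≡-i _)) ⟩
      𝒜 j i * 𝒟 i - ∑ (λ k → 𝒜 j k * 𝒜 k i) ∎
      where
      split : ∀ a d e b → a * (d * e - b) ≡ a * d * e + -1ℤ * (a * b)
      split = solve-∀
    inner : ∀ i → ∑ (λ j → 𝒜 i j * S j i) ≡ -1ℤ * ∑ (λ j → 𝒟 j * 𝒜 i j) + (- (𝒟 i * 𝒟 i) + T i)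
    inner i = begin
      ∑ (λ j → 𝒜 i j * S j i)
        ≡⟨ ∑-cong (λ j → trans (cong (𝒜 i j *_) (trans (ℒ-apply j (λ k → ℒ k i)) (cong (_-_ (𝒟 j * ℒ j i)) (∑𝒜ℒ′ j i))))
             (trans (expand (𝒜 i j) (𝒟 j) (ℒ j i) (𝒜 j i) (𝒟 i) (∑ (λ k → 𝒜 j k * 𝒜 k i)))
               (trans (cong₂ (λ x y → 𝒟 j * x - 𝒟 i * y + 𝒜 i j * ∑ (λ k → 𝒜 j k * 𝒜 k i)) (𝒜ℒ i j) (𝒜-idem i j))
                 (tidy (𝒟 j) (𝒟 i) (𝒜 i j) (𝒜 i j * ∑ (λ k → 𝒜 j k * 𝒜 k i)))))) ⟩
      ∑ (λ j → -1ℤ * (𝒟 j * 𝒜 i j) + (- 𝒟 i * 𝒜 i j + 𝒜 i j * ∑ (λ k → 𝒜 j k * 𝒜 k i)))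
        ≡⟨ ∑-+ (λ j → -1ℤ * (𝒟 j * 𝒜 i j)) (λ j → - 𝒟 i * 𝒜 i j + 𝒜 i j * ∑ (λ k → 𝒜 j k * 𝒜 k i)) ⟩
      ∑ (λ j → -1ℤ * (𝒟 j * 𝒜 i j)) + ∑ (λ j → - 𝒟 i * 𝒜 i j + 𝒜 i j * ∑ (λ k → 𝒜 j k * 𝒜 k i))
        ≡⟨ cong₂ _+_ (∑-* -1ℤ (λ j → 𝒟 j * 𝒜 i j))
             (trans (∑-+ (λ j → - 𝒟 i * 𝒜 i j) (λ j → 𝒜 i j * ∑ (λ k → 𝒜 j k * 𝒜 k i)))
               (cong (_+ T i) (trans (∑-* (- 𝒟 i) (𝒜 i)) (trans (cong (- 𝒟 i *_) (≡-sym (𝒟-∑ i))) (≡-sym (ℤₚ.neg-distribˡ-* (𝒟 i) (𝒟 i))))))) ⟩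
      -1ℤ * ∑ (λ j → 𝒟 j * 𝒜 i j) + (- (𝒟 i * 𝒟 i) + T i) ∎
      where
      expand : ∀ a d l b e s → a * (d * l - (b * e - s)) ≡ d * (a * l) - e * (a * b) + a * s
      expand = solve-∀
      tidy : ∀ d e a s → d * - a - e * a + s ≡ -1ℤ * (d * a) + (- e * a + s)
      tidy = solve-∀


*-cancelˡ : ∀ a {x y} .{{_ : ℤ.NonZero a}} → a * x ≡ a * y → x ≡ y
*-cancelˡ a {x} {y} e = ℤₚ.*-cancelˡ-≡ a x y e

-- The coefficients of w, w² and w³ are compared in turn. Once the lower ones agree, cancelling the
-- power of `w` leaves a congruence modulo every positive `w`, hence an equality.
newton-injective : ∀ {t₁ t₂ t₃ t₁′ t₂′ t₃′} →
  (∀ w → newton w t₁ t₂ t₃ ≈[ w * w * w * w ] newton w t₁′ t₂′ t₃′) → t₁ ≡ t₁′ × t₂ ≡ t₂′ × t₃ ≡ t₃′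
newton-injective {t₁} {t₂} {t₃} {t₁′} {t₂′} {t₃′} e = first , second , third
  where
  C = λ t₁ t₂ t₃ → t₁ * t₁ * t₁ - + 3 * t₁ * t₂ + + 2 * t₃
  first : t₁ ≡ t₁′
  first = *-cancelˡ (+ 6) {t₁} {t₁′} (≈-separated {_} {_} (λ v → reduce (+ suc v) (e (+ suc v))))
    where
    reduce : ∀ w .{{_ : ℤ.NonZero w}} → newton w t₁ t₂ t₃ ≈[ w * w * w * w ] newton w t₁′ t₂′ t₃′ → + 6 * t₁ ≈[ w ] + 6 * t₁′
    reduce w (by q f) = by (Y - Y′ - q * w * w) (*-cancelˡ w (rearrange w t₁ t₁′ (t₁ * t₁ - t₂) (t₁′ * t₁′ - t₂′) (C t₁ t₂ t₃) (C t₁′ t₂′ t₃′) q f))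
      where
      Y = + 3 * (t₁ * t₁ - t₂) - w * C t₁ t₂ t₃
      Y′ = + 3 * (t₁′ * t₁′ - t₂′) - w * C t₁′ t₂′ t₃′
      rearrange : ∀ w a a′ b b′ c c′ q →
        + 6 - + 6 * (w * a) + + 3 * (w * w * b) - w * w * w * c ≡ + 6 - + 6 * (w * a′) + + 3 * (w * w * b′) - w * w * w * c′ + q * (w * w * w * w) →
        w * (+ 6 * a) ≡ w * (+ 6 * a′ + ((+ 3 * b - w * c) - (+ 3 * b′ - w * c′) - q * w * w) * w)
      rearrange w a a′ b b′ c c′ q f = trans (lhs w a b c) (trans (cong (λ z → + 6 + + 3 * (w * w * b) - w * w * w * c - z) f) (rhs w a′ b b′ c c′ q))
        where
        lhs : ∀ w a b c → w * (+ 6 * a) ≡ + 6 + + 3 * (w * w * b) - w * w * w * c - (+ 6 - + 6 * (w * a) + + 3 * (w * w * b) - w * w * w * c)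
        lhs = solve-∀
        rhs : ∀ w a′ b b′ c c′ q → + 6 + + 3 * (w * w * b) - w * w * w * c - (+ 6 - + 6 * (w * a′) + + 3 * (w * w * b′) - w * w * w * c′ + q * (w * w * w * w))
            ≡ w * (+ 6 * a′ + ((+ 3 * b - w * c) - (+ 3 * b′ - w * c′) - q * w * w) * w)
        rhs = solve-∀
  second : t₂ ≡ t₂′
  second = *-cancelˡ (+ 3) {t₂} {t₂′} (≈-separated {_} {_} (λ v → reduce (+ suc v) (e (+ suc v))))
    where
    reduce : ∀ w .{{_ : ℤ.NonZero w}} → newton w t₁ t₂ t₃ ≈[ w * w * w * w ] newton w t₁′ t₂′ t₃′ → + 3 * t₂ ≈[ w ] + 3 * t₂′
    reduce w (by q f) = by (C t₁′ t₂′ t₃′ - C t₁′ t₂ t₃ - q * w) (*-cancelˡ w {+ 3 * t₂} (*-cancelˡ w {w * (+ 3 * t₂)} (rearrange w t₁′ t₂ t₂′ (C t₁′ t₂ t₃) (C t₁′ t₂′ t₃′) q (trans (cong (λ t → newton w t t₂ t₃) (≡-sym first)) f))))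
      where
      rearrange : ∀ w a b b′ c c′ q →
        + 6 - + 6 * (w * a) + + 3 * (w * w * (a * a - b)) - w * w * w * c ≡ + 6 - + 6 * (w * a) + + 3 * (w * w * (a * a - b′)) - w * w * w * c′ + q * (w * w * w * w) →
        w * (w * (+ 3 * b)) ≡ w * (w * (+ 3 * b′ + (c′ - c - q * w) * w))
      rearrange w a b b′ c c′ q f = trans (lhs w a b c) (trans (cong (λ z → + 6 - + 6 * (w * a) + + 3 * (w * w * (a * a)) - w * w * w * c - z) f) (rhs w a b′ c c′ q))
        where
        lhs : ∀ w a b c → w * (w * (+ 3 * b)) ≡ + 6 - + 6 * (w * a) + + 3 * (w * w * (a * a)) - w * w * w * c - (+ 6 - + 6 * (w * a) + + 3 * (w * w * (a * a - b)) - w * w * w * c)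
        lhs = solve-∀
        rhs : ∀ w a b′ c c′ q → + 6 - + 6 * (w * a) + + 3 * (w * w * (a * a)) - w * w * w * c - (+ 6 - + 6 * (w * a) + + 3 * (w * w * (a * a - b′)) - w * w * w * c′ + q * (w * w * w * w))
            ≡ w * (w * (+ 3 * b′ + (c′ - c - q * w) * w))
        rhs = solve-∀
  third : t₃ ≡ t₃′
  third = *-cancelˡ (+ 2) {t₃} {t₃′} (≈-separated {_} {_} (λ v → reduce (+ suc v) (e (+ suc v))))
    where
    reduce : ∀ w .{{_ : ℤ.NonZero w}} → newton w t₁ t₂ t₃ ≈[ w * w * w * w ] newton w t₁′ t₂′ t₃′ → + 2 * t₃ ≈[ w ] + 2 * t₃′
    reduce w (by q f) = by (- q) (*-cancelˡ w {+ 2 * t₃} (*-cancelˡ w {w * (+ 2 * t₃)} (*-cancelˡ w {w * (w * (+ 2 * t₃))} (rearrange w t₁′ t₂′ t₃ t₃′ q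
                     (trans (cong₂ (λ x y → newton w x y t₃) (≡-sym first) (≡-sym second)) f)))))
      where
      rearrange : ∀ w a b c c′ q → newton w a b c ≡ newton w a b c′ + q * (w * w * w * w) →
        w * (w * (w * (+ 2 * c))) ≡ w * (w * (w * (+ 2 * c′ + - q * w)))
      rearrange w a b c c′ q f = trans (lhs w a b c) (trans (cong (λ z → newton w a b 0ℤ - z) f) (rhs w a b c′ q))
        where
        lhs : ∀ w a b c → w * (w * (w * (+ 2 * c))) ≡ (+ 6 - + 6 * (w * a) + + 3 * (w * w * (a * a - b)) - w * w * w * (a * a * a - + 3 * a * b + + 2 * 0ℤ))
                   - (+ 6 - + 6 * (w * a) + + 3 * (w * w * (a * a - b)) - w * w * w * (a * a * a - + 3 * a * b + + 2 * c))
        lhs = solve-∀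
        rhs : ∀ w a b c′ q → (+ 6 - + 6 * (w * a) + + 3 * (w * w * (a * a - b)) - w * w * w * (a * a * a - + 3 * a * b + + 2 * 0ℤ))
                   - ((+ 6 - + 6 * (w * a) + + 3 * (w * w * (a * a - b)) - w * w * w * (a * a * a - + 3 * a * b + + 2 * c′)) + q * (w * w * w * w))
            ≡ w * (w * (w * (+ 2 * c′ + - q * w)))
        rhs = solve-∀

same-moments : ∀ G H → (∀ s u → P G s u ≡ P H s u) →
               ∑ (𝒟 G) ≡ ∑ (𝒟 H) × Σ𝒟² G ≡ Σ𝒟² H × Σ𝒟³ G - triangles G ≡ Σ𝒟³ H - triangles H
same-moments G H e = s₁ , s₂ , s₃
  where
  taylor : ∀ G w → + 6 * P G 1ℤ w ≈[ w * w * w * w ] newton w (tr₁ (ℒ G)) (tr₂ (ℒ G)) (tr₃ (ℒ G))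
  taylor G w = ≈-trans (≈-reflexive (cong (+ 6 *_) (det-cong (λ i j → cong (_- w * ℒ G i j) (ℤₚ.*-identityˡ (δ i j)))))) (det-newton w (ℒ G))
  traces = newton-injective {tr₁ (ℒ G)} {tr₂ (ℒ G)} {tr₃ (ℒ G)} {tr₁ (ℒ H)} {tr₂ (ℒ H)} {tr₃ (ℒ H)}
    (λ w → ≈-trans (≈-sym (taylor G w)) (≈-trans (≈-reflexive (cong (+ 6 *_) (e 1ℤ w))) (taylor H w)))
  t₁ = proj₁ traces
  t₂ = proj₁ (proj₂ traces)
  t₃ = proj₂ (proj₂ traces)
  s₁ : ∑ (𝒟 G) ≡ ∑ (𝒟 H)
  s₁ = trans (≡-sym (tr₁-ℒ G)) (trans t₁ (tr₁-ℒ H))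
  s₂ : Σ𝒟² G ≡ Σ𝒟² H
  s₂ = cancel (Σ𝒟² G) (∑ (𝒟 G)) (Σ𝒟² H) (∑ (𝒟 H)) s₁ (trans (≡-sym (tr₂-ℒ G)) (trans t₂ (tr₂-ℒ H)))
    where
    drop : ∀ x y → x ≡ x + y - y
    drop = solve-∀
    cancel : ∀ a b a′ b′ → b ≡ b′ → a + b ≡ a′ + b′ → a ≡ a′
    cancel a b a′ b′ refl f = trans (drop a b) (trans (cong (_- b) f) (≡-sym (drop a′ b)))
  s₃ : Σ𝒟³ G - triangles G ≡ Σ𝒟³ H - triangles H
  s₃ = cancel (Σ𝒟³ G) (Σ𝒟² G) (triangles G) (Σ𝒟³ H) (Σ𝒟² H) (triangles H) s₂ (trans (≡-sym (tr₃-ℒ G)) (trans t₃ (tr₃-ℒ H)))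
    where
    drop : ∀ a b c → a - c ≡ a + + 3 * b - c - + 3 * b
    drop = solve-∀
    cancel : ∀ a b c a′ b′ c′ → b ≡ b′ → a + + 3 * b - c ≡ a′ + + 3 * b′ - c′ → a - c ≡ a′ - c′
    cancel a b c a′ b′ c′ refl f = trans (drop a b c) (trans (cong (_- + 3 * b) f) (≡-sym (drop a′ b c′)))

-- The homogenised characteristic polynomial

-- Σ cₖ sᵏ uᵐ⁻¹⁻ᵏ
ev : ∀ {m} → Vec ℤ m → ℤ → ℤ → ℤ
ev         []       s u = 0ℤ
ev {suc m} (c ∷ cs) s u = c * u ^ m + s * ev cs s u

-- `m` counts the coefficients, so the degree is m - 1.
Homogeneous : ℕ → (ℤ → ℤ → ℤ) → Set
Homogeneous m f = Σ (Vec ℤ m) λ cs → ∀ s u → f s u ≡ ev cs s u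

ev-linear : ∀ {m} a (cs ds : Vec ℤ m) s u → ev (Vec.zipWith (λ c d → a * c + d) cs ds) s u ≡ a * ev cs s u + ev ds s u
ev-linear         a []       []       s u = ≡-sym (trans (ℤₚ.+-identityʳ (a * 0ℤ)) (ℤₚ.*-zeroʳ a))
ev-linear {suc m} a (c ∷ cs) (d ∷ ds) s u = trans (cong (λ z → (a * c + d) * u ^ m + s * z) (ev-linear a cs ds s u))
                                                  (identity a c d (u ^ m) s (ev cs s u) (ev ds s u))
  where
  identity : ∀ a c d x s p q → (a * c + d) * x + s * (a * p + q) ≡ a * (c * x + s * p) + (d * x + s * q)
  identity = solve-∀

homogeneous-linear : ∀ {m f g} a → Homogeneous m f → Homogeneous m g → Homogeneous m (λ s u → a * f s u + g s u)
homogeneous-linear a (cs , p) (ds , q) = Vec.zipWith (λ c d → a * c + d) cs ds ,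
  λ s u → trans (cong₂ (λ x y → a * x + y) (p s u) (q s u)) (≡-sym (ev-linear a cs ds s u))

homogeneous-0 : ∀ m → Homogeneous m (λ _ _ → 0ℤ)
homogeneous-0 m = Vec.replicate m 0ℤ , vanish m
  where
  vanish : ∀ m s u → 0ℤ ≡ ev (Vec.replicate m 0ℤ) s u
  vanish zero    s u = refl
  vanish (suc m) s u = ≡-sym (trans (cong (λ z → 0ℤ * u ^ m + s * z) (≡-sym (vanish m s u))) (identity (u ^ m) s))
    where
    identity : ∀ x s → 0ℤ * x + s * 0ℤ ≡ 0ℤ
    identity = solve-∀

homogeneous-s : ∀ {m f} → Homogeneous m f → Homogeneous (suc m) (λ s u → s * f s u)
homogeneous-s {m} {f} (cs , p) = 0ℤ ∷ cs , λ s u → trans (cong (s *_) (p s u)) (≡-sym (identity (u ^ m) (s * ev cs s u)))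
  where
  identity : ∀ x y → 0ℤ * x + y ≡ y
  identity = solve-∀

homogeneous-u : ∀ {m f} → Homogeneous m f → Homogeneous (suc m) (λ s u → u * f s u)
homogeneous-u (cs , p) = append cs , λ s u → trans (cong (u *_) (p s u)) (≡-sym (ev-append cs s u))
  where
  append : ∀ {m} → Vec ℤ m → Vec ℤ (suc m)
  append []       = 0ℤ ∷ []
  append (c ∷ cs) = c ∷ append cs
  identity₀ : ∀ s u → 0ℤ * 1ℤ + s * 0ℤ ≡ u * 0ℤ
  identity₀ = solve-∀
  identity : ∀ c x s e u → c * (u * x) + s * (u * e) ≡ u * (c * x + s * e)
  identity = solve-∀
  ev-append : ∀ {m} (cs : Vec ℤ m) s u → ev (append cs) s u ≡ u * ev cs s u
  ev-append         []       s u = identity₀ s u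
  ev-append {suc m} (c ∷ cs) s u = trans (cong (λ z → c * (u * u ^ m) + s * z) (ev-append cs s u)) (identity c (u ^ m) s (ev cs s u) u)

homogeneous-altSum : ∀ {m} q {f : Fin q → ℤ → ℤ → ℤ} → (∀ j → Homogeneous m (f j)) → Homogeneous m (λ s u → altSum q (λ j → f j s u))
homogeneous-altSum {m} zero    h = homogeneous-0 m
homogeneous-altSum {m} (suc q) {f} h with homogeneous-linear -1ℤ (homogeneous-altSum q (h ∘ suc)) (h zero)
... | cs , p = cs , λ s u → trans (identity (f zero s u) (altSum q (λ j → f (suc j) s u))) (p s u)
  where
  identity : ∀ x y → x - y ≡ -1ℤ * y + x
  identity = solve-∀

homogeneous-det : ∀ m (α β : Mat m m) → Homogeneous (suc m) (λ s u → det m (λ i j → s * α i j - u * β i j))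
homogeneous-det zero    α β = 1ℤ ∷ [] , λ s u → ≡-sym (cong (_+_ 1ℤ) (ℤₚ.*-zeroʳ s))
homogeneous-det (suc m) α β with homogeneous-altSum (suc m) (λ j →
    homogeneous-linear (α zero j) (homogeneous-s (homogeneous-det m (minor α j) (minor β j)))
      (homogeneous-linear (- β zero j) (homogeneous-u (homogeneous-det m (minor α j) (minor β j))) (homogeneous-0 (suc (suc m)))))
... | cs , p = cs , λ s u → trans (det-expand (λ i j → s * α i j - u * β i j) (λ j → identity s u (α zero j) (β zero j) _)) (p s u)
  where
  identity : ∀ s u a b d → (s * a - u * b) * d ≡ a * (s * d) + (- b * (u * d) + 0ℤ)
  identity = solve-∀

ev-one : ∀ {m} c (cs : Vec ℤ m) t → ev (c ∷ cs) t 1ℤ ≡ c + t * ev cs t 1ℤ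
ev-one {m} c cs t = cong (_+ t * ev cs t 1ℤ) (trans (cong (c *_) (ℤₚ.^-zeroˡ m)) (ℤₚ.*-identityʳ c))

-- Zero is excluded so that agreement passes to the tails, where `t` has to be cancelled. The
-- nonzero values still suffice to compare heads, as these are congruent modulo every positive `t`.
Agree : ∀ {m m′} → Vec ℤ m → Vec ℤ m′ → Set
Agree cs ds = ∀ t .{{_ : ℤ.NonZero t}} → ev cs t 1ℤ ≡ ev ds t 1ℤ

agree-head : ∀ {m m′ c d} {cs : Vec ℤ m} {ds : Vec ℤ m′} → Agree (c ∷ cs) (d ∷ ds) → c ≡ d
agree-head {c = c} {d} {cs} {ds} e = ≈-separated (λ v → congruent (+ suc v))
  where
  move : ∀ c d t x y → c + t * x ≡ d + t * y → c ≡ d + (y - x) * t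
  move c d t x y f = trans (lhs c t x) (trans (cong (_- t * x) f) (rhs d t x y))
    where
    lhs : ∀ c t x → c ≡ c + t * x - t * x
    lhs = solve-∀
    rhs : ∀ d t x y → d + t * y - t * x ≡ d + (y - x) * t
    rhs = solve-∀
  congruent : ∀ t .{{_ : ℤ.NonZero t}} → c ≈[ t ] d
  congruent t = by (ev ds t 1ℤ - ev cs t 1ℤ) (move c d t (ev cs t 1ℤ) (ev ds t 1ℤ) (trans (≡-sym (ev-one c cs t)) (trans (e t) (ev-one d ds t))))

agree-tail : ∀ {m m′ c} {cs : Vec ℤ m} {ds : Vec ℤ m′} → Agree (c ∷ cs) (c ∷ ds) → Agree cs ds
agree-tail {c = c} {cs} {ds} e t = *-cancelˡ t {ev cs t 1ℤ} {ev ds t 1ℤ}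
  (cancel c (t * ev cs t 1ℤ) (t * ev ds t 1ℤ) (trans (≡-sym (ev-one c cs t)) (trans (e t) (ev-one c ds t))))
  where
  cancel : ∀ c x y → c + x ≡ c + y → x ≡ y
  cancel c x y f = trans (drop c x) (trans (cong (_- c) f) (≡-sym (drop c y)))
    where
    drop : ∀ c x → x ≡ c + x - c
    drop = solve-∀

agree-[] : ∀ {m} (cs : Vec ℤ m) → Agree cs [] → ∀ s u → ev cs s u ≡ 0ℤ
agree-[]         []       e s u = refl
agree-[] {suc m} (c ∷ cs) e s u with padded
  where
  ev-zero : ∀ t → 0ℤ * 1ℤ + t * 0ℤ ≡ 0ℤ
  ev-zero = solve-∀
  -- The empty list is padded by a zero coefficient, so that `agree-head` can be applied and yields
  -- `c ≡ 0ℤ`.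
  agree : Agree (c ∷ cs) (0ℤ ∷ [])
  agree t = trans (e t) (≡-sym (ev-zero t))
  padded : c ≡ 0ℤ × Agree (c ∷ cs) (0ℤ ∷ [])
  padded = agree-head {c = c} {0ℤ} {cs} {[]} agree , agree
... | refl , agree = trans (cong (λ z → 0ℤ * u ^ m + s * z) (agree-[] cs (agree-tail {c = 0ℤ} {cs} {[]} agree) s u)) (identity (u ^ m) s)
  where
  identity : ∀ x s → 0ℤ * x + s * 0ℤ ≡ 0ℤ
  identity = solve-∀

ev-leading : ∀ {m} c (cs : Vec ℤ (suc m)) → ev (c ∷ cs) 1ℤ 0ℤ ≡ ev cs 1ℤ 0ℤ
ev-leading {m} c cs = trans (cong (λ z → c * z + 1ℤ * ev cs 1ℤ 0ℤ) (ℤₚ.*-zeroˡ (0ℤ ^ m))) (identity c (ev cs 1ℤ 0ℤ))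
  where
  identity : ∀ c x → c * 0ℤ + 1ℤ * x ≡ x
  identity = solve-∀

-- Values at u = 1 determine the coefficients only up to trailing zeros, hence not the degree of
-- homogenisation. The value 1 at `(1, 0)` says that the last coefficient is 1, which fixes the
-- degree.
monic-agree : ∀ {m m′} (cs : Vec ℤ (suc m)) (ds : Vec ℤ (suc m′)) → Agree cs ds →
              ev cs 1ℤ 0ℤ ≡ 1ℤ → ev ds 1ℤ 0ℤ ≡ 1ℤ → m ≡ m′ × (∀ s u → ev cs s u ≡ ev ds s u)
monic-agree (c ∷ cs) (d ∷ ds) e lc ld with agree-head {c = c} {d} {cs} {ds} e
monic-agree {zero}  {zero}   (c ∷ [])     (c ∷ [])     e lc ld | refl = refl , λ s u → refl
monic-agree {zero}  {suc m′} (c ∷ [])     (c ∷ ds)     e lc ld | refl =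
  contradiction (trans (≡-sym ld) (trans (ev-leading c ds) (agree-[] ds (λ t → ≡-sym (agree-tail {c = c} {[]} {ds} e t)) 1ℤ 0ℤ))) λ ()
monic-agree {suc m} {zero}   (c ∷ cs)     (c ∷ [])     e lc ld | refl =
  contradiction (trans (≡-sym lc) (trans (ev-leading c cs) (agree-[] cs (agree-tail {c = c} {cs} {[]} e) 1ℤ 0ℤ))) λ ()
monic-agree {suc m} {suc m′} (c ∷ cs)     (c ∷ ds)     e lc ld | refl
  with monic-agree cs ds (agree-tail {c = c} {cs} {ds} e) (trans (≡-sym (ev-leading c cs)) lc) (trans (≡-sym (ev-leading c ds)) ld)
... | refl , same = refl , λ s u → cong (λ z → c * u ^ suc m + s * z) (same s u)

cospectral-P : ∀ G H → LCospectral G H → n G ≡ n H × (∀ s u → P G s u ≡ P H s u)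
cospectral-P G H e = proj₁ compared , λ s u → trans (proj₂ PG s u) (trans (proj₂ compared s u) (≡-sym (proj₂ PH s u)))
  where
  PG = homogeneous-det (n G) δ (ℒ G)
  PH = homogeneous-det (n H) δ (ℒ H)
  monic : ∀ G → P G 1ℤ 0ℤ ≡ 1ℤ
  monic G = trans (det-cong (λ i j → identity (δ i j) (ℒ G i j))) (det-δ (n G))
    where
    identity : ∀ d l → 1ℤ * d - 0ℤ * l ≡ d
    identity = solve-∀
  compared = monic-agree (proj₁ PG) (proj₁ PH)
    (λ t → trans (≡-sym (proj₂ PG t 1ℤ)) (trans (≡-sym (charPoly-P G t)) (trans (e t) (trans (charPoly-P H t) (proj₂ PH t 1ℤ)))))
    (trans (≡-sym (proj₂ PG 1ℤ 0ℤ)) (monic G)) (trans (≡-sym (proj₂ PH 1ℤ 0ℤ)) (monic H))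

-- Degrees

sumFinℕ-zero : ∀ {m} {f : Fin m → ℕ} → (∀ i → f i ≡ 0) → sumFinℕ m f ≡ 0
sumFinℕ-zero {zero}  e = refl
sumFinℕ-zero {suc m} e = cong₂ ℕ._+_ (e zero) (sumFinℕ-zero (e ∘ suc))

sumFinℕ-remove : ∀ {m} (f : Fin m → ℕ) i → sumFinℕ m f ≡ f i ℕ.+ sumFinℕ m (f [ i ]≔ 0)
sumFinℕ-remove {suc m} f zero    = refl
sumFinℕ-remove {suc m} f (suc i) = begin
  f zero ℕ.+ sumFinℕ m (f ∘ suc)                                  ≡⟨ cong (f zero ℕ.+_) (sumFinℕ-remove (f ∘ suc) i) ⟩
  f zero ℕ.+ (f (suc i) ℕ.+ sumFinℕ m ((f ∘ suc) [ i ]≔ 0))       ≡⟨ ℕₚ.+-assoc (f zero) _ _ ⟨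
  f zero ℕ.+ f (suc i) ℕ.+ sumFinℕ m ((f ∘ suc) [ i ]≔ 0)         ≡⟨ cong (ℕ._+ sumFinℕ m ((f ∘ suc) [ i ]≔ 0)) (ℕₚ.+-comm (f zero) (f (suc i))) ⟩
  f (suc i) ℕ.+ f zero ℕ.+ sumFinℕ m ((f ∘ suc) [ i ]≔ 0)         ≡⟨ ℕₚ.+-assoc (f (suc i)) _ _ ⟩
  f (suc i) ℕ.+ (f zero ℕ.+ sumFinℕ m ((f ∘ suc) [ i ]≔ 0))       ∎
  where open ≡-Reasoning

module _ (G : Graph) {v : Fin (n G)} (deg≡2 : deg G v ≡ 2) where

  private
    f : Fin (n G) → ℕ
    f x = if adj G v x then 1 else 0
    f-true : ∀ {x} → adj G v x ≡ true → f x ≡ 1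
    f-true e = cong (λ b → if b then 1 else 0) e
    f-false : ∀ {x} → ¬ adj G v x ≡ true → f x ≡ 0
    f-false {x} e with adj G v x
    ... | true  = contradiction refl e
    ... | false = refl

  neighbour-other : ∀ {u} → adj G v u ≡ true → ∃ λ w → w ≢ u × adj G v w ≡ true
  neighbour-other {u} vu with Finₚ.any? (λ w → (¬? (w Fin.≟ u)) ×-dec (adj G v w Boolₚ.≟ true))
  ... | yes (w , found) = w , found
  ... | no none = contradiction (trans (≡-sym deg≡2) (trans (sumFinℕ-remove f u) (cong₂ ℕ._+_ (f-true vu) (sumFinℕ-zero rest)))) λ ()
    where
    rest : ∀ w → (f [ u ]≔ 0) w ≡ 0
    rest w with w Fin.≟ u
    ... | yes refl = ≔-same f u 0
    ... | no w≢u   = trans (≔-other f 0 w≢u) (f-false (λ e → none (w , w≢u , e)))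

  neighbour-cases : ∀ {j k} → j ≢ k → adj G v j ≡ true → adj G v k ≡ true → ∀ {x} → adj G v x ≡ true → x ≡ j ⊎ x ≡ k
  neighbour-cases {j} {k} j≢k vj vk {x} vx with x Fin.≟ j | x Fin.≟ k
  ... | yes x≡j | _       = inj₁ x≡j
  ... | no _    | yes x≡k = inj₂ x≡k
  ... | no x≢j  | no x≢k  = contradiction (trans (≡-sym deg≡2) count) λ ()
    where
    g = f [ j ]≔ 0
    h = g [ k ]≔ 0
    count : deg G v ≡ 3 ℕ.+ sumFinℕ (n G) (h [ x ]≔ 0)
    count = trans (sumFinℕ-remove f j) (cong₂ ℕ._+_ (f-true vj)
            (trans (sumFinℕ-remove g k) (cong₂ ℕ._+_ (trans (≔-other f 0 (j≢k ∘ ≡-sym)) (f-true vk))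
            (trans (sumFinℕ-remove h x) (cong (ℕ._+ sumFinℕ (n G) (h [ x ]≔ 0))
              (trans (≔-other g 0 x≢k) (trans (≔-other f 0 x≢j) (f-true vx))))))))

-- The degree condition of `IsRose` alone: for a cospectral graph it is obtained before anything is
-- known about connectedness.
HasDegrees : ℕ → (G : Graph) → Fin (n G) → Set
HasDegrees k G c = deg G c ≡ 2 ℕ.* k × (∀ v → v ≢ c → deg G v ≡ 2)

reach-closed : ∀ G (S : Fin (n G) → Set) → (∀ {u v} → S u → adj G u v ≡ true → S v) → ∀ {u v} → Reach G u v → S u → S v
reach-closed G S closed here       s = s
reach-closed G S closed (step e r) s = reach-closed G S closed r (closed s e)

∑-mono : ∀ {m} {f g : Fin m → ℤ} → (∀ i → f i ℤ.≤ g i) → ∑ f ℤ.≤ ∑ g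
∑-mono {zero}  e = ℤₚ.≤-refl
∑-mono {suc m} e = ℤₚ.+-mono-≤ (e zero) (∑-mono (e ∘ suc))

∑-nonneg : ∀ {m} {f : Fin m → ℤ} → (∀ i → 0ℤ ℤ.≤ f i) → 0ℤ ℤ.≤ ∑ f
∑-nonneg {m} e = ℤₚ.≤-trans (ℤₚ.≤-reflexive (≡-sym (∑-zero {m} (λ _ → refl)))) (∑-mono e)

∑-single : ∀ {m} (c : Fin m) {f : Fin m → ℤ} → (∀ i → i ≢ c → f i ≡ 0ℤ) → ∑ f ≡ f c
∑-single c {f} e = trans (∑-cong term) (∑-δ c f)
  where
  term : ∀ i → f i ≡ f i * δ c i
  term i with i Fin.≟ c
  ... | yes refl = ≡-sym (trans (cong (f i *_) (δ-refl i)) (ℤₚ.*-identityʳ (f i)))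
  ... | no i≢c   = trans (e i i≢c) (≡-sym (cong (_* δ c i) (e i i≢c)))

0≤* : ∀ {x y} → 0ℤ ℤ.≤ x → 0ℤ ℤ.≤ y → 0ℤ ℤ.≤ x * y
0≤* {x} {y} (ℤ.+≤+ {n = a} _) (ℤ.+≤+ {n = b} _) = ℤₚ.≤-trans (ℤ.+≤+ z≤n) (ℤₚ.≤-reflexive (ℤₚ.pos-* a b))

module _ (G : Graph) where

  𝒜-nonneg : ∀ i j → 0ℤ ℤ.≤ 𝒜 G i j
  𝒜-nonneg i j with adj G i j
  ... | true  = ℤ.+≤+ z≤n
  ... | false = ℤ.+≤+ z≤n

  𝒜-true : ∀ {i j} → adj G i j ≡ true → 𝒜 G i j ≡ 1ℤ
  𝒜-true e = cong (λ b → if b then 1ℤ else 0ℤ) e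

  triangle-nonneg : ∀ i j k → 0ℤ ℤ.≤ 𝒜 G i j * 𝒜 G j k * 𝒜 G k i
  triangle-nonneg i j k = 0≤* (0≤* (𝒜-nonneg i j) (𝒜-nonneg j k)) (𝒜-nonneg k i)

  triangles-nonneg : 0ℤ ℤ.≤ triangles G
  triangles-nonneg = ∑-nonneg (λ i → ∑-nonneg (λ j → ∑-nonneg (λ k → triangle-nonneg i j k)))

  module _ {k : ℕ} (connected : Connected G) (c : Fin (n G)) (degrees : HasDegrees k G c) where

    private
      t : Fin (n G) → Fin (n G) → Fin (n G) → ℤ
      t i j l = 𝒜 G i j * 𝒜 G j l * 𝒜 G l i
      τ = ∑ (λ j → ∑ (λ l → t c j l))

    -- Three mutually adjacent vertices of degree 2 would form a whole component.
    triangle-centre : ∀ {i j l} → i ≢ c → j ≢ c → l ≢ c → adj G i j ≡ true → adj G j l ≡ true → adj G l i ≡ true → ⊥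
    triangle-centre {i} {j} {l} i≢c j≢c l≢c ij jl li with reach-closed G S closed (connected i c) (inj₁ refl)
      where
      S : Fin (n G) → Set
      S x = x ≡ i ⊎ x ≡ j ⊎ x ≡ l
      flip : ∀ {x y} → adj G x y ≡ true → adj G y x ≡ true
      flip {x} {y} e = trans (sym G y x) e
      two : ∀ {x} → x ≢ c → deg G x ≡ 2
      two {x} = proj₂ degrees x
      closed : ∀ {u v} → S u → adj G u v ≡ true → S v
      closed (inj₁ refl) e with neighbour-cases G (two i≢c) (adj⇒≢ G jl) ij (flip li) e
      ... | inj₁ x = inj₂ (inj₁ x)
      ... | inj₂ x = inj₂ (inj₂ x)
      closed (inj₂ (inj₁ refl)) e with neighbour-cases G (two j≢c) (adj⇒≢ G li) jl (flip ij) e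
      ... | inj₁ x = inj₂ (inj₂ x)
      ... | inj₂ x = inj₁ x
      closed (inj₂ (inj₂ refl)) e with neighbour-cases G (two l≢c) (adj⇒≢ G ij) li (flip jl) e
      ... | inj₁ x = inj₁ x
      ... | inj₂ x = inj₂ (inj₁ x)
    ... | inj₁ e        = i≢c (≡-sym e)
    ... | inj₂ (inj₁ e) = j≢c (≡-sym e)
    ... | inj₂ (inj₂ e) = l≢c (≡-sym e)

    private
      δt : ∀ i j l → 0ℤ ℤ.≤ δ c i * t j l i
      δt i j l with c Fin.≟ i
      ... | yes refl = ℤₚ.≤-trans (triangle-nonneg j l i) (ℤₚ.≤-reflexive (≡-sym (trans (cong (_* t j l i) (δ-refl i)) (ℤₚ.*-identityˡ (t j l i)))))
      ... | no c≢i   = ℤₚ.≤-reflexive (≡-sym (cong (_* t j l i) (δ-≢ c≢i)))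

      cyclic : ∀ i j l → t i j l ≡ t j l i
      cyclic i j l = rotate (𝒜 G i j) (𝒜 G j l) (𝒜 G l i)
        where
        rotate : ∀ x y z → x * y * z ≡ y * z * x
        rotate = solve-∀

      -- By `triangle-centre` every triangle has the centre among its corners. One of the three
      -- terms is then the triangle itself, rotated, and the other two are nonnegative.
      through-centre : ∀ i j l → t i j l ℤ.≤ δ c i * t j l i + (δ c j * t l i j + δ c l * t i j l)
      through-centre i j l with c Fin.≟ i | c Fin.≟ j | c Fin.≟ l
      ... | yes refl | _ | _ = ℤₚ.≤-trans (ℤₚ.≤-reflexive (trans (cyclic i j l) (≡-sym (trans (ℤₚ.+-identityʳ _) (trans (cong (_* t j l i) (δ-refl i)) (ℤₚ.*-identityˡ (t j l i)))))))
              (ℤₚ.+-monoʳ-≤ (δ i i * t j l i) (ℤₚ.+-mono-≤ (δt j l i) (δt l i j)))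
      ... | no _ | yes refl | _ = ℤₚ.≤-trans (ℤₚ.≤-reflexive (trans (cyclic i j l) (trans (cyclic j l i) (≡-sym (trans (zeros (δ j j * t l i j)) (trans (cong (_* t l i j) (δ-refl j)) (ℤₚ.*-identityˡ (t l i j))))))))
              (ℤₚ.+-mono-≤ (δt i j l) (ℤₚ.+-monoʳ-≤ (δ j j * t l i j) (δt l i j)))
        where
        zeros : ∀ x → 0ℤ + (x + 0ℤ) ≡ x
        zeros = solve-∀
      ... | no _ | no _ | yes refl = ℤₚ.≤-trans (ℤₚ.≤-reflexive (≡-sym (trans (zeros (δ l l * t i j l)) (trans (cong (_* t i j l) (δ-refl l)) (ℤₚ.*-identityˡ (t i j l))))))
              (ℤₚ.+-mono-≤ (δt i j l) (ℤₚ.+-monoˡ-≤ (δ l l * t i j l) (δt j l i)))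
        where
        zeros : ∀ x → 0ℤ + (0ℤ + x) ≡ x
        zeros = solve-∀
      ... | no c≢i | no c≢j | no c≢l = ℤₚ.≤-trans (ℤₚ.≤-reflexive absent) (ℤₚ.+-mono-≤ (δt i j l) (ℤₚ.+-mono-≤ (δt j l i) (δt l i j)))
        where
        absent : t i j l ≡ 0ℤ
        absent with adj G i j in ij | adj G j l in jl | adj G l i in li
        ... | true  | true  | true  = ⊥-elim (triangle-centre (c≢i ∘ ≡-sym) (c≢j ∘ ≡-sym) (c≢l ∘ ≡-sym) ij jl li)
        ... | true  | true  | false = refl
        ... | true  | false | true  = refl
        ... | true  | false | false = refl
        ... | false | true  | true  = refl
        ... | false | true  | false = refl
        ... | false | false | true  = refl
        ... | false | false | false = refl

      ∑-δc : ∀ (f : Fin (n G) → ℤ) → ∑ (λ i → δ c i * f i) ≡ f c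
      ∑-δc f = trans (∑-cong (λ i → ℤₚ.*-comm (δ c i) (f i))) (∑-δ c f)

      sum₁ : ∑ (λ i → ∑ (λ j → ∑ (λ l → δ c i * t j l i))) ≡ τ
      sum₁ = trans (∑-cong (λ i → trans (∑-cong (λ j → ∑-* (δ c i) (λ l → t j l i))) (∑-* (δ c i) (λ j → ∑ (λ l → t j l i)))))
             (trans (∑-δc (λ i → ∑ (λ j → ∑ (λ l → t j l i)))) (∑-cong (λ j → ∑-cong (λ l → ≡-sym (cyclic c j l)))))

      sum₂ : ∑ (λ i → ∑ (λ j → ∑ (λ l → δ c j * t l i j))) ≡ τ
      sum₂ = trans (∑-cong (λ i → trans (∑-cong (λ j → ∑-* (δ c j) (λ l → t l i j))) (∑-δc (λ j → ∑ (λ l → t l i j)))))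
             (trans (∑-swap (λ i l → t l i c)) (∑-cong (λ l → ∑-cong (λ i → ≡-sym (cyclic c l i)))))

      sum₃ : ∑ (λ i → ∑ (λ j → ∑ (λ l → δ c l * t i j l))) ≡ τ
      sum₃ = ∑-cong (λ i → ∑-cong (λ j → trans (∑-δc (t i j)) (≡-sym (cyclic c i j))))

      triangles-τ : triangles G ℤ.≤ τ + (τ + τ)
      triangles-τ = ℤₚ.≤-trans (∑-mono (λ i → ∑-mono (λ j → ∑-mono (λ l → through-centre i j l)))) (ℤₚ.≤-reflexive (begin
        ∑ (λ i → ∑ (λ j → ∑ (λ l → δ c i * t j l i + (δ c j * t l i j + δ c l * t i j l))))
          ≡⟨ ∑³-+ (λ i j l → δ c i * t j l i) (λ i j l → δ c j * t l i j + δ c l * t i j l) ⟩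
        ∑ (λ i → ∑ (λ j → ∑ (λ l → δ c i * t j l i))) + ∑ (λ i → ∑ (λ j → ∑ (λ l → δ c j * t l i j + δ c l * t i j l)))
          ≡⟨ cong₂ _+_ sum₁ (trans (∑³-+ (λ i j l → δ c j * t l i j) (λ i j l → δ c l * t i j l)) (cong₂ _+_ sum₂ sum₃)) ⟩
        τ + (τ + τ) ∎))
        where
        open ≡-Reasoning
        ∑³-+ : ∀ (f g : Fin (n G) → Fin (n G) → Fin (n G) → ℤ) →
               ∑ (λ i → ∑ (λ j → ∑ (λ l → f i j l + g i j l))) ≡ ∑ (λ i → ∑ (λ j → ∑ (f i j))) + ∑ (λ i → ∑ (λ j → ∑ (g i j)))
        ∑³-+ f g = trans (∑-cong (λ i → trans (∑-cong (λ j → ∑-+ (f i j) (g i j))) (∑-+ (λ j → ∑ (f i j)) (λ j → ∑ (g i j)))))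
                         (∑-+ (λ i → ∑ (λ j → ∑ (f i j))) (λ i → ∑ (λ j → ∑ (g i j))))

      -- `j` has degree 2 and one of its neighbours is `c`, so at most one other can be adjacent to
      -- `c`.
      common : ∀ j → adj G c j ≡ true → ∑ (λ l → 𝒜 G j l * 𝒜 G l c) ℤ.≤ 1ℤ
      common j cj = cancel (ℤₚ.≤-trans (∑-mono bound) (ℤₚ.≤-reflexive (trans (≡-sym (𝒟-∑ G j)) (cong +_ (proj₂ degrees j (adj⇒≢ G cj ∘ ≡-sym))))))
        where
        bound : ∀ l → 𝒜 G j l * 𝒜 G l c + 1ℤ * δ c l ℤ.≤ 𝒜 G j l
        bound l with c Fin.≟ l
        ... | yes refl = ℤₚ.≤-reflexive (trans (cong₂ (λ x y → 𝒜 G j c * x + 1ℤ * y) (𝒜-diag G c) (δ-refl c))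
                           (trans (identity (𝒜 G j c)) (≡-sym (𝒜-true (trans (sym G j c) cj)))))
          where
          identity : ∀ x → x * 0ℤ + 1ℤ * 1ℤ ≡ 1ℤ
          identity = solve-∀
        ... | no c≢l = ℤₚ.≤-trans (ℤₚ.≤-reflexive (trans (cong (λ y → 𝒜 G j l * 𝒜 G l c + 1ℤ * y) (δ-≢ c≢l)) (ℤₚ.+-identityʳ _))) less
          where
          less : 𝒜 G j l * 𝒜 G l c ℤ.≤ 𝒜 G j l
          less with adj G j l | adj G l c
          ... | true  | true  = ℤ.+≤+ (s≤s z≤n)
          ... | true  | false = ℤ.+≤+ z≤n
          ... | false | true  = ℤ.+≤+ z≤n
          ... | false | false = ℤ.+≤+ z≤n
        cancel : ∑ (λ l → 𝒜 G j l * 𝒜 G l c + 1ℤ * δ c l) ℤ.≤ + 2 → ∑ (λ l → 𝒜 G j l * 𝒜 G l c) ℤ.≤ 1ℤ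
        cancel le = ℤₚ.≤-trans (ℤₚ.≤-reflexive (trans (drop (∑ (λ l → 𝒜 G j l * 𝒜 G l c)))
                      (cong (_- 1ℤ) (≡-sym (trans (∑-+ (λ l → 𝒜 G j l * 𝒜 G l c) (λ l → 1ℤ * δ c l)) (cong (_+_ (∑ (λ l → 𝒜 G j l * 𝒜 G l c))) (∑-δ c (λ _ → 1ℤ))))))))
                    (ℤₚ.+-monoˡ-≤ -1ℤ le)
          where
          drop : ∀ x → x ≡ x + 1ℤ - 1ℤ
          drop = solve-∀

      τ-bound : τ ℤ.≤ + (2 ℕ.* k)
      τ-bound = ℤₚ.≤-trans (∑-mono row) (ℤₚ.≤-reflexive (trans (≡-sym (𝒟-∑ G c)) (cong +_ (proj₁ degrees))))
        where
        row : ∀ j → ∑ (λ l → t c j l) ℤ.≤ 𝒜 G c j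
        row j = ℤₚ.≤-trans (ℤₚ.≤-reflexive (trans (∑-cong (λ l → ℤₚ.*-assoc (𝒜 G c j) (𝒜 G j l) (𝒜 G l c))) (∑-* (𝒜 G c j) (λ l → 𝒜 G j l * 𝒜 G l c)))) scaled
          where
          scaled : 𝒜 G c j * ∑ (λ l → 𝒜 G j l * 𝒜 G l c) ℤ.≤ 𝒜 G c j
          scaled with adj G c j in cj
          ... | true  = ℤₚ.≤-trans (ℤₚ.≤-reflexive (ℤₚ.*-identityˡ _)) (common j cj)
          ... | false = ℤ.+≤+ z≤n

    -- `τ` counts closed walks of length 3 that start at `c`. There is at most one for each of the
    -- 2k first steps, and the centre may occupy any of three positions in a triangle.
    triangles-bound : triangles G ℤ.≤ + 6 * + k
    triangles-bound = ℤₚ.≤-trans triangles-τ (ℤₚ.≤-trans (ℤₚ.+-mono-≤ τ-bound (ℤₚ.+-mono-≤ τ-bound τ-bound))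
      (ℤₚ.≤-reflexive (trans (cong (λ x → x + (x + x)) (ℤₚ.pos-* 2 k)) (identity (+ k)))))
      where
      identity : ∀ x → + 2 * x + (+ 2 * x + + 2 * x) ≡ + 6 * x
      identity = solve-∀

∑-cubic : ∀ G α β γ ε → ∑ (λ i → α * (𝒟 G i * 𝒟 G i * 𝒟 G i) + (β * (𝒟 G i * 𝒟 G i) + (γ * 𝒟 G i + ε * 1ℤ)))
                      ≡ α * Σ𝒟³ G + (β * Σ𝒟² G + (γ * ∑ (𝒟 G) + ε * + n G))
∑-cubic G α β γ ε =
  trans (∑-+ (λ i → α * d³ i) (λ i → β * d² i + (γ * d i + ε * 1ℤ))) (cong₂ _+_ (∑-* α d³)
  (trans (∑-+ (λ i → β * d² i) (λ i → γ * d i + ε * 1ℤ)) (cong₂ _+_ (∑-* β d²)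
  (trans (∑-+ (λ i → γ * d i) (λ _ → ε * 1ℤ)) (cong₂ _+_ (∑-* γ d)
  (trans (∑-* {n G} ε (λ _ → 1ℤ)) (cong (ε *_) (∑-1 (n G)))))))))
  where
  d  = 𝒟 G
  d² = λ i → d i * d i
  d³ = λ i → d i * d i * d i
  ∑-1 : ∀ m → ∑ {m} (λ _ → 1ℤ) ≡ + m
  ∑-1 zero    = refl
  ∑-1 (suc m) = cong (_+_ 1ℤ) (∑-1 m)

module _ {k : ℕ} (3≤k : 3 ≤ k) (G : Graph) (c : Fin (n G)) (degrees : HasDegrees k G c) (few : triangles G ℤ.≤ + 6 * + k)
         (H : Graph) (same-n : n G ≡ n H) (same₁ : ∑ (𝒟 G) ≡ ∑ (𝒟 H)) (same₂ : Σ𝒟² G ≡ Σ𝒟² H)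
         (same₃ : Σ𝒟³ G - triangles G ≡ Σ𝒟³ H - triangles H) where

  private
    K = + k

    -- Nonnegative at every natural number below 2k, and zero at 2.
    φ : ℤ → ℤ
    φ d = (d - 1ℤ) * (d - + 2) * (+ 2 * K - 1ℤ - d)

    φ-sum : ∀ G → ∑ (λ i → φ (𝒟 G i)) ≡ -1ℤ * Σ𝒟³ G + ((+ 2 * K + + 2) * Σ𝒟² G + ((1ℤ - + 6 * K) * ∑ (𝒟 G) + (+ 4 * K - + 2) * + n G))
    φ-sum G = trans (∑-cong (λ i → expand (𝒟 G i) K)) (∑-cubic G -1ℤ (+ 2 * K + + 2) (1ℤ - + 6 * K) (+ 4 * K - + 2))
      where
      expand : ∀ d K → (d - 1ℤ) * (d - + 2) * (+ 2 * K - 1ℤ - d) ≡ -1ℤ * (d * d * d) + ((+ 2 * K + + 2) * (d * d) + ((1ℤ - + 6 * K) * d + (+ 4 * K - + 2) * 1ℤ))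
      expand = solve-∀

    𝒟-c : 𝒟 G c ≡ + 2 * K
    𝒟-c = trans (cong +_ (proj₁ degrees)) (ℤₚ.pos-* 2 k)

    𝒟-v : ∀ v → v ≢ c → 𝒟 G v ≡ + 2
    𝒟-v v v≢c = cong +_ (proj₂ degrees v v≢c)

    φ-G : ∑ (λ i → φ (𝒟 G i)) ≡ φ (+ 2 * K)
    φ-G = trans (∑-single c (λ i i≢c → trans (cong φ (𝒟-v i i≢c)) (at-2 K))) (cong φ 𝒟-c)
      where
      at-2 : ∀ K → (+ 2 - 1ℤ) * (+ 2 - + 2) * (+ 2 * K - 1ℤ - + 2) ≡ 0ℤ
      at-2 = solve-∀

    φ-H : ∑ (λ i → φ (𝒟 H i)) ≡ φ (+ 2 * K) + (triangles G - triangles H)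
    φ-H = trans (φ-sum H) (trans (transfer (Σ𝒟³ H) (Σ𝒟² H) (∑ (𝒟 H)) (+ n H) (Σ𝒟³ G) (Σ𝒟² G) (∑ (𝒟 G)) (+ n G) (triangles G) (triangles H)
                                           same₃ same₂ same₁ (cong +_ same-n))
                          (cong (_+ (triangles G - triangles H)) (trans (≡-sym (φ-sum G)) φ-G)))
      where
      transfer : ∀ c′ b′ a′ e′ c b a e s s′ → c - s ≡ c′ - s′ → b ≡ b′ → a ≡ a′ → e ≡ e′ →
        -1ℤ * c′ + ((+ 2 * K + + 2) * b′ + ((1ℤ - + 6 * K) * a′ + (+ 4 * K - + 2) * e′))
        ≡ -1ℤ * c + ((+ 2 * K + + 2) * b + ((1ℤ - + 6 * K) * a + (+ 4 * K - + 2) * e)) + (s - s′)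
      transfer c′ b a e c b a e s s′ p refl refl refl = trans (lhs c′ s′ rest) (trans (cong (λ z → -1ℤ * (z + s′) + rest) (≡-sym p)) (rhs c s s′ rest))
        where
        rest = (+ 2 * K + + 2) * b + ((1ℤ - + 6 * K) * a + (+ 4 * K - + 2) * e)
        lhs : ∀ c s r → -1ℤ * c + r ≡ -1ℤ * (c - s + s) + r
        lhs = solve-∀
        rhs : ∀ c s s′ r → -1ℤ * (c - s + s′) + r ≡ -1ℤ * c + r + (s - s′)
        rhs = solve-∀

    φ-nonneg : ∀ d → d ℕ.< 2 ℕ.* k → 0ℤ ℤ.≤ φ (+ d)
    φ-nonneg d d<2k = 0≤* (quadratic d) (ℤₚ.≤-trans (ℤₚ.i≤j⇒0≤j-i (ℤ.+≤+ d<2k)) (ℤₚ.≤-reflexive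
      (trans (cong₂ _-_ (ℤₚ.pos-* 2 k) (ℤₚ.pos-+ 1 d)) (identity K (+ d)))))
      where
      identity : ∀ K d → + 2 * K - (1ℤ + d) ≡ + 2 * K - 1ℤ - d
      identity = solve-∀
      quadratic : ∀ d → 0ℤ ℤ.≤ (+ d - 1ℤ) * (+ d - + 2)
      quadratic zero          = ℤ.+≤+ z≤n
      quadratic (suc zero)    = ℤ.+≤+ z≤n
      quadratic (suc (suc d)) = 0≤* {+ suc (suc d) - 1ℤ} {+ suc (suc d) - + 2} (ℤ.+≤+ z≤n) (ℤ.+≤+ z≤n)

    some-large : ∃ λ v → 2 ℕ.* k ≤ deg H v
    some-large with Finₚ.any? (λ v → 2 ℕ.* k ℕ.≤? deg H v)
    ... | yes found = found
    ... | no none   = contradiction (conclude (∑-nonneg (λ i → φ-nonneg (deg H i) (ℕₚ.≰⇒> (λ le → none (i , le)))))) λ ()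
      where
      -- From (2k - 1)(2k - 2) - 6k = 4k(k - 3) + 2; the hypothesis `3≤k` makes `A` nonnegative, and
      -- the 2 becomes the contradiction `0ℤ ≤ - 2`.
      A = + 4 * K * (K - + 3)
      A-nonneg : 0ℤ ℤ.≤ A
      A-nonneg = 0≤* (0≤* {+ 4} {K} (ℤ.+≤+ z≤n) (ℤ.+≤+ z≤n)) (ℤₚ.i≤j⇒0≤j-i (ℤ.+≤+ 3≤k))
      conclude : 0ℤ ℤ.≤ ∑ (λ i → φ (𝒟 H i)) → 0ℤ ℤ.≤ - (+ 2)
      conclude le = ℤₚ.≤-trans (ℤₚ.+-mono-≤ le (ℤₚ.+-mono-≤ A-nonneg (ℤₚ.+-mono-≤ (ℤₚ.i≤j⇒0≤j-i few) (triangles-nonneg H))))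
                      (ℤₚ.≤-reflexive (trans (cong (_+ (A + (+ 6 * K - triangles G + triangles H))) φ-H) (identity K (triangles G) (triangles H))))
        where
        identity : ∀ K s s′ → (+ 2 * K - 1ℤ) * (+ 2 * K - + 2) * (+ 2 * K - 1ℤ - + 2 * K) + (s - s′) + (+ 4 * K * (K - + 3) + (+ 6 * K - s + s′)) ≡ - (+ 2)
        identity = solve-∀

    ψ : ℤ → ℤ
    ψ d = (d - + 2) * (d - + 2)

    square-nonneg : ∀ x → 0ℤ ℤ.≤ x * x
    square-nonneg (+ m)        = 0≤* {+ m} {+ m} (ℤ.+≤+ z≤n) (ℤ.+≤+ z≤n)
    square-nonneg (ℤ.-[1+ m ]) = ℤ.+≤+ z≤n

    ψ-H : ∑ (λ i → ψ (𝒟 H i)) ≡ ψ (+ 2 * K)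
    ψ-H = trans (ψ-sum H) (trans (transfer (Σ𝒟³ H) (Σ𝒟³ G) same₂ same₁ (cong +_ same-n))
            (trans (≡-sym (ψ-sum G)) (trans (∑-single c (λ i i≢c → cong ψ (𝒟-v i i≢c))) (cong ψ 𝒟-c))))
      where
      ψ-sum : ∀ G → ∑ (λ i → ψ (𝒟 G i)) ≡ 0ℤ * Σ𝒟³ G + (1ℤ * Σ𝒟² G + (- (+ 4) * ∑ (𝒟 G) + + 4 * + n G))
      ψ-sum G = trans (∑-cong (λ i → expand (𝒟 G i))) (∑-cubic G 0ℤ 1ℤ (- (+ 4)) (+ 4))
        where
        expand : ∀ d → (d - + 2) * (d - + 2) ≡ 0ℤ * (d * d * d) + (1ℤ * (d * d) + (- (+ 4) * d + + 4 * 1ℤ))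
        expand = solve-∀
      transfer : ∀ {b a e b′ a′ e′} c′ c → b ≡ b′ → a ≡ a′ → e ≡ e′ →
        0ℤ * c′ + (1ℤ * b′ + (- (+ 4) * a′ + + 4 * e′)) ≡ 0ℤ * c + (1ℤ * b + (- (+ 4) * a + + 4 * e))
      transfer {b} {a} {e} c′ c refl refl refl = identity c′ c (1ℤ * b + (- (+ 4) * a + + 4 * e))
        where
        identity : ∀ x y r → 0ℤ * x + r ≡ 0ℤ * y + r
        identity = solve-∀

    linear-H : ∑ (λ i → 𝒟 H i - + 2) ≡ + 2 * K - + 2
    linear-H = trans (sum H) (trans (cong₂ (λ x y → x + -1ℤ * (+ 2 * y)) (≡-sym same₁) (cong +_ (≡-sym same-n)))
              (trans (≡-sym (sum G)) (trans (∑-single c (λ i i≢c → cong (_- + 2) (𝒟-v i i≢c))) (cong (_- + 2) 𝒟-c))))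
      where
      sum : ∀ G → ∑ (λ i → 𝒟 G i - + 2) ≡ ∑ (𝒟 G) + -1ℤ * (+ 2 * + n G)
      sum G = trans (∑-cong (λ i → expand (𝒟 G i))) (trans (∑-cubic G 0ℤ 0ℤ 1ℤ (- (+ 2))) (collect (Σ𝒟³ G) (Σ𝒟² G) (∑ (𝒟 G)) (+ n G)))
        where
        expand : ∀ d → d - + 2 ≡ 0ℤ * (d * d * d) + (0ℤ * (d * d) + (1ℤ * d + - (+ 2) * 1ℤ))
        expand = solve-∀
        collect : ∀ c b a e → 0ℤ * c + (0ℤ * b + (1ℤ * a + - (+ 2) * e)) ≡ a + -1ℤ * (+ 2 * e)
        collect = solve-∀

  degrees-determined : ∃ (HasDegrees k H)
  degrees-determined = w , centre , λ u u≢w → ℤₚ.+-injective (others u u≢w)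
    where
    w = proj₁ some-large
    e = deg H w ℕ.∸ 2 ℕ.* k
    large : 𝒟 H w ≡ + 2 * K + + e
    large = trans (cong +_ (≡-sym (ℕₚ.m+[n∸m]≡n (proj₂ some-large)))) (trans (ℤₚ.pos-+ (2 ℕ.* k) e) (cong (_+ + e) (ℤₚ.pos-* 2 k)))
    ψ-large : ψ (+ 2 * K) ℤ.≤ ψ (𝒟 H w)
    ψ-large = ℤₚ.≤-trans (ℤₚ.≤-trans (ℤₚ.≤-reflexive (≡-sym (ℤₚ.+-identityʳ (ψ (+ 2 * K)))))
        (ℤₚ.+-monoʳ-≤ (ψ (+ 2 * K)) (ℤₚ.+-mono-≤ (0≤* {+ 4} (ℤ.+≤+ z≤n) (0≤* {+ e} (ℤ.+≤+ z≤n) (ℤₚ.i≤j⇒0≤j-i (ℤ.+≤+ (ℕₚ.≤-trans (s≤s z≤n) 3≤k))))) (square-nonneg (+ e)))))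
        (ℤₚ.≤-reflexive (≡-sym (trans (cong ψ large) (identity K (+ e)))))
      where
      identity : ∀ K e → (+ 2 * K + e - + 2) * (+ 2 * K + e - + 2) ≡ (+ 2 * K - + 2) * (+ 2 * K - + 2) + (+ 4 * (e * (K - 1ℤ)) + e * e)
      identity = solve-∀
    -- All summands of `ψ-H` are squares, so those of `w` and `u` together stay below the total; by
    -- `ψ-large` the summand of `w` alone already exhausts it.
    pair : ∀ u → u ≢ w → ψ (𝒟 H w) + ψ (𝒟 H u) ℤ.≤ ψ (+ 2 * K)
    pair u u≢w = ℤₚ.≤-trans (ℤₚ.≤-reflexive (≡-sym (trans (∑-+ (λ i → x i * δ w i) (λ i → x i * δ u i)) (cong₂ _+_ (∑-δ w x) (∑-δ u x)))))
                   (ℤₚ.≤-trans (∑-mono bound) (ℤₚ.≤-reflexive ψ-H))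
      where
      x = λ i → ψ (𝒟 H i)
      bound : ∀ i → x i * δ w i + x i * δ u i ℤ.≤ x i
      bound i with w Fin.≟ i | u Fin.≟ i
      ... | yes refl | yes refl = contradiction refl u≢w
      ... | yes refl | no u≢i   = ℤₚ.≤-reflexive (trans (cong₂ (λ p q → x i * p + x i * q) (δ-refl i) (δ-≢ u≢i)) (identity (x i)))
        where
        identity : ∀ x → x * 1ℤ + x * 0ℤ ≡ x
        identity = solve-∀
      ... | no w≢i | yes refl = ℤₚ.≤-reflexive (trans (cong₂ (λ p q → x i * p + x i * q) (δ-≢ w≢i) (δ-refl i)) (identity (x i)))
        where
        identity : ∀ x → x * 0ℤ + x * 1ℤ ≡ x
        identity = solve-∀
      ... | no w≢i | no u≢i = ℤₚ.≤-trans (ℤₚ.≤-reflexive (trans (cong₂ (λ p q → x i * p + x i * q) (δ-≢ w≢i) (δ-≢ u≢i)) (identity (x i)))) (square-nonneg (𝒟 H i - + 2))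
        where
        identity : ∀ x → x * 0ℤ + x * 0ℤ ≡ 0ℤ
        identity = solve-∀
    others : ∀ u → u ≢ w → 𝒟 H u ≡ + 2
    others u u≢w = ℤₚ.i-j≡0⇒i≡j (𝒟 H u) (+ 2) (square-zero (𝒟 H u - + 2) (ℤₚ.≤-antisym small (square-nonneg (𝒟 H u - + 2))))
      where
      small : ψ (𝒟 H u) ℤ.≤ 0ℤ
      small = ℤₚ.≤-trans (ℤₚ.≤-reflexive (move (ψ (𝒟 H w)) (ψ (𝒟 H u)))) (ℤₚ.i≤j⇒i-j≤0 (ℤₚ.≤-trans (pair u u≢w) ψ-large))
        where
        move : ∀ x y → y ≡ x + y - x
        move = solve-∀
      square-zero : ∀ x → x * x ≡ 0ℤ → x ≡ 0ℤ
      square-zero x p with ℤₚ.i*j≡0⇒i≡0∨j≡0 x p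
      ... | inj₁ q = q
      ... | inj₂ q = q
    -- So far the degree of `w` is only bounded below. With all other degrees equal to 2, the sum of
    -- `d - 2` in `linear-H` gives it exactly.
    centre : deg H w ≡ 2 ℕ.* k
    centre = ℤₚ.+-injective (trans (shift (𝒟 H w)) (trans (cong (_+ + 2) (trans (≡-sym (∑-single w (λ i i≢w → cong (_- + 2) (others i i≢w)))) linear-H))
               (trans (≡-sym (shift (+ 2 * K))) (≡-sym (ℤₚ.pos-* 2 k)))))
      where
      shift : ∀ x → x ≡ x - + 2 + + 2
      shift = solve-∀

-- The determinant of a rose

bit : Bool → ℤ
bit b = if b then 1ℤ else 0ℤ

isFirst isLast isEnd : ∀ {m} → Fin m → Bool
isFirst zero    = true
isFirst (suc j) = false
isLast {suc zero}    zero    = true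
isLast {suc (suc m)} zero    = false
isLast               (suc j) = isLast j
isEnd j = isFirst j ∨ isLast j

pathAdj : ∀ {m} → Fin m → Fin m → Bool
pathAdj zero    zero    = false
pathAdj zero    (suc j) = isFirst j
pathAdj (suc i) zero    = isFirst i
pathAdj (suc i) (suc j) = pathAdj i j

size : List ℕ → ℕ
size []       = 0
size (m ∷ ms) = size ms ℕ.+ m

-- The rose whose petals have m₁, m₂, … vertices besides the centre; the centre is vertex 0
-- and the first petal of the list is numbered last.
roseAdj : ∀ ms → Fin (suc (size ms)) → Fin (suc (size ms)) → Bool
petalAdj : ∀ m ms → Fin (suc (size ms)) ⊎ Fin m → Fin (suc (size ms)) ⊎ Fin m → Bool
roseAdj []       i j = false
roseAdj (m ∷ ms) i j = petalAdj m ms (Fin.splitAt (suc (size ms)) i) (Fin.splitAt (suc (size ms)) j)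
petalAdj m ms (inj₁ i) (inj₁ j) = roseAdj ms i j
petalAdj m ms (inj₁ i) (inj₂ j) = isFirst i ∧ isEnd j
petalAdj m ms (inj₂ i) (inj₁ j) = isFirst j ∧ isEnd i
petalAdj m ms (inj₂ i) (inj₂ j) = pathAdj i j

module _ (m : ℕ) (ms : List ℕ) where
  private
    r : ℕ
    r = suc (size ms)

  roseAdj-ˡˡ : ∀ (i j : Fin r) → roseAdj (m ∷ ms) (i ↑ˡ m) (j ↑ˡ m) ≡ roseAdj ms i j
  roseAdj-ˡˡ i j = cong₂ (petalAdj m ms) (Finₚ.splitAt-↑ˡ r i m) (Finₚ.splitAt-↑ˡ r j m)

  roseAdj-ˡʳ : ∀ (i : Fin r) (j : Fin m) → roseAdj (m ∷ ms) (i ↑ˡ m) (r ↑ʳ j) ≡ isFirst i ∧ isEnd j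
  roseAdj-ˡʳ i j = cong₂ (petalAdj m ms) (Finₚ.splitAt-↑ˡ r i m) (Finₚ.splitAt-↑ʳ r m j)

  roseAdj-ʳˡ : ∀ (i : Fin m) (j : Fin r) → roseAdj (m ∷ ms) (r ↑ʳ i) (j ↑ˡ m) ≡ isFirst j ∧ isEnd i
  roseAdj-ʳˡ i j = cong₂ (petalAdj m ms) (Finₚ.splitAt-↑ʳ r m i) (Finₚ.splitAt-↑ˡ r j m)

  roseAdj-ʳʳ : ∀ (i j : Fin m) → roseAdj (m ∷ ms) (r ↑ʳ i) (r ↑ʳ j) ≡ pathAdj i j
  roseAdj-ʳʳ i j = cong₂ (petalAdj m ms) (Finₚ.splitAt-↑ʳ r m i) (Finₚ.splitAt-↑ʳ r m j)

δ-ˡˡ : ∀ {r} m (i j : Fin r) → δ (i ↑ˡ m) (j ↑ˡ m) ≡ δ i j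
δ-ˡˡ m zero    zero    = refl
δ-ˡˡ m zero    (suc j) = refl
δ-ˡˡ m (suc i) zero    = refl
δ-ˡˡ m (suc i) (suc j) = δ-ˡˡ m i j

δ-ˡʳ : ∀ {r m} (i : Fin r) (j : Fin m) → δ (i ↑ˡ m) (r ↑ʳ j) ≡ 0ℤ
δ-ˡʳ zero    j = refl
δ-ˡʳ (suc i) j = δ-ˡʳ i j

δ-ʳʳ : ∀ r {m} (i j : Fin m) → δ (r ↑ʳ i) (r ↑ʳ j) ≡ δ i j
δ-ʳʳ zero    i j = refl
δ-ʳʳ (suc r) i j = δ-ʳʳ r i j

∑-split : ∀ r {m} (f : Fin (r ℕ.+ m) → ℤ) → ∑ f ≡ ∑ (λ i → f (i ↑ˡ m)) + ∑ (λ j → f (r ↑ʳ j))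
∑-split zero    f = ≡-sym (ℤₚ.+-identityˡ (∑ f))
∑-split (suc r) {m} f = trans (cong (_+_ (f zero)) (∑-split r (f ∘ suc))) (≡-sym (ℤₚ.+-assoc (f zero) (∑ (λ (i : Fin r) → f (suc i ↑ˡ m))) (∑ (λ j → f (suc r ↑ʳ j)))))

∑-isFirst : ∀ {m} (V : ℕ → ℤ) → ∑ {suc m} (λ i → V (suc (toℕ i)) * bit (isFirst i)) ≡ V 1
∑-isFirst {m} V = trans (cong₂ _+_ (ℤₚ.*-identityʳ (V 1)) (∑-zero {m} (λ i → ℤₚ.*-zeroʳ (V (suc (suc (toℕ i))))))) (ℤₚ.+-identityʳ (V 1))

∑-isLast : ∀ {m} (V : ℕ → ℤ) → ∑ {suc m} (λ i → V (suc (toℕ i)) * bit (isLast i)) ≡ V (suc m)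
∑-isLast {zero}  V = trans (ℤₚ.+-identityʳ (V 1 * 1ℤ)) (ℤₚ.*-identityʳ (V 1))
∑-isLast {suc m} V = trans (cong₂ _+_ (ℤₚ.*-zeroʳ (V 1)) (∑-isLast (V ∘ suc))) (ℤₚ.+-identityˡ (V (suc (suc m))))

-- Path vertex `i` carries the value of `V` at i + 1. The boundary terms `V 0` and `V (suc m)`
-- supply the missing neighbours of the two ends, so that one formula holds for every vertex.
∑-pathAdj : ∀ {m} (V : ℕ → ℤ) (j : Fin m) →
            ∑ (λ i → V (suc (toℕ i)) * bit (pathAdj i j)) + (bit (isFirst j) * V 0 + bit (isLast j) * V (suc m)) ≡ V (toℕ j) + V (suc (suc (toℕ j)))
∑-pathAdj {suc zero} V zero = identity (V 0) (V 1) (V 2)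
  where
  identity : ∀ a b c → b * 0ℤ + 0ℤ + (1ℤ * a + 1ℤ * c) ≡ a + c
  identity = solve-∀
∑-pathAdj {suc (suc m)} V zero = trans (cong (λ z → V 1 * 0ℤ + z + (1ℤ * V 0 + 0ℤ * V (suc (suc (suc m))))) (∑-isFirst {m} (V ∘ suc)))
                                       (identity (V 0) (V 1) (V 2) (V (suc (suc (suc m)))))
  where
  identity : ∀ a b c d → b * 0ℤ + c + (1ℤ * a + 0ℤ * d) ≡ a + c
  identity = solve-∀
∑-pathAdj {suc m} V (suc j) = trans (identity (V 0) (V 1) (bit (isFirst j)) (∑ (λ i → V (suc (suc (toℕ i))) * bit (pathAdj i j))) (bit (isLast j) * V (suc (suc m))))
                                    (∑-pathAdj (V ∘ suc) j)
  where
  identity : ∀ a b f s l → b * f + s + (0ℤ * a + l) ≡ s + (f * b + l)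
  identity = solve-∀

module RoseMatrix (y : ℤ) where

  -- The diagonal entry s - 2u of a vertex of degree 2 at s = (1 - y)², u = - y.
  ρ : ℤ
  ρ = 1ℤ + y * y

  pathMat : ∀ m → Mat m m
  pathMat m i j = ρ * δ i j - y * bit (pathAdj i j)

  -- The central entry `x` is a parameter because petals are removed one at a time while the entry
  -- stays that of the full rose.
  roseMat : ℤ → ∀ ms → Mat (suc (size ms)) (suc (size ms))
  roseMat x ms i j = (x ◂ (λ _ → ρ)) i * δ i j - y * bit (roseAdj ms i j)

  det-path-suc : ∀ m → det (suc (suc m)) (pathMat (suc (suc m))) ≡ ρ * det (suc m) (pathMat (suc m)) - y * y * det m (pathMat m)
  det-path-suc m = begin
    det (suc (suc m)) X
      ≡⟨ det-suc (suc m) X ⟩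
    X zero zero * det (suc m) (pathMat (suc m)) - (X zero (suc zero) * det (suc m) N - altSum m (λ j → X zero (suc (suc j)) * det (suc m) (minor X (suc (suc j)))))
      ≡⟨ cong₂ (λ p q → X zero zero * det (suc m) (pathMat (suc m)) - (X zero (suc zero) * p - q))
           (det-pivot N (λ r → zeros ρ y)) (altSum-zero (λ j → trans (cong (_* det (suc m) (minor X (suc (suc j)))) (zeros ρ y)) (ℤₚ.*-zeroˡ (det (suc m) (minor X (suc (suc j))))))) ⟩
    X zero zero * det (suc m) (pathMat (suc m)) - (X zero (suc zero) * (N zero zero * det m (pathMat m)) - 0ℤ)
      ≡⟨ identity ρ y (det (suc m) (pathMat (suc m))) (det m (pathMat m)) ⟩
    ρ * det (suc m) (pathMat (suc m)) - y * y * det m (pathMat m) ∎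
    where
    open ≡-Reasoning
    X = pathMat (suc (suc m))
    N = minor X (suc zero)
    zeros : ∀ ρ y → ρ * 0ℤ - y * 0ℤ ≡ 0ℤ
    zeros = solve-∀
    identity : ∀ ρ y p q → (ρ * 1ℤ - y * 0ℤ) * p - ((ρ * 0ℤ - y * 1ℤ) * ((ρ * 0ℤ - y * 1ℤ) * q) - 0ℤ) ≡ ρ * p - y * y * q
    identity = solve-∀

  -- The recurrence of `det-path-suc` has the characteristic roots 1 and y², so the determinant is
  -- the geometric sum 1 + y² + ... + y²ᵐ.
  det-path : ∀ m → (1ℤ - y * y) * det m (pathMat m) ≡ 1ℤ - y ^ suc m * y ^ suc m
  det-path zero = base y
    where
    base : ∀ y → (1ℤ - y * y) * 1ℤ ≡ 1ℤ - y * 1ℤ * (y * 1ℤ)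
    base = solve-∀
  det-path (suc zero) = trans (cong ((1ℤ - y * y) *_) (det-suc 0 (pathMat 1))) (base y)
    where
    base : ∀ y → (1ℤ - y * y) * (((1ℤ + y * y) * 1ℤ - y * 0ℤ) * 1ℤ - 0ℤ) ≡ 1ℤ - y * (y * 1ℤ) * (y * (y * 1ℤ))
    base = solve-∀
  det-path (suc (suc m)) = trans (cong ((1ℤ - y * y) *_) (det-path-suc m)) (trans (distribute (1ℤ - y * y) ρ (y * y) (det (suc m) (pathMat (suc m))) (det m (pathMat m)))
    (trans (cong₂ (λ p q → ρ * p - y * y * q) (det-path (suc m)) (det-path m)) (identity y (y ^ suc m))))
    where
    distribute : ∀ a b c p q → a * (b * p - c * q) ≡ b * (a * p) - c * (a * q)
    distribute = solve-∀
    identity : ∀ y z → (1ℤ + y * y) * (1ℤ - y * z * (y * z)) - y * y * (1ℤ - z * z) ≡ 1ℤ - y * (y * z) * (y * (y * z))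
    identity = solve-∀

  module _ (x : ℤ) (m′ : ℕ) (ms : List ℕ) where
    private
      m r l : ℕ
      m = suc (suc m′)
      r = suc (size ms)
      l = suc m
      Y = y ^ l
      M : Mat (r ℕ.+ m) (r ℕ.+ m)
      M = roseMat x (m ∷ ms)
      R : Mat r r
      R = roseMat x ms

    M-ˡˡ : ∀ (i j : Fin r) → M (i ↑ˡ m) (j ↑ˡ m) ≡ R i j
    M-ˡˡ i j = cong₂ _-_ (cong₂ _*_ (diag i) (δ-ˡˡ m i j)) (cong (λ b → y * bit b) (roseAdj-ˡˡ m ms i j))
      where
      diag : ∀ (i : Fin r) → (x ◂ (λ _ → ρ)) (i ↑ˡ m) ≡ (x ◂ (λ _ → ρ)) i
      diag zero    = refl
      diag (suc i) = refl

    M-ˡʳ : ∀ (i : Fin r) (j : Fin m) → M (i ↑ˡ m) (r ↑ʳ j) ≡ - (y * bit (isFirst i ∧ isEnd j))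
    M-ˡʳ i j = trans (cong₂ (λ d b → (x ◂ (λ _ → ρ)) (i ↑ˡ m) * d - y * bit b) (δ-ˡʳ i j) (roseAdj-ˡʳ m ms i j))
                     (identity ((x ◂ (λ _ → ρ)) (i ↑ˡ m)) (y * bit (isFirst i ∧ isEnd j)))
      where
      identity : ∀ a b → a * 0ℤ - b ≡ - b
      identity = solve-∀

    M-ʳˡ : ∀ (i : Fin m) (j : Fin r) → M (r ↑ʳ i) (j ↑ˡ m) ≡ - (y * bit (isFirst j ∧ isEnd i))
    M-ʳˡ i j = trans (cong₂ (λ d b → (x ◂ (λ _ → ρ)) (r ↑ʳ i) * d - y * bit b) (trans (δ-sym (r ↑ʳ i) (j ↑ˡ m)) (δ-ˡʳ j i)) (roseAdj-ʳˡ m ms i j))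
                     (identity ((x ◂ (λ _ → ρ)) (r ↑ʳ i)) (y * bit (isFirst j ∧ isEnd i)))
      where
      identity : ∀ a b → a * 0ℤ - b ≡ - b
      identity = solve-∀

    M-ʳʳ : ∀ (i j : Fin m) → M (r ↑ʳ i) (r ↑ʳ j) ≡ pathMat m i j
    M-ʳʳ i j = cong₂ (λ d b → ρ * d - y * bit b) (δ-ʳʳ r i j) (roseAdj-ʳʳ m ms i j)

    -- Among the rows of the smaller rose only the central one meets the columns of the new petal.
    -- Once it is replaced by a row that vanishes there, the matrix is block triangular.
    det-replaced : ∀ (v : Fin (r ℕ.+ m) → ℤ) (w : Fin r → ℤ) → (∀ (j : Fin r) → v (j ↑ˡ m) ≡ w j) → (∀ (j : Fin m) → v (r ↑ʳ j) ≡ 0ℤ) →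
                   det (r ℕ.+ m) (M [ zero ]≔ v) ≡ det r (R [ zero ]≔ w) * det m (pathMat m)
    det-replaced v w vˡ vʳ = trans (det-block r m (M [ zero ]≔ v) upper) (cong₂ _*_ (det-cong left) (det-cong M-ʳʳ))
      where
      upper : ∀ (i : Fin r) (j : Fin m) → (M [ zero ]≔ v) (i ↑ˡ m) (r ↑ʳ j) ≡ 0ℤ
      upper zero    j = vʳ j
      upper (suc i) j = trans (M-ˡʳ (suc i) j) (cong -_ (ℤₚ.*-zeroʳ y))
      left : ∀ (i j : Fin r) → (M [ zero ]≔ v) (i ↑ˡ m) (j ↑ˡ m) ≡ (R [ zero ]≔ w) i j
      left zero    j = vˡ j
      left (suc i) j = M-ˡˡ (suc i) j

    det-minor-rose : det (r ℕ.+ m) (M [ zero ]≔ δ zero) ≡ det r (R [ zero ]≔ δ zero) * det m (pathMat m)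
    det-minor-rose = det-replaced (δ zero) (δ zero) (δ-ˡˡ m zero) (δ-ˡʳ {r} zero)

    private
      -- A solution of `ρ * V (suc j) ≡ y * (V j + V (suc (suc j)))` along the cycle, so interior
      -- columns cancel. It is made symmetric so that `V 0` and `V l` both equal `1ℤ + Y`, the
      -- weight given to the central row.
      V : ℕ → ℤ
      V j = y ^ j + y ^ (l ℕ.∸ j)

      V-recurrence : ∀ j → suc (suc j) ≤ l → ρ * V (suc j) ≡ y * (V j + V (suc (suc j)))
      V-recurrence j le = trans (cong (λ z → ρ * (y * y ^ j + z)) e₁) (trans (identity y (y ^ j) (y ^ e)) (cong (λ z → y * (y ^ j + z + (y * (y * y ^ j) + y ^ e))) (≡-sym e₂)))
        where
        e = l ℕ.∸ suc (suc j)
        e₁ : y ^ (l ℕ.∸ suc j) ≡ y * y ^ e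
        e₁ = cong (y ^_) (ℕₚ.+-∸-assoc 1 le)
        e₂ : y ^ (l ℕ.∸ j) ≡ y * (y * y ^ e)
        e₂ = cong (y ^_) (ℕₚ.+-∸-assoc 2 le)
        identity : ∀ y p q → (1ℤ + y * y) * (y * p + y * q) ≡ y * (p + y * (y * q) + (y * (y * p) + q))
        identity = solve-∀

      bit-end : ∀ (j : Fin m) → bit (isEnd j) ≡ bit (isFirst j) + bit (isLast j)
      bit-end zero    = refl
      bit-end (suc j) = ≡-sym (ℤₚ.+-identityˡ (bit (isLast j)))

      V-l : V l ≡ 1ℤ + Y
      V-l = trans (cong (λ k → Y + y ^ k) (ℕₚ.n∸n≡0 m)) (ℤₚ.+-comm Y 1ℤ)

      V-m : V m ≡ y ^ m + y
      V-m = cong (_+_ (y ^ m)) (trans (cong (y ^_) (ℕₚ.m+n∸n≡m 1 m′)) (ℤₚ.*-identityʳ y))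

      weight : Fin r ⊎ Fin m → ℤ
      weight (inj₁ i) = (1ℤ + Y) * δ zero i
      weight (inj₂ j) = V (suc (toℕ j))

      a : Fin (r ℕ.+ m) → ℤ
      a i = weight (Fin.splitAt r i)

      a-ˡ : ∀ (i : Fin r) → a (i ↑ˡ m) ≡ (1ℤ + Y) * δ zero i
      a-ˡ i = cong weight (Finₚ.splitAt-↑ˡ r i m)

      a-ʳ : ∀ (j : Fin m) → a (r ↑ʳ j) ≡ V (suc (toℕ j))
      a-ʳ j = cong weight (Finₚ.splitAt-↑ʳ r m j)

      v : Fin (r ℕ.+ m) → ℤ
      v k = ∑ (λ i → a i * M i k)

      v-split : ∀ k → v k ≡ (1ℤ + Y) * M zero k + ∑ (λ j → V (suc (toℕ j)) * M (r ↑ʳ j) k)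
      v-split k = trans (∑-split r (λ i → a i * M i k)) (cong₂ _+_
        (trans (∑-cong (λ i → trans (cong (_* M (i ↑ˡ m) k) (a-ˡ i)) (rearrange (1ℤ + Y) (δ zero i) (M (i ↑ˡ m) k)))) (∑-δ zero (λ i → (1ℤ + Y) * M (i ↑ˡ m) k)))
        (∑-cong (λ j → cong (_* M (r ↑ʳ j) k) (a-ʳ j))))
        where
        rearrange : ∀ a d b → a * d * b ≡ a * b * d
        rearrange = solve-∀

      ends : ∑ (λ j → V (suc (toℕ j)) * bit (isEnd {m} j)) ≡ + 2 * (y + y ^ m)
      ends = trans (∑-cong (λ j → trans (cong (V (suc (toℕ j)) *_) (bit-end j)) (ℤₚ.*-distribˡ-+ (V (suc (toℕ j))) (bit (isFirst j)) (bit (isLast j)))))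
             (trans (∑-+ (λ j → V (suc (toℕ j)) * bit (isFirst {m} j)) (λ j → V (suc (toℕ j)) * bit (isLast {m} j)))
             (trans (cong₂ _+_ (∑-isFirst {suc m′} V) (trans (∑-isLast {suc m′} V) V-m)) (identity y (y ^ m))))
        where
        identity : ∀ y z → y * 1ℤ + z + (z + y) ≡ + 2 * (y + z)
        identity = solve-∀

      -- `y` times the weights of the two petal vertices next to the centre, `V 1` and `V m`, each
      -- equal to y + yᵐ.
      κ = + 2 * (y * y + Y)

      v-ˡ : ∀ (j : Fin r) → v (j ↑ˡ m) ≡ (1ℤ + Y) * R zero j + - κ * δ zero j
      v-ˡ j = trans (v-split (j ↑ˡ m)) (cong₂ _+_ (cong ((1ℤ + Y) *_) (M-ˡˡ zero j))
        (trans (∑-cong (λ i → trans (cong (V (suc (toℕ i)) *_) (M-ʳˡ i j)) (pull j i)))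
        (trans (∑-* (- y * δ zero j) (λ i → V (suc (toℕ i)) * bit (isEnd {m} i))) (trans (cong (- y * δ zero j *_) ends) (identity y (δ zero j) (y ^ m))))))
        where
        identity : ∀ y d z → - y * d * (+ 2 * (y + z)) ≡ - (+ 2 * (y * y + y * z)) * d
        identity = solve-∀
        pull : ∀ (j : Fin r) (i : Fin m) → V (suc (toℕ i)) * - (y * bit (isFirst j ∧ isEnd i)) ≡ - y * δ zero j * (V (suc (toℕ i)) * bit (isEnd {m} i))
        pull zero    i = pull₁ (V (suc (toℕ i))) y (bit (isEnd i))
          where
          pull₁ : ∀ v y b → v * - (y * b) ≡ - y * 1ℤ * (v * b)
          pull₁ = solve-∀
        pull (suc j) i = pull₀ (V (suc (toℕ i))) y (bit (isEnd i))
          where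
          pull₀ : ∀ v y b → v * - (y * 0ℤ) ≡ - y * 0ℤ * (v * b)
          pull₀ = solve-∀

      v-ʳ : ∀ (j : Fin m) → v (r ↑ʳ j) ≡ 0ℤ
      v-ʳ j = begin
        v (r ↑ʳ j)
          ≡⟨ v-split (r ↑ʳ j) ⟩
        (1ℤ + Y) * M zero (r ↑ʳ j) + ∑ (λ i → V (suc (toℕ i)) * M (r ↑ʳ i) (r ↑ʳ j))
          ≡⟨ cong₂ (λ p q → (1ℤ + Y) * p + q) (M-ˡʳ zero j) (∑-cong (λ i → trans (cong (V (suc (toℕ i)) *_) (M-ʳʳ i j))
               (trans (cong (λ d → V (suc (toℕ i)) * (ρ * d - y * bit (pathAdj i j))) (δ-sym i j)) (expand (V (suc (toℕ i))) ρ (δ j i) y (bit (pathAdj i j)))))) ⟩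
        (1ℤ + Y) * - (y * bit (isEnd j)) + ∑ (λ i → ρ * V (suc (toℕ i)) * δ j i + - y * (V (suc (toℕ i)) * bit (pathAdj i j)))
          ≡⟨ cong (_+_ ((1ℤ + Y) * - (y * bit (isEnd j)))) (trans (∑-+ (λ i → ρ * V (suc (toℕ i)) * δ j i) (λ i → - y * (V (suc (toℕ i)) * bit (pathAdj i j))))
               (cong₂ _+_ (trans (∑-δ j (λ i → ρ * V (suc (toℕ i)))) (V-recurrence (toℕ j) (s≤s (Finₚ.toℕ<n j)))) (∑-* (- y) (λ i → V (suc (toℕ i)) * bit (pathAdj i j))))) ⟩
        (1ℤ + Y) * - (y * bit (isEnd j)) + (y * (V (toℕ j) + V (suc (suc (toℕ j)))) + - y * S)
          ≡⟨ cong₂ (λ b s → (1ℤ + Y) * - (y * b) + (y * s + - y * S)) (bit-end j) (≡-sym (∑-pathAdj V j)) ⟩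
        (1ℤ + Y) * - (y * (bit (isFirst j) + bit (isLast j))) + (y * (S + (bit (isFirst j) * (1ℤ + Y) + bit (isLast j) * V l)) + - y * S)
          ≡⟨ cong (λ z → (1ℤ + Y) * - (y * (bit (isFirst j) + bit (isLast j))) + (y * (S + (bit (isFirst j) * (1ℤ + Y) + bit (isLast j) * z)) + - y * S)) V-l ⟩
        (1ℤ + Y) * - (y * (bit (isFirst j) + bit (isLast j))) + (y * (S + (bit (isFirst j) * (1ℤ + Y) + bit (isLast j) * (1ℤ + Y))) + - y * S)
          ≡⟨ cancel Y y (bit (isFirst j)) (bit (isLast j)) S ⟩
        0ℤ ∎
        where
        open ≡-Reasoning
        S = ∑ (λ i → V (suc (toℕ i)) * bit (pathAdj i j))
        expand : ∀ v ρ d y b → v * (ρ * d - y * b) ≡ ρ * v * d + - y * (v * b)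
        expand = solve-∀
        cancel : ∀ Y y f l S → (1ℤ + Y) * - (y * (f + l)) + (y * (S + (f * (1ℤ + Y) + l * (1ℤ + Y))) + - y * S) ≡ 0ℤ
        cancel = solve-∀

    -- Adding (yʲ + yˡ⁻ʲ) times the j-th row of the petal to 1 + yˡ times the central row clears the petal's columns.
    det-rose : (1ℤ + y ^ suc m) * det (r ℕ.+ m) M
             ≡ ((1ℤ + y ^ suc m) * det r R - + 2 * (y * y + y ^ suc m) * det r (R [ zero ]≔ δ zero)) * det m (pathMat m)
    det-rose = begin
      (1ℤ + Y) * det (r ℕ.+ m) M               ≡⟨ cong (_* det (r ℕ.+ m) M) (ℤₚ.*-identityʳ (1ℤ + Y)) ⟨
      (1ℤ + Y) * 1ℤ * det (r ℕ.+ m) M          ≡⟨ replace-row (det-alternating (r ℕ.+ m)) M zero a ⟨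
      det (r ℕ.+ m) (M [ zero ]≔ v)            ≡⟨ det-replaced v (λ j → (1ℤ + Y) * R zero j + - κ * δ zero j) v-ˡ v-ʳ ⟩
      det r (R [ zero ]≔ (λ j → (1ℤ + Y) * R zero j + - κ * δ zero j)) * det m (pathMat m)
        ≡⟨ cong (_* det m (pathMat m)) (trans (det-linear R zero (1ℤ + Y) (R zero) (λ j → - κ * δ zero j))
             (cong₂ (λ p q → (1ℤ + Y) * p + q) (det-cong (λ i j → cong (λ row → row j) (≔-self R zero i)))
               (trans (scale (det-alternating r) R zero (- κ) (δ zero)) (≡-sym (ℤₚ.neg-distribˡ-* κ (det r (R [ zero ]≔ δ zero))))))) ⟩
      ((1ℤ + Y) * det r R - κ * det r (R [ zero ]≔ δ zero)) * det m (pathMat m) ∎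
      where open ≡-Reasoning

-- Recovering the cycle lengths

-- A list p₁, p₂, … of naturals stands for the rose with cycles of lengths 3 + p₁, 3 + p₂, …
petalSizes : List ℕ → List ℕ
petalSizes = map (λ p → suc (suc p))

module _ (y : ℤ) where

  -- `Ã` and `D̃` are the determinants of the rose without and with its centre, multiplied by (1 -
  -- y²) to the number of petals; this clears the denominators of the petal recursion.
  Ã : List ℕ → ℤ
  Ã []       = 1ℤ
  Ã (p ∷ ps) = let Y = y ^ (3 ℕ.+ p) in (1ℤ - Y * Y) * Ã ps

  D̃ : ℤ → List ℕ → ℤ
  D̃ x []       = x
  D̃ x (p ∷ ps) = let Y = y ^ (3 ℕ.+ p) in (1ℤ - Y * Y) * D̃ x ps - + 2 * (y * y + Y) * (1ℤ - Y) * Ã ps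

pos-^ : ∀ v l → (+ v) ^ l ≡ + (v ℕ.^ l)
pos-^ v zero    = refl
pos-^ v (suc l) = trans (cong (+ v *_) (pos-^ v l)) (≡-sym (ℤₚ.pos-* v (v ℕ.^ l)))

module _ (v : ℕ) where
  private
    y = + v
    open RoseMatrix y

    -- At a natural number `y` the factor `1ℤ + y ^ l` is positive and can be cancelled.
    one-plus : ∀ l {a b} → (1ℤ + y ^ l) * a ≡ (1ℤ + y ^ l) * b → a ≡ b
    one-plus l {a} {b} e = *-cancelˡ (+ suc (v ℕ.^ l)) {a} {b} (trans (cong (_* a) (≡-sym positive)) (trans e (cong (_* b) positive)))
      where
      positive : 1ℤ + y ^ l ≡ + suc (v ℕ.^ l)
      positive = trans (cong (_+_ 1ℤ) (pos-^ v l)) (≡-sym (ℤₚ.pos-+ 1 (v ℕ.^ l)))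

  rose-det : ℤ → List ℕ → ℤ
  rose-det x ps = det (suc (size (petalSizes ps))) (roseMat x (petalSizes ps))

  private
    minor-det : ℤ → List ℕ → ℤ
    minor-det x ps = det (suc (size (petalSizes ps))) (roseMat x (petalSizes ps) [ zero ]≔ δ zero)

    minor-det-Ã : ∀ x ps → (1ℤ - y * y) ^ length ps * minor-det x ps ≡ Ã y ps
    minor-det-Ã x []       = trans (ℤₚ.*-identityˡ (minor-det x [])) (det-δ 1)
    minor-det-Ã x (p ∷ ps) = begin
      u * u ^ k * minor-det x (p ∷ ps)                  ≡⟨ cong (u * u ^ k *_) (det-minor-rose x p (petalSizes ps)) ⟩
      u * u ^ k * (minor-det x ps * Π)                  ≡⟨ rearrange u (u ^ k) (minor-det x ps) Π ⟩
      u * Π * (u ^ k * minor-det x ps)                  ≡⟨ cong₂ _*_ (det-path (2 ℕ.+ p)) (minor-det-Ã x ps) ⟩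
      (1ℤ - Y * Y) * Ã y ps                             ∎
      where
      open ≡-Reasoning
      k = length ps
      u = 1ℤ - y * y
      Y = y ^ (3 ℕ.+ p)
      Π = det (2 ℕ.+ p) (pathMat (2 ℕ.+ p))
      rearrange : ∀ u w m π → u * w * (m * π) ≡ u * π * (w * m)
      rearrange = solve-∀

  rose-det-D̃ : ∀ x ps → (1ℤ - y * y) ^ length ps * rose-det x ps ≡ D̃ y x ps
  rose-det-D̃ x []       = trans (ℤₚ.*-identityˡ (rose-det x [])) (trans (det-suc 0 (roseMat x [])) (base x y))
    where
    base : ∀ x y → (x * 1ℤ - y * 0ℤ) * 1ℤ - 0ℤ ≡ x
    base = solve-∀
  rose-det-D̃ x (p ∷ ps) = one-plus (3 ℕ.+ p) {u * u ^ k * rose-det x (p ∷ ps)} {D̃ y x (p ∷ ps)} (begin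
    (1ℤ + Y) * (u * u ^ k * rose-det x (p ∷ ps))                                ≡⟨ swap (1ℤ + Y) (u * u ^ k) (rose-det x (p ∷ ps)) ⟩
    u * u ^ k * ((1ℤ + Y) * rose-det x (p ∷ ps))                                ≡⟨ cong (u * u ^ k *_) (det-rose x p (petalSizes ps)) ⟩
    u * u ^ k * (((1ℤ + Y) * rose-det x ps - κ * minor-det x ps) * Π)           ≡⟨ rearrange u (u ^ k) (1ℤ + Y) κ (rose-det x ps) (minor-det x ps) Π ⟩
    u * Π * ((1ℤ + Y) * (u ^ k * rose-det x ps) - κ * (u ^ k * minor-det x ps)) ≡⟨ cong₂ _*_ (det-path (2 ℕ.+ p)) (cong₂ (λ a b → (1ℤ + Y) * a - κ * b) (rose-det-D̃ x ps) (minor-det-Ã x ps)) ⟩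
    (1ℤ - Y * Y) * ((1ℤ + Y) * D̃ y x ps - κ * Ã y ps)                           ≡⟨ factor Y κ (D̃ y x ps) (Ã y ps) ⟩
    (1ℤ + Y) * ((1ℤ - Y * Y) * D̃ y x ps - κ * (1ℤ - Y) * Ã y ps)                ∎)
    where
    open ≡-Reasoning
    k = length ps
    u = 1ℤ - y * y
    Y = y ^ (3 ℕ.+ p)
    κ = + 2 * (y * y + Y)
    Π = det (2 ℕ.+ p) (pathMat (2 ℕ.+ p))
    swap : ∀ a b c → a * (b * c) ≡ b * (a * c)
    swap = solve-∀
    rearrange : ∀ u w a κ d m π → u * w * ((a * d - κ * m) * π) ≡ u * π * (a * (w * d) - κ * (w * m))
    rearrange = solve-∀
    factor : ∀ Y κ d a → (1ℤ - Y * Y) * ((1ℤ + Y) * d - κ * a) ≡ (1ℤ + Y) * ((1ℤ - Y * Y) * d - κ * (1ℤ - Y) * a)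
    factor = solve-∀

indicator : ∀ {A : Set} → Dec A → ℕ
indicator (yes _) = 1
indicator (no _)  = 0

count : ℕ → List ℕ → ℕ
count p []       = 0
count p (r ∷ rs) = indicator (r ℕ.≟ p) ℕ.+ count p rs

-- Modulo y · yᵖ⁺³ a list of entries ≥ p is seen only through its length and the multiplicity of p.
module _ (y : ℤ) (p : ℕ) where
  private
    Y = y ^ (3 ℕ.+ p)
    N = y * Y

    power-≥ : ∀ {r} → p ≤ r → y ^ (3 ℕ.+ r) ≡ Y * y ^ (r ℕ.∸ p)
    power-≥ {r} p≤r = trans (cong (λ k → y ^ (3 ℕ.+ k)) (≡-sym (ℕₚ.m+[n∸m]≡n p≤r))) (ℤₚ.^-distribˡ-+-* y (3 ℕ.+ p) (r ℕ.∸ p))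

    square≈0 : ∀ {r} → p ≤ r → let Z = y ^ (3 ℕ.+ r) in Z * Z ≈[ N ] 0ℤ
    square≈0 {r} p≤r = by (y ^ (2 ℕ.+ p) * w * w) (trans (cong (λ z → z * z) (power-≥ p≤r)) (identity y (y ^ (2 ℕ.+ p)) w))
      where
      w = y ^ (r ℕ.∸ p)
      identity : ∀ y z w → y * z * w * (y * z * w) ≡ 0ℤ + z * w * w * (y * (y * z))
      identity = solve-∀

    shift≈0 : ∀ {r} → p ≤ r → y * y * y ^ (3 ℕ.+ r) ≈[ N ] 0ℤ
    shift≈0 {r} p≤r = by (y * w) (trans (cong (y * y *_) (power-≥ p≤r)) (identity y Y w))
      where
      w = y ^ (r ℕ.∸ p)
      identity : ∀ y Y w → y * y * (Y * w) ≡ 0ℤ + y * w * (y * Y)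
      identity = solve-∀

    power≈ : ∀ {r} → p ≤ r → y ^ (3 ℕ.+ r) ≈[ N ] + indicator (r ℕ.≟ p) * Y
    power≈ {r} p≤r with r ℕ.≟ p
    ... | yes refl = ≈-reflexive (≡-sym (ℤₚ.*-identityˡ Y))
    ... | no r≢p   = by (y ^ (r ℕ.∸ suc p)) (trans (power-≥ p≤r) (trans (cong (λ k → Y * y ^ k) (ℕₚ.+-∸-assoc 1 p<r)) (identity y Y (y ^ (r ℕ.∸ suc p)))))
      where
      p<r : suc p ≤ r
      p<r = ℕₚ.≤∧≢⇒< p≤r (r≢p ∘ ≡-sym)
      identity : ∀ y Y w → Y * (y * w) ≡ 0ℤ * Y + w * (y * Y)
      identity = solve-∀

  Ã-≈ : ∀ {rs} → All (p ≤_) rs → Ã y rs ≈[ N ] 1ℤ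
  Ã-≈ []          = ≈-refl
  Ã-≈ {r ∷ rs} (p≤r ∷ ≥) = ≈-* (≈-- (≈-refl {a = 1ℤ}) (square≈0 p≤r)) (Ã-≈ ≥)

  D̃-≈ : ∀ x {rs} → All (p ≤_) rs → D̃ y x rs ≈[ N ] x - + 2 * (+ length rs * (y * y) + + count p rs * Y)
  D̃-≈ x []          = ≈-reflexive (identity x y Y)
    where
    identity : ∀ x y Y → x ≡ x - + 2 * (0ℤ * (y * y) + 0ℤ * Y)
    identity = solve-∀
  D̃-≈ x {r ∷ rs} (p≤r ∷ ≥) =
    ≈-trans (≈-- (≈-* (≈-- (≈-refl {a = 1ℤ}) (square≈0 p≤r)) (D̃-≈ x ≥)) (≈-* term (Ã-≈ ≥)))
            (≈-reflexive (trans (identity x (+ length rs) (+ count p rs) (+ b) y Y) (cong₂ (λ n c → x - + 2 * (n * (y * y) + c * Y)) (≡-sym (ℤₚ.pos-+ 1 (length rs))) (≡-sym (ℤₚ.pos-+ b (count p rs))))))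
    where
    b : ℕ
    b = indicator (r ℕ.≟ p)
    Z = y ^ (3 ℕ.+ r)
    identity : ∀ x n c b y Y → (1ℤ - 0ℤ) * (x - + 2 * (n * (y * y) + c * Y)) - + 2 * (y * y + b * Y) * 1ℤ ≡ x - + 2 * ((1ℤ + n) * (y * y) + (b + c) * Y)
    identity = solve-∀
    expand : ∀ y Z → + 2 * (y * y + Z) * (1ℤ - Z) ≡ + 2 * (y * y + Z) - + 2 * (y * y * Z + Z * Z)
    expand = solve-∀
    term : + 2 * (y * y + Z) * (1ℤ - Z) ≈[ N ] + 2 * (y * y + + b * Y)
    term = ≈-trans (≈-reflexive (expand y Z)) (≈-trans (≈-- (≈-* (≈-refl {a = + 2}) (≈-+ (≈-refl {a = y * y}) (power≈ p≤r)))
                                                           (≈-* (≈-refl {a = + 2}) (≈-+ (shift≈0 p≤r) (square≈0 p≤r))))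
                                                       (≈-reflexive (ℤₚ.+-identityʳ (+ 2 * (y * y + + b * Y)))))

count-> : ∀ {p rs} → All (p ℕ.<_) rs → count p rs ≡ 0
count-> []                      = refl
count-> {p} {r ∷ rs} (p<r ∷ ps) with r ℕ.≟ p
... | yes refl = contradiction p<r (ℕₚ.<-irrefl refl)
... | no _     = count-> ps

count-head : ∀ p rs → count p (p ∷ rs) ≡ suc (count p rs)
count-head p rs with p ℕ.≟ p
... | yes _  = refl
... | no p≢p = contradiction refl p≢p

-- Stripping a common first petal turns `D̃` into a combination of `D̃` and `Ã` of the remaining
-- lists. This shape is stable under stripping, and `α` stays 1 modulo `y`.
Profile : (X α ε : ℤ → ℤ) → ℤ → List ℕ → ℤ
Profile X α ε y ps = α y * D̃ y (X y) ps - ε y * Ã y ps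

-- The two profiles first differ at yᵖ⁺³, where p is the smaller of the two minima.
profile-separates : ∀ {X α ε} → (∀ y → α y ≈[ y ] 1ℤ) → ∀ {p rs ss} → All (p ≤_) rs → All (p ℕ.<_) ss → length (p ∷ rs) ≡ length ss →
                    ¬ (∀ v → Profile X α ε (+ v) (p ∷ rs) ≡ Profile X α ε (+ v) ss)
profile-separates {X} {α} {ε} α≈1 {p} {rs} {ss} ≥p >p same-length e =
  contradiction (≈-separated {+ 2 * + suc c} {0ℤ} (λ v → congruent (+ suc v) (e (suc v)))) nonzero
  where
  c = count p rs
  nonzero : + 2 * + suc c ≢ 0ℤ
  nonzero ()
  congruent : ∀ y .{{_ : ℤ.NonZero y}} → Profile X α ε y (p ∷ rs) ≡ Profile X α ε y ss → + 2 * + suc c ≈[ y ] 0ℤ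
  congruent y same = divide (3 ℕ.+ p) final
    where
    Y = y ^ (3 ℕ.+ p)
    N = y * Y
    x = X y
    L = + length ss * (y * y)
    All≤ : All (p ≤_) ss
    All≤ = All.map ℕₚ.<⇒≤ >p
    lhs : Profile X α ε y (p ∷ rs) ≈[ N ] α y * (x - + 2 * (L + + suc c * Y)) - ε y * 1ℤ
    lhs = ≈-- (≈-* (≈-refl {a = α y}) (≈-trans (D̃-≈ y p x (ℕₚ.≤-refl ∷ ≥p)) (≈-reflexive
            (cong₂ (λ n k → x - + 2 * (+ n * (y * y) + + k * Y)) same-length (count-head p rs)))))
          (≈-* (≈-refl {a = ε y}) (Ã-≈ y p (ℕₚ.≤-refl ∷ ≥p)))
    rhs : Profile X α ε y ss ≈[ N ] α y * (x - + 2 * (L + 0ℤ * Y)) - ε y * 1ℤ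
    rhs = ≈-- (≈-* (≈-refl {a = α y}) (≈-trans (D̃-≈ y p x All≤) (≈-reflexive (cong (λ k → x - + 2 * (L + + k * Y)) (count-> >p)))))
          (≈-* (≈-refl {a = ε y}) (Ã-≈ y p All≤))
    difference : α y * (+ 2 * + suc c * Y) ≈[ N ] 0ℤ
    difference = ≈-trans (≈-reflexive (d₁ (α y) x L (+ suc c) Y (ε y))) (≈-trans (≈-- (≈-trans (≈-sym rhs) (≈-trans (≈-reflexive (≡-sym same)) lhs)) (≈-refl {a = α y * (x - + 2 * (L + + suc c * Y)) - ε y * 1ℤ}))
                   (≈-reflexive (ℤₚ.+-inverseʳ (α y * (x - + 2 * (L + + suc c * Y)) - ε y * 1ℤ))))
      where
      d₁ : ∀ α x L c Y ε → α * (+ 2 * c * Y) ≡ α * (x - + 2 * (L + 0ℤ * Y)) - ε * 1ℤ - (α * (x - + 2 * (L + c * Y)) - ε * 1ℤ)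
      d₁ = solve-∀
    -- `α y` is 1 modulo `y` and drops out. Cancelling `Y` then leaves 2(c + 1), twice the
    -- multiplicity of `p` in the first list, congruent to 0 modulo `y`.
    final : Y * (+ 2 * + suc c) ≈[ Y * y ] Y * 0ℤ
    final = ≈-trans (≈-sym (≈-trans (≈-reflexive (d₂ (α y) (+ 2 * + suc c) Y)) (≈-trans (≈-scale Y (≈-* α≈ (≈-refl {a = + 2 * + suc c}))) (≈-reflexive (cong (Y *_) (ℤₚ.*-identityˡ (+ 2 * + suc c)))))))
              (≈-trans (≈-modulus (ℤₚ.*-comm y Y) difference) (≈-reflexive (≡-sym (ℤₚ.*-zeroʳ Y))))
      where
      α≈ = α≈1 y
      d₂ : ∀ α c Y → α * (c * Y) ≡ Y * (α * c)
      d₂ = solve-∀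
    divide : ∀ l {a b N} → y ^ l * a ≈[ y ^ l * N ] y ^ l * b → a ≈[ N ] b
    divide zero    {a} {b} {N} (by q f) = by q (trans (≡-sym (ℤₚ.*-identityˡ a)) (trans f (identity b q N)))
      where
      identity : ∀ b q N → 1ℤ * b + q * (1ℤ * N) ≡ b + q * N
      identity = solve-∀
    divide (suc l) {a} {b} {N} (by q f) = divide l (by q (*-cancelˡ y {y ^ l * a} {y ^ l * b + q * (y ^ l * N)} (trans (assoc₁ y (y ^ l) a) (trans f (assoc₂ y (y ^ l) b q N)))))
      where
      assoc₁ : ∀ y z a → y * (z * a) ≡ y * z * a
      assoc₁ = solve-∀
      assoc₂ : ∀ y z b q N → y * z * b + q * (y * z * N) ≡ y * (z * b + q * (z * N))
      assoc₂ = solve-∀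

-- Since the lists are sorted, a strictly smaller head is absent from the other list, which
-- `profile-separates` excludes. Equal heads are absorbed into `α′` and `ε′`.
profile-injective : ∀ {X α ε} → (∀ y → α y ≈[ y ] 1ℤ) → ∀ {ps qs} → AllPairs _≤_ ps → AllPairs _≤_ qs → length ps ≡ length qs →
                    (∀ v → Profile X α ε (+ v) ps ≡ Profile X α ε (+ v) qs) → ps ≡ qs
profile-injective α≈1 {[]}     {[]}     []       []       len e = refl
profile-injective {X} {α} {ε} α≈1 {p ∷ ps} {q ∷ qs} (p≤ ∷ sp) (q≤ ∷ sq) len e with ℕₚ.<-cmp p q
... | tri< p<q _ _ = ⊥-elim (profile-separates {X} {α} {ε} α≈1 p≤ (p<q ∷ All.map (ℕₚ.<-≤-trans p<q) q≤) len e)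

... | tri> _ _ q<p = ⊥-elim (profile-separates {X} {α} {ε} α≈1 q≤ (q<p ∷ All.map (ℕₚ.<-≤-trans q<p) p≤) (≡-sym len) (≡-sym ∘ e))
... | tri≈ _ refl _ = cong (p ∷_) (profile-injective {X} {α′} {ε′} α′≈1 sp sq (ℕₚ.suc-injective len)
        (λ v → trans (≡-sym (push (+ v) ps)) (trans (e v) (push (+ v) qs))))
  where
  Y : ℤ → ℤ
  Y y = y ^ (3 ℕ.+ p)
  α′ ε′ : ℤ → ℤ
  α′ y = α y * (1ℤ - Y y * Y y)
  ε′ y = α y * (+ 2 * (y * y + Y y) * (1ℤ - Y y)) + ε y * (1ℤ - Y y * Y y)
  α′≈1 : ∀ y → α′ y ≈[ y ] 1ℤ
  α′≈1 y = ≈-* {b = 1ℤ} {d = 1ℤ} (α≈1 y) (by (- (y ^ (2 ℕ.+ p) * Y y)) (identity y (y ^ (2 ℕ.+ p))))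
    where
    identity : ∀ y z → 1ℤ - y * z * (y * z) ≡ 1ℤ + - (z * (y * z)) * y
    identity = solve-∀
  push : ∀ y rs → Profile X α ε y (p ∷ rs) ≡ Profile X α′ ε′ y rs
  push y rs = identity (α y) (ε y) (1ℤ - Y y * Y y) (+ 2 * (y * y + Y y) * (1ℤ - Y y)) (D̃ y (X y) rs) (Ã y rs)
    where
    identity : ∀ a e u k d b → a * (u * d - k * b) - e * (u * b) ≡ a * u * d - (a * k + e * u) * b
    identity = solve-∀

-- Connectedness

geo : ℤ → ℕ → ℤ
geo y zero    = 0ℤ
geo y (suc l) = 1ℤ + y * geo y l

geo-sum : ∀ y l → (1ℤ - y) * geo y l ≡ 1ℤ - y ^ l
geo-sum y zero    = ℤₚ.*-zeroʳ (1ℤ - y)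
geo-sum y (suc l) = trans (expand y (geo y l)) (trans (cong (λ s → 1ℤ - y + y * s) (geo-sum y l)) (identity y (y ^ l)))
  where
  expand : ∀ y g → (1ℤ - y) * (1ℤ + y * g) ≡ 1ℤ - y + y * ((1ℤ - y) * g)
  expand = solve-∀
  identity : ∀ y p → 1ℤ - y + y * (1ℤ - p) ≡ 1ℤ - y * p
  identity = solve-∀

module _ (y : ℤ) where

  -- D̃ divided by (1 - y)ᵏ; for the central entry x = (1 - y)² + 2ky the remaining value is (1 - y)² (Â + Ĉ).
  Â Ĉ : List ℕ → ℤ
  Â []       = 1ℤ
  Â (p ∷ ps) = geo y (3 ℕ.+ p) * ((1ℤ + y ^ (3 ℕ.+ p)) * Â ps)
  Ĉ []       = 0ℤ
  Ĉ (p ∷ ps) = geo y (3 ℕ.+ p) * ((1ℤ + y ^ (3 ℕ.+ p)) * Ĉ ps + + 2 * y * (geo y (2 ℕ.+ p) * Â ps))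

  Ã-Â : ∀ ps → Ã y ps ≡ (1ℤ - y) ^ length ps * Â ps
  Ã-Â []       = refl
  Ã-Â (p ∷ ps) = trans (cong₂ _*_ (trans (factor Y) (cong (_* (1ℤ + Y)) (≡-sym (geo-sum y (3 ℕ.+ p))))) (Ã-Â ps))
                       (rearrange (1ℤ - y) (geo y (3 ℕ.+ p)) (1ℤ + Y) ((1ℤ - y) ^ length ps) (Â ps))
    where
    Y = y ^ (3 ℕ.+ p)
    factor : ∀ Y → 1ℤ - Y * Y ≡ (1ℤ - Y) * (1ℤ + Y)
    factor = solve-∀
    rearrange : ∀ z g u w a → z * g * u * (w * a) ≡ z * w * (g * (u * a))
    rearrange = solve-∀

  -- With l = 3 + p, the coefficient of a petal splits as 2(y² + yˡ) = 2y(1 + yˡ) - 2y(1 - y)(1 -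
  -- yˡ⁻¹). The first part lowers the central entry by 2y; the second is a multiple of (1 - y)² and
  -- feeds `Ĉ`.
  D̃-Ĉ : ∀ x ps → D̃ y x ps ≡ (1ℤ - y) ^ length ps * ((x - + 2 * + length ps * y) * Â ps + (1ℤ - y) * (1ℤ - y) * Ĉ ps)
  D̃-Ĉ x []       = base x y
    where
    base : ∀ x y → x ≡ 1ℤ * ((x - + 2 * 0ℤ * y) * 1ℤ + (1ℤ - y) * (1ℤ - y) * 0ℤ)
    base = solve-∀
  D̃-Ĉ x (p ∷ ps) = begin
    (1ℤ - Y * Y) * D̃ y x ps - + 2 * (y * y + Y) * (1ℤ - Y) * Ã y ps
      ≡⟨ cong₂ (λ d a → (1ℤ - Y * Y) * d - + 2 * (y * y + Y) * (1ℤ - Y) * a) (D̃-Ĉ x ps) (Ã-Â ps) ⟩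
    (1ℤ - Y * Y) * (W * (E * Â ps + z * z * Ĉ ps)) - + 2 * (y * y + Y) * (1ℤ - Y) * (W * Â ps)
      ≡⟨ factor Y W (E * Â ps + z * z * Ĉ ps) (y * y + Y) (Â ps) ⟩
    (1ℤ - Y) * (W * ((1ℤ + Y) * (E * Â ps + z * z * Ĉ ps) - + 2 * (y * y + Y) * Â ps))
      ≡⟨ cong (λ s → s * (W * ((1ℤ + Y) * (E * Â ps + z * z * Ĉ ps) - + 2 * (y * y + Y) * Â ps))) (geo-sum y (3 ℕ.+ p)) ⟨
    z * g * (W * ((1ℤ + Y) * (E * Â ps + z * z * Ĉ ps) - + 2 * (y * y + Y) * Â ps))
      ≡⟨ cong (λ s → z * g * (W * s)) (trans (expose y (y ^ (2 ℕ.+ p)) z E (Â ps) (Ĉ ps)) (cong (λ s → (1ℤ + Y) * ((E - + 2 * y) * Â ps + z * z * Ĉ ps) + + 2 * y * (z * s) * Â ps) (≡-sym (geo-sum y (2 ℕ.+ p))))) ⟩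
    z * g * (W * ((1ℤ + Y) * ((E - + 2 * y) * Â ps + z * z * Ĉ ps) + + 2 * y * (z * (z * g′)) * Â ps))
      ≡⟨ collect z g W (1ℤ + Y) E y g′ (Â ps) (Ĉ ps) ⟩
    z * W * ((E - + 2 * y) * (g * ((1ℤ + Y) * Â ps)) + z * z * (g * ((1ℤ + Y) * Ĉ ps + + 2 * y * (g′ * Â ps))))
      ≡⟨ cong (λ e → z * W * (e * (g * ((1ℤ + Y) * Â ps)) + z * z * (g * ((1ℤ + Y) * Ĉ ps + + 2 * y * (g′ * Â ps)))))
           (trans (shift x (+ k) y) (cong (λ n → x - + 2 * n * y) (≡-sym (ℤₚ.pos-+ 1 k)))) ⟩
    z * W * ((x - + 2 * + suc k * y) * (g * ((1ℤ + Y) * Â ps)) + z * z * (g * ((1ℤ + Y) * Ĉ ps + + 2 * y * (g′ * Â ps)))) ∎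
    where
    open ≡-Reasoning
    k = length ps
    Y = y ^ (3 ℕ.+ p)
    z = 1ℤ - y
    W = z ^ k
    E = x - + 2 * + k * y
    g = geo y (3 ℕ.+ p)
    g′ = geo y (2 ℕ.+ p)
    factor : ∀ Y W S u a → (1ℤ - Y * Y) * (W * S) - + 2 * u * (1ℤ - Y) * (W * a) ≡ (1ℤ - Y) * (W * ((1ℤ + Y) * S - + 2 * u * a))
    factor = solve-∀
    expose : ∀ y q z E a c → (1ℤ + y * q) * (E * a + z * z * c) - + 2 * (y * y + y * q) * a
                           ≡ (1ℤ + y * q) * ((E - + 2 * y) * a + z * z * c) + + 2 * y * ((1ℤ - y) * (1ℤ - q)) * a
    expose = solve-∀
    collect : ∀ z g W u E y g′ a c → z * g * (W * (u * ((E - + 2 * y) * a + z * z * c) + + 2 * y * (z * (z * g′)) * a))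
                                   ≡ z * W * ((E - + 2 * y) * (g * (u * a)) + z * z * (g * (u * c + + 2 * y * (g′ * a))))
    collect = solve-∀
    shift : ∀ x k y → x - + 2 * k * y - + 2 * y ≡ x - + 2 * (1ℤ + k) * y
    shift = solve-∀

module _ {N y y′ : ℤ} (y≈ : y ≈[ N ] y′) where

  ^-≈ : ∀ l → y ^ l ≈[ N ] y′ ^ l
  ^-≈ zero    = ≈-refl
  ^-≈ (suc l) = ≈-* y≈ (^-≈ l)

  geo-≈ : ∀ l → geo y l ≈[ N ] geo y′ l
  geo-≈ zero    = ≈-refl
  geo-≈ (suc l) = ≈-+ (≈-refl {a = 1ℤ}) (≈-* y≈ (geo-≈ l))

  Â-≈ : ∀ ps → Â y ps ≈[ N ] Â y′ ps
  Â-≈ []       = ≈-refl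
  Â-≈ (p ∷ ps) = ≈-* (geo-≈ (3 ℕ.+ p)) (≈-* (≈-+ (≈-refl {a = 1ℤ}) (^-≈ (3 ℕ.+ p))) (Â-≈ ps))

  Ĉ-≈ : ∀ ps → Ĉ y ps ≈[ N ] Ĉ y′ ps
  Ĉ-≈ []       = ≈-refl
  Ĉ-≈ (p ∷ ps) = ≈-* (geo-≈ (3 ℕ.+ p)) (≈-+ (≈-* (≈-+ (≈-refl {a = 1ℤ}) (^-≈ (3 ℕ.+ p))) (Ĉ-≈ ps))
                                            (≈-* (≈-* (≈-refl {a = + 2}) y≈) (≈-* (geo-≈ (2 ℕ.+ p)) (Â-≈ ps))))

geo-1 : ∀ l → geo 1ℤ l ≡ + l
geo-1 zero    = refl
geo-1 (suc l) = trans (cong (λ g → 1ℤ + 1ℤ * g) (geo-1 l)) (cong (_+_ 1ℤ) (ℤₚ.*-identityˡ (+ l)))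

1≤* : ∀ {x y} → 1ℤ ℤ.≤ x → 1ℤ ℤ.≤ y → 1ℤ ℤ.≤ x * y
1≤* {+ suc a} {+ suc b} _ _ = ℤ.+≤+ (s≤s z≤n)
1≤* {+ zero}  (ℤ.+≤+ ())
1≤* {+ suc a} {+ zero} _ (ℤ.+≤+ ())

0≤ : ∀ {x} → 1ℤ ℤ.≤ x → 0ℤ ℤ.≤ x
0≤ = ℤₚ.≤-trans (ℤ.+≤+ z≤n)

1≤geo-1 : ∀ l → 1ℤ ℤ.≤ geo 1ℤ (suc l)
1≤geo-1 l = ℤₚ.≤-trans (ℤ.+≤+ (s≤s z≤n)) (ℤₚ.≤-reflexive (≡-sym (geo-1 (suc l))))

1≤1+1^ : ∀ l → 1ℤ ℤ.≤ 1ℤ + 1ℤ ^ l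
1≤1+1^ l = ℤₚ.≤-trans (ℤ.+≤+ (s≤s z≤n)) (ℤₚ.≤-reflexive (cong (_+_ 1ℤ) (≡-sym (ℤₚ.^-zeroˡ l))))

1≤Â : ∀ ps → 1ℤ ℤ.≤ Â 1ℤ ps
1≤Â []       = ℤₚ.≤-refl
1≤Â (p ∷ ps) = 1≤* (1≤geo-1 (2 ℕ.+ p)) (1≤* (1≤1+1^ (3 ℕ.+ p)) (1≤Â ps))

0≤Ĉ : ∀ ps → 0ℤ ℤ.≤ Ĉ 1ℤ ps
0≤Ĉ []       = ℤₚ.≤-refl
0≤Ĉ (p ∷ ps) = 0≤* (0≤ (1≤geo-1 (2 ℕ.+ p))) (ℤₚ.+-mono-≤ (0≤* (0≤ (1≤1+1^ (3 ℕ.+ p))) (0≤Ĉ ps)) (0≤* {+ 2 * 1ℤ} (ℤ.+≤+ z≤n) (0≤* (0≤ (1≤geo-1 (1 ℕ.+ p))) (0≤ (1≤Â ps)))))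

^-distrib-* : ∀ a b k → (a * b) ^ k ≡ a ^ k * b ^ k
^-distrib-* a b zero    = refl
^-distrib-* a b (suc k) = trans (cong (a * b *_) (^-distrib-* a b k)) (rearrange a b (a ^ k) (b ^ k))
  where
  rearrange : ∀ a b x y → a * b * (x * y) ≡ a * x * (b * y)
  rearrange = solve-∀

^-cancel : ∀ z .{{_ : ℤ.NonZero z}} k {a b} → z ^ k * a ≡ z ^ k * b → a ≡ b
^-cancel z zero    {a} {b} e = trans (≡-sym (ℤₚ.*-identityˡ a)) (trans e (ℤₚ.*-identityˡ b))
^-cancel z (suc k) {a} {b} e = ^-cancel z k {a} {b} (*-cancelˡ z {z ^ k * a} {z ^ k * b}
  (trans (≡-sym (ℤₚ.*-assoc z (z ^ k) a)) (trans e (ℤₚ.*-assoc z (z ^ k) b))))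

-- At this central entry the determinant times (1 + y)ᵏ equals z²(Â + Ĉ). A further factor z² would
-- make Â + Ĉ vanish modulo z, and modulo z it equals its value `K` at y = 1. For y = v + 2 the
-- modulus z is - (v + 1), so `K` would be divisible by every positive integer, although it is at
-- least 1.
rose-simple-zero : ∀ ps → ¬ (∀ v → let z = 1ℤ - + suc (suc v) in
                   ∃ λ q → rose-det (suc (suc v)) (z * z + + 2 * + length ps * + suc (suc v)) ps ≡ z * z * (z * z) * q)
rose-simple-zero ps h = contradiction (≈-separated vanishing) (λ e → case ℤₚ.≤-trans K-positive (ℤₚ.≤-reflexive e) of λ { (ℤ.+≤+ ()) })
  where
  k = length ps
  K = Â 1ℤ ps + Ĉ 1ℤ ps
  K-positive : 1ℤ ℤ.≤ K
  K-positive = ℤₚ.+-mono-≤ (1≤Â ps) (0≤Ĉ ps)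
  reduce : ∀ y d q .{{_ : ℤ.NonZero (1ℤ - y)}} → let z = 1ℤ - y in
           (1ℤ - y * y) ^ k * d ≡ D̃ y (z * z + + 2 * + k * y) ps → d ≡ z * z * (z * z) * q → K ≈[ z ] 0ℤ
  reduce y d q det-eq divisible = ≈-trans (≈-sym (≈-+ (Â-≈ y≈1 ps) (Ĉ-≈ y≈1 ps))) (by (z * q * (1ℤ + y) ^ k) (trans value (rearrange z q ((1ℤ + y) ^ k))))
    where
    z = 1ℤ - y
    y≈1 : y ≈[ z ] 1ℤ
    y≈1 = by -1ℤ (identity y)
      where
      identity : ∀ y → y ≡ 1ℤ + -1ℤ * (1ℤ - y)
      identity = solve-∀
    rearrange : ∀ z q w → z * z * (w * q) ≡ 0ℤ + z * q * w * z
    rearrange = solve-∀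
    scaled : (1ℤ + y) ^ k * d ≡ z * z * (Â y ps + Ĉ y ps)
    scaled = ^-cancel z k {(1ℤ + y) ^ k * d} {z * z * (Â y ps + Ĉ y ps)} (begin
      z ^ k * ((1ℤ + y) ^ k * d)        ≡⟨ ℤₚ.*-assoc (z ^ k) ((1ℤ + y) ^ k) d ⟨
      z ^ k * (1ℤ + y) ^ k * d          ≡⟨ cong (_* d) (^-distrib-* z (1ℤ + y) k) ⟨
      (z * (1ℤ + y)) ^ k * d            ≡⟨ cong (λ u → u ^ k * d) (factor y) ⟩
      (1ℤ - y * y) ^ k * d              ≡⟨ det-eq ⟩
      D̃ y (z * z + + 2 * + k * y) ps    ≡⟨ D̃-Ĉ y (z * z + + 2 * + k * y) ps ⟩
      z ^ k * ((z * z + + 2 * + k * y - + 2 * + k * y) * Â y ps + z * z * Ĉ y ps) ≡⟨ cong (z ^ k *_) (collect z (+ 2 * + k * y) (Â y ps) (Ĉ y ps)) ⟩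
      z ^ k * (z * z * (Â y ps + Ĉ y ps)) ∎)
      where
      open ≡-Reasoning
      factor : ∀ y → (1ℤ - y) * (1ℤ + y) ≡ 1ℤ - y * y
      factor = solve-∀
      collect : ∀ z e a c → (z * z + e - e) * a + z * z * c ≡ z * z * (a + c)
      collect = solve-∀
    value : Â y ps + Ĉ y ps ≡ z * z * ((1ℤ + y) ^ k * q)
    value = *-cancelˡ z {Â y ps + Ĉ y ps} {z * z * ((1ℤ + y) ^ k * q)} (*-cancelˡ z {z * (Â y ps + Ĉ y ps)} {z * (z * z * ((1ℤ + y) ^ k * q))}
      (trans (assoc z (Â y ps + Ĉ y ps)) (trans (≡-sym scaled) (trans (cong ((1ℤ + y) ^ k *_) divisible) (regroup ((1ℤ + y) ^ k) z q)))))
      where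
      assoc : ∀ z a → z * (z * a) ≡ z * z * a
      assoc = solve-∀
      regroup : ∀ w z q → w * (z * z * (z * z) * q) ≡ z * (z * (z * z * (w * q)))
      regroup = solve-∀
  vanishing : ∀ v → K ≈[ + suc v ] 0ℤ
  vanishing v = negate (reduce (+ suc (suc v)) _ (proj₁ (h v)) (rose-det-D̃ (suc (suc v)) _ ps) (proj₂ (h v)))
    where
    negate : K ≈[ - (+ suc v) ] 0ℤ → K ≈[ + suc v ] 0ℤ
    negate (by q e) = by (- q) (trans e (identity q (+ suc v)))
      where
      identity : ∀ q N → 0ℤ + q * - N ≡ 0ℤ + - q * N
      identity = solve-∀

module _ (G : Graph) (s u : ℤ) where
  private
    M : Mat (n G) (n G)
    M i j = s * δ i j - u * ℒ G i j

  ℒ-column : ∀ j → ∑ (λ i → ℒ G i j) ≡ 0ℤ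
  ℒ-column j = begin
    ∑ (λ i → 𝒟 G i * δ i j - 𝒜 G i j)                    ≡⟨ ∑-cong (λ i → trans (cong₂ (λ d a → 𝒟 G i * d - a) (δ-sym i j) (𝒜-sym G i j)) (split (𝒟 G i) (δ j i) (𝒜 G j i))) ⟩
    ∑ (λ i → 𝒟 G i * δ j i + -1ℤ * 𝒜 G j i)              ≡⟨ ∑-+ (λ i → 𝒟 G i * δ j i) (λ i → -1ℤ * 𝒜 G j i) ⟩
    ∑ (λ i → 𝒟 G i * δ j i) + ∑ (λ i → -1ℤ * 𝒜 G j i)    ≡⟨ cong₂ _+_ (∑-δ j (𝒟 G)) (trans (∑-* -1ℤ (𝒜 G j)) (cong (-1ℤ *_) (≡-sym (𝒟-∑ G j)))) ⟩
    𝒟 G j + -1ℤ * 𝒟 G j                                  ≡⟨ cancel (𝒟 G j) ⟩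
    0ℤ                                                   ∎
    where
    open ≡-Reasoning
    split : ∀ d e a → d * e - a ≡ d * e + -1ℤ * a
    split = solve-∀
    cancel : ∀ d → d + -1ℤ * d ≡ 0ℤ
    cancel = solve-∀

  -- A function constant on components is a left null vector of the Laplacian, so only the part
  -- `s * δ` contributes.
  component-rows : ∀ (χ : Fin (n G) → ℤ) → (∀ {i j} → adj G i j ≡ true → χ i ≡ χ j) → ∀ j → ∑ (λ i → χ i * M i j) ≡ s * χ j
  component-rows χ constant j = begin
    ∑ (λ i → χ i * M i j)                                        ≡⟨ ∑-cong (λ i → trans (expand (χ i) s (δ i j) u (ℒ G i j)) (cong₂ (λ d l → s * (χ i * d) + - u * l) (δ-sym i j) (same i))) ⟩
    ∑ (λ i → s * (χ i * δ j i) + - u * (χ j * ℒ G i j))          ≡⟨ ∑-+ (λ i → s * (χ i * δ j i)) (λ i → - u * (χ j * ℒ G i j)) ⟩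
    ∑ (λ i → s * (χ i * δ j i)) + ∑ (λ i → - u * (χ j * ℒ G i j)) ≡⟨ cong₂ _+_ (trans (∑-* s (λ i → χ i * δ j i)) (cong (s *_) (∑-δ j χ)))
                                                                     (trans (∑-* (- u) (λ i → χ j * ℒ G i j)) (cong (- u *_) (trans (∑-* (χ j) (λ i → ℒ G i j)) (cong (χ j *_) (ℒ-column j))))) ⟩
    s * χ j + - u * (χ j * 0ℤ)                                   ≡⟨ drop (s * χ j) u (χ j) ⟩
    s * χ j                                                      ∎
    where
    open ≡-Reasoning
    expand : ∀ c s d u l → c * (s * d - u * l) ≡ s * (c * d) + - u * (c * l)
    expand = solve-∀
    drop : ∀ a u c → a + - u * (c * 0ℤ) ≡ a
    drop = solve-∀
    same : ∀ i → χ i * ℒ G i j ≡ χ j * ℒ G i j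
    same i with i Fin.≟ j
    ... | yes refl = refl
    ... | no i≢j with adj G i j in e
    ...   | true  = cong (_* (𝒟 G i * δ i j - 1ℤ)) (constant e)
    ...   | false = trans (cong (χ i *_) vanish) (trans (ℤₚ.*-zeroʳ (χ i)) (≡-sym (trans (cong (χ j *_) vanish) (ℤₚ.*-zeroʳ (χ j)))))
      where
      vanish : 𝒟 G i * δ i j - 0ℤ ≡ 0ℤ
      vanish = trans (cong (λ d → 𝒟 G i * d - 0ℤ) (δ-≢ i≢j)) (trans (ℤₚ.+-identityʳ (𝒟 G i * 0ℤ)) (ℤₚ.*-zeroʳ (𝒟 G i)))

  -- Summing the rows over a union of components, and over its complement, exposes two factors s.
  disconnected-divides : ∀ (χ : Fin (n G) → ℤ) → (∀ {i j} → adj G i j ≡ true → χ i ≡ χ j) →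
                         ∀ v w → χ v ≡ 1ℤ → χ w ≡ 0ℤ → ∃ λ q → P G s u ≡ s * s * q
  disconnected-divides χ constant v w χv χw = det N (M₁ [ w ]≔ χ̄) , (begin
    det N M                                            ≡⟨ ℤₚ.*-identityˡ (det N M) ⟨
    1ℤ * det N M                                       ≡⟨ cong (_* det N M) χv ⟨
    χ v * det N M                                      ≡⟨ replace-row F M v χ ⟨
    det N (M [ v ]≔ (λ j → ∑ (λ i → χ i * M i j)))     ≡⟨ det-cong (≔-cong M v (component-rows χ constant)) ⟩
    det N (M [ v ]≔ (λ j → s * χ j))                   ≡⟨ scale F M v s χ ⟩
    s * det N M₁                                       ≡⟨ cong (s *_) (begin
      det N M₁                                           ≡⟨ ℤₚ.*-identityˡ (det N M₁) ⟨
      1ℤ * det N M₁                                      ≡⟨ cong (λ x → (1ℤ - x) * det N M₁) χw ⟨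
      χ̄ w * det N M₁                                     ≡⟨ replace-row F M₁ w χ̄ ⟨
      det N (M₁ [ w ]≔ (λ j → ∑ (λ i → χ̄ i * M₁ i j)))   ≡⟨ det-cong (≔-cong M₁ w (λ j → trans (∑-cong (λ i → old i j)) (component-rows χ̄ (λ e → cong (_-_ 1ℤ) (constant e)) j))) ⟩
      det N (M₁ [ w ]≔ (λ j → s * χ̄ j))                  ≡⟨ scale F M₁ w s χ̄ ⟩
      s * det N (M₁ [ w ]≔ χ̄)                            ∎) ⟩
    s * (s * det N (M₁ [ w ]≔ χ̄))                      ≡⟨ ℤₚ.*-assoc s s _ ⟨
    s * s * det N (M₁ [ w ]≔ χ̄)                        ∎)
    where
    open ≡-Reasoning
    N = n G
    F = det-alternating N
    χ̄ : Fin (n G) → ℤ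
    χ̄ i = 1ℤ - χ i
    M₁ = M [ v ]≔ χ
    -- Row `v` has been overwritten by `χ`, but `χ̄ v` is 0, so the second combination does not see
    -- it.
    old : ∀ i j → χ̄ i * M₁ i j ≡ χ̄ i * M i j
    old i j with i Fin.≟ v
    ... | yes refl = trans (cong (_* M₁ i j) zeroes) (≡-sym (cong (_* M i j) zeroes))
      where
      zeroes : χ̄ i ≡ 0ℤ
      zeroes = cong (_-_ 1ℤ) χv
    ... | no i≢v   = cong (λ row → χ̄ i * row j) (≔-other M χ i≢v)

-- Decomposition into petals

module Petals (G : Graph) (c : Fin (n G)) (two : ∀ v → v ≢ c → deg G v ≡ 2) where

  flip : ∀ {x y} → adj G x y ≡ true → adj G y x ≡ true
  flip {x} {y} e = trans (sym G y x) e

  -- A closed walk c = path 0, path 1, …, path (3 + p) = c whose 2 + p interior vertices are distinct.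
  record Petal : Set where
    field
      p           : ℕ
      path        : ℕ → Fin (n G)
      start       : path 0 ≡ c
      end         : path (3 ℕ.+ p) ≡ c
      interior    : ∀ i → i ℕ.< 2 ℕ.+ p → path (suc i) ≢ c
      distinct    : ∀ i j → i ℕ.< 2 ℕ.+ p → j ℕ.< 2 ℕ.+ p → path (suc i) ≡ path (suc j) → i ≡ j
      consecutive : ∀ i → i ℕ.≤ 2 ℕ.+ p → adj G (path i) (path (suc i)) ≡ true
      neighbours  : ∀ i → i ℕ.< 2 ℕ.+ p → ∀ {x} → adj G (path (suc i)) x ≡ true → x ≡ path i ⊎ x ≡ path (suc (suc i))

    vertex : Fin (2 ℕ.+ p) → Fin (n G)
    vertex j = path (suc (toℕ j))

  open Petal public

  infix 4 _∈ₚ_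
  _∈ₚ_ : Fin (n G) → Petal → Set
  v ∈ₚ P = ∃ λ j → vertex P j ≡ v

  _∈ₚ?_ : ∀ v P → Dec (v ∈ₚ P)
  v ∈ₚ? P = Finₚ.any? (λ j → vertex P j Fin.≟ v)

  path-∈ₚ : ∀ P i → i ℕ.< 2 ℕ.+ p P → path P (suc i) ∈ₚ P
  path-∈ₚ P i i<m = Fin.fromℕ< i<m , cong (λ k → path P (suc k)) (Finₚ.toℕ-fromℕ< i<m)

  ∈ₚ-≢c : ∀ P {v} → v ∈ₚ P → v ≢ c
  ∈ₚ-≢c P (j , refl) = interior P (toℕ j) (Finₚ.toℕ<n j)

  petal-closed : ∀ P {v x} → v ∈ₚ P → adj G v x ≡ true → x ≡ c ⊎ x ∈ₚ P
  petal-closed P (j , refl) e with neighbours P (toℕ j) (Finₚ.toℕ<n j) e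
  ... | inj₁ x≡ = previous (toℕ j) (Finₚ.toℕ<n j) x≡
    where
    previous : ∀ i → i ℕ.< 2 ℕ.+ p P → ∀ {x} → x ≡ path P i → x ≡ c ⊎ x ∈ₚ P
    previous zero    i<m refl = inj₁ (start P)
    previous (suc i) i<m refl = inj₂ (path-∈ₚ P i (ℕₚ.<-trans (ℕₚ.n<1+n i) i<m))
  ... | inj₂ refl with suc (toℕ j) ℕ.<? 2 ℕ.+ p P
  ...   | yes lt = inj₂ (path-∈ₚ P (suc (toℕ j)) lt)
  ...   | no ≮   = inj₁ (trans (cong (λ k → path P (suc k)) (ℕₚ.≤-antisym (Finₚ.toℕ<n j) (ℕₚ.≮⇒≥ ≮))) (end P))

  -- Total, so that the walk is defined at all times. By `next-spec` the default `cur` does not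
  -- occur while the walk is away from `c`.
  next : Fin (n G) → Fin (n G) → Fin (n G)
  next prev cur with Finₚ.any? (λ w → (¬? (w Fin.≟ prev)) ×-dec (adj G cur w Boolₚ.≟ true))
  ... | yes (w , _) = w
  ... | no _        = cur

  next-spec : ∀ {prev cur} → cur ≢ c → adj G cur prev ≡ true → next prev cur ≢ prev × adj G cur (next prev cur) ≡ true
  next-spec {prev} {cur} cur≢c e with Finₚ.any? (λ w → (¬? (w Fin.≟ prev)) ×-dec (adj G cur w Boolₚ.≟ true))
  ... | yes (w , found) = found
  ... | no none         = contradiction (neighbour-other G (two cur cur≢c) e) none

  module Walk (v₁ : Fin (n G)) (c-v₁ : adj G c v₁ ≡ true) where

    walk : ℕ → Fin (n G)
    walk zero          = c
    walk (suc zero)    = v₁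
    walk (suc (suc i)) = next (walk i) (walk (suc i))

    Away : ℕ → Set
    Away j = ∀ i → i ℕ.< j → walk (suc i) ≢ c

    walk-adj : ∀ j → Away j → adj G (walk j) (walk (suc j)) ≡ true
    walk-adj zero    away = c-v₁
    walk-adj (suc j) away = proj₂ (next-spec (away j (ℕₚ.n<1+n j)) (flip (walk-adj j (λ i i<j → away i (ℕₚ.m<n⇒m<1+n i<j)))))

    walk-turn : ∀ j → Away (suc j) → walk (suc (suc j)) ≢ walk j
    walk-turn j away = proj₁ (next-spec (away j (ℕₚ.n<1+n j)) (flip (walk-adj j (λ i i<j → away i (ℕₚ.m<n⇒m<1+n i<j)))))

    walk-neighbours : ∀ j → Away (suc j) → ∀ {x} → adj G (walk (suc j)) x ≡ true → x ≡ walk j ⊎ x ≡ walk (suc (suc j))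
    walk-neighbours j away = neighbour-cases G (two _ (away j (ℕₚ.n<1+n j))) (walk-turn j away ∘ ≡-sym)
      (flip (walk-adj j (λ i i<j → away i (ℕₚ.m<n⇒m<1+n i<j)))) (walk-adj (suc j) away)

    restrict : ∀ {i j} → i ℕ.≤ j → Away j → Away i
    restrict i≤j away k k<i = away k (ℕₚ.<-≤-trans k<i i≤j)

    -- If the last vertex repeats an earlier one, its predecessor on the walk is a neighbour of that
    -- earlier vertex, hence the vertex just before or just after it. This is an earlier repetition,
    -- a return to `c`, a turn back or a loop.
    walk-fresh : ∀ j → Away (suc j) → ∀ i → i ℕ.< j → walk (suc i) ≢ walk (suc j)
    walk-fresh (suc j) away i (s≤s i≤j) same
      with walk-neighbours i (restrict (s≤s (ℕₚ.m≤n⇒m≤1+n i≤j)) away)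
             (subst (λ x → adj G x (walk (suc j)) ≡ true) (≡-sym same) (flip (walk-adj (suc j) (restrict (ℕₚ.n≤1+n _) away))))
    walk-fresh (suc j) away zero    (s≤s i≤j) same | inj₁ e = away j (s≤s (ℕₚ.n≤1+n j)) e
    walk-fresh (suc j) away (suc i) (s≤s i<j) same | inj₁ e = walk-fresh j (restrict (ℕₚ.n≤1+n _) away) i i<j (≡-sym e)
    walk-fresh (suc j) away i       (s≤s i≤j) same | inj₂ e with ℕₚ.<-cmp (suc i) j
    ... | tri< lt _ _ = walk-fresh j (restrict (ℕₚ.n≤1+n _) away) (suc i) lt (≡-sym e)
    ... | tri≈ _ refl _ = walk-turn (suc i) (restrict (ℕₚ.n≤1+n _) away) (≡-sym same)
    ... | tri> _ _ j<si with ℕₚ.≤-antisym i≤j (ℕₚ.≤-pred j<si)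
    ...   | refl = adj⇒≢ G (walk-adj (suc j) (restrict (ℕₚ.n≤1+n _) away)) same

    walk-distinct : ∀ m → Away m → ∀ i j → i ℕ.< m → j ℕ.< m → walk (suc i) ≡ walk (suc j) → i ≡ j
    walk-distinct m away i j i<m j<m e with ℕₚ.<-cmp i j
    ... | tri< i<j _ _ = contradiction e (walk-fresh j (restrict j<m away) i i<j)
    ... | tri≈ _ i≡j _ = i≡j
    ... | tri> _ _ j<i = contradiction (≡-sym e) (walk-fresh i (restrict i<m away) j j<i)

    returns : ∀ b → Away b ⊎ ∃ λ m → Away m × walk (suc m) ≡ c
    returns zero = inj₁ (λ i ())
    returns (suc b) with returns b
    ... | inj₂ found = inj₂ found
    ... | inj₁ away with walk (suc b) Fin.≟ c
    ...   | yes e = inj₂ (b , away , e)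
    ...   | no ≢c = inj₁ extend
      where
      extend : Away (suc b)
      extend i (s≤s i≤b) with ℕₚ.m≤n⇒m<n∨m≡n i≤b
      ... | inj₁ i<b  = away i i<b
      ... | inj₂ refl = ≢c

    -- Pigeonhole: `suc (n G)` steps away from `c` would visit as many distinct vertices.
    first-return : ∃ λ m → Away m × walk (suc m) ≡ c
    first-return with returns (suc (n G))
    ... | inj₂ found = found
    ... | inj₁ away  = contradiction (Finₚ.injective⇒≤ {f = λ (i : Fin (suc (n G))) → walk (suc (toℕ i))} (λ {i} {j} e →
            Finₚ.toℕ-injective (walk-distinct (suc (n G)) away (toℕ i) (toℕ j) (Finₚ.toℕ<n i) (Finₚ.toℕ<n j) e))) ℕₚ.1+n≰n

    -- A return at step 1 would be a loop and one at step 2 a turn back, so the cycle has length at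
    -- least 3.
    petal-through : Σ Petal λ P → path P 1 ≡ v₁
    petal-through with first-return
    ... | zero , away , e = contradiction (≡-sym e) (adj⇒≢ G c-v₁)
    ... | suc zero , away , e = contradiction e (walk-turn 0 away)
    ... | suc (suc q) , away , e = record
      { p = q ; path = walk ; start = refl ; end = e ; interior = away ; distinct = walk-distinct (2 ℕ.+ q) away
      ; consecutive = λ i i≤m → walk-adj i (restrict i≤m away)
      ; neighbours = λ i i<m → walk-neighbours i (restrict i<m away) } , refl

  Disjoint : Petal → Petal → Set
  Disjoint P Q = ∀ v → v ∈ₚ P → v ∈ₚ Q → ⊥

  -- Traced backwards from a common vertex, `P` stays inside `Q`, because `Q` can be left only
  -- through the centre. Thus the first vertex of `P` would lie in `Q`.
  disjoint-start : ∀ P Q → ¬ path P 1 ∈ₚ Q → Disjoint P Q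
  disjoint-start P Q v₁∉Q v (j , refl) = go (toℕ j) (Finₚ.toℕ<n j)
    where
    go : ∀ i → i ℕ.< 2 ℕ.+ p P → ¬ path P (suc i) ∈ₚ Q
    go zero    i<m ∈Q = v₁∉Q ∈Q
    go (suc i) i<m ∈Q with petal-closed Q ∈Q (flip (consecutive P (suc i) (ℕₚ.<⇒≤ i<m)))
    ... | inj₁ ≡c  = interior P i (ℕₚ.<-trans (ℕₚ.n<1+n i) i<m) ≡c
    ... | inj₂ ∈Q′ = go i (ℕₚ.<-trans (ℕₚ.n<1+n i) i<m) ∈Q′

  -- Disjointness makes the numbering by petals injective; the order by length makes the list of
  -- lengths canonical, as comparing two roses requires.
  Before : Petal → Petal → Set
  Before P Q = p P ≤ p Q × Disjoint P Q

  insert : Petal → List Petal → List Petal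
  insert P []      = P ∷ []
  insert P (Q ∷ L) with p P ℕ.≤? p Q
  ... | yes _ = P ∷ Q ∷ L
  ... | no _  = Q ∷ insert P L

  insert-All : ∀ {R : Petal → Set} P L → R P → All R L → All R (insert P L)
  insert-All P []      r []       = r ∷ []
  insert-All P (Q ∷ L) r (q ∷ rs) with p P ℕ.≤? p Q
  ... | yes _ = r ∷ q ∷ rs
  ... | no _  = q ∷ insert-All P L r rs

  insert-new : ∀ {R : Petal → Set} P L → R P → Any R (insert P L)
  insert-new P []      r = here r
  insert-new P (Q ∷ L) r with p P ℕ.≤? p Q
  ... | yes _ = here r
  ... | no _  = there (insert-new P L r)

  insert-old : ∀ {R : Petal → Set} P L → Any R L → Any R (insert P L)
  insert-old P (Q ∷ L) a with p P ℕ.≤? p Q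
  insert-old P (Q ∷ L) a         | yes _ = there a
  insert-old P (Q ∷ L) (here r)  | no _  = here r
  insert-old P (Q ∷ L) (there a) | no _  = there (insert-old P L a)

  insert-sorted : ∀ P L → All (Disjoint P) L → AllPairs Before L → AllPairs Before (insert P L)
  insert-sorted P []      []       []       = [] ∷ []
  insert-sorted P (Q ∷ L) (d ∷ ds) (b ∷ bs) with p P ℕ.≤? p Q
  ... | yes P≤Q = ((P≤Q , d) ∷ All.zipWith (λ { ((Q≤R , _) , dis) → ℕₚ.≤-trans P≤Q Q≤R , dis }) (b , ds)) ∷ b ∷ bs
  ... | no P≰Q  = insert-All P L (ℕₚ.≰⇒≥ P≰Q , λ v ∈Q ∈P → d v ∈P ∈Q) b ∷ insert-sorted P L ds bs

  Covered : List Petal → Fin (n G) → Set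
  Covered L v = Any (v ∈ₚ_) L

  covered? : ∀ L v → Dec (Covered L v)
  covered? L v = Any.any? (v ∈ₚ?_) L

  -- A neighbour of `c` already covered needs no new petal, for instance as the other end of an
  -- earlier one. From an uncovered neighbour the walk gives a petal disjoint from all earlier ones.
  petals-through : ∀ (vs : List (Fin (n G))) → Σ (List Petal) λ L → AllPairs Before L × All (λ v → adj G c v ≡ true → Covered L v) vs
  petals-through [] = [] , [] , []
  petals-through (v ∷ vs) with petals-through vs
  ... | L , pairs , covers with adj G c v Boolₚ.≟ true | covered? L v
  ...   | no ≢true | _       = L , pairs , (λ e → contradiction e ≢true) ∷ covers
  ...   | yes e    | yes cov = L , pairs , (λ _ → cov) ∷ covers
  ...   | yes e    | no ¬cov with Walk.petal-through v e
  ...     | P , refl = insert P L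
                     , insert-sorted P L (All.map (λ {Q} ∉Q → disjoint-start P Q ∉Q) (¬Any⇒All¬ L ¬cov)) pairs
                     , (λ _ → insert-new P L (path-∈ₚ P 0 (s≤s z≤n))) ∷ All.map (λ f e → insert-old P L (f e)) covers

  all-petals : Σ (List Petal) λ L → AllPairs Before L × (∀ {v} → adj G c v ≡ true → Covered L v)
  all-petals with petals-through (allFin (n G))
  ... | L , pairs , covers = L , pairs , λ {v} → All.lookup covers (∈-allFin v)

-- Numbering a graph by its petals

bool-iff : ∀ {a b} → (a ≡ true → b ≡ true) → (b ≡ true → a ≡ true) → a ≡ b
bool-iff {true}  {true}  f g = refl
bool-iff {true}  {false} f g = ≡-sym (f refl)
bool-iff {false} {true}  f g = g refl
bool-iff {false} {false} f g = refl

isFirst⇒ : ∀ {m} {j : Fin m} → isFirst j ≡ true → toℕ j ≡ 0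
isFirst⇒ {j = zero} e = refl

isFirst⇐ : ∀ {m} {j : Fin m} → toℕ j ≡ 0 → isFirst j ≡ true
isFirst⇐ {j = zero} e = refl

isLast⇒ : ∀ {m} {j : Fin m} → isLast j ≡ true → suc (toℕ j) ≡ m
isLast⇒ {suc zero} {zero}  e = refl
isLast⇒ {suc m}    {suc j} e = cong suc (isLast⇒ e)

isLast⇐ : ∀ {m} {j : Fin m} → suc (toℕ j) ≡ m → isLast j ≡ true
isLast⇐ {suc zero} {zero}  e = refl
isLast⇐ {suc m}    {suc j} e = isLast⇐ {m} {j} (ℕₚ.suc-injective e)

pathAdj⇒ : ∀ {m} {i j : Fin m} → pathAdj i j ≡ true → suc (toℕ i) ≡ toℕ j ⊎ suc (toℕ j) ≡ toℕ i
pathAdj⇒ {i = zero}  {suc j} e = inj₁ (cong suc (≡-sym (isFirst⇒ e)))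
pathAdj⇒ {i = suc i} {zero}  e = inj₂ (cong suc (≡-sym (isFirst⇒ e)))
pathAdj⇒ {i = suc i} {suc j} e with pathAdj⇒ {i = i} {j} e
... | inj₁ p = inj₁ (cong suc p)
... | inj₂ p = inj₂ (cong suc p)

pathAdj⇐ˡ : ∀ {m} {i j : Fin m} → suc (toℕ i) ≡ toℕ j → pathAdj i j ≡ true
pathAdj⇐ˡ {i = zero}  {suc j} e = isFirst⇐ (≡-sym (ℕₚ.suc-injective e))
pathAdj⇐ˡ {i = suc i} {suc j} e = pathAdj⇐ˡ {i = i} {j} (ℕₚ.suc-injective e)

pathAdj⇐ʳ : ∀ {m} {i j : Fin m} → suc (toℕ j) ≡ toℕ i → pathAdj i j ≡ true
pathAdj⇐ʳ {i = suc i} {zero}  e = isFirst⇐ (≡-sym (ℕₚ.suc-injective e))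
pathAdj⇐ʳ {i = suc i} {suc j} e = pathAdj⇐ʳ {i = i} {j} (ℕₚ.suc-injective e)

split-view : ∀ r m (i : Fin (r ℕ.+ m)) → (∃ λ i′ → i′ ↑ˡ m ≡ i) ⊎ (∃ λ j → r ↑ʳ j ≡ i)
split-view r m i with Fin.splitAt r i in e
... | inj₁ i′ = inj₁ (i′ , Finₚ.splitAt⁻¹-↑ˡ e)
... | inj₂ j  = inj₂ (j , Finₚ.splitAt⁻¹-↑ʳ e)

-- An isomorphism from the standard rose, with vertex 0 sent to `c`. Two graphs with forms over the
-- same list are isomorphic through it.
record RoseForm (G : Graph) (c : Fin (n G)) (ps : List ℕ) : Set where
  field
    to        : Fin (suc (size (petalSizes ps))) → Fin (n G)
    from      : Fin (n G) → Fin (suc (size (petalSizes ps)))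
    to-from   : ∀ v → to (from v) ≡ v
    injective : ∀ {i j} → to i ≡ to j → i ≡ j
    centre    : to zero ≡ c
    to-adj    : ∀ i j → adj G (to i) (to j) ≡ roseAdj (petalSizes ps) i j

  from-to : ∀ i → from (to i) ≡ i
  from-to i = injective (to-from (to i))

module _ (G : Graph) (c : Fin (n G)) (two : ∀ v → v ≢ c → deg G v ≡ 2) where
  open Petals G c two

  vertex-adj : ∀ P i j → adj G (vertex P i) (vertex P j) ≡ pathAdj i j
  vertex-adj P i j = bool-iff forwards backwards
    where
    forwards : adj G (vertex P i) (vertex P j) ≡ true → pathAdj i j ≡ true
    forwards e with neighbours P (toℕ i) (Finₚ.toℕ<n i) e
    ... | inj₁ back = previous (toℕ i) refl back
      where
      previous : ∀ k → toℕ i ≡ k → vertex P j ≡ path P k → pathAdj i j ≡ true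
      previous zero    i≡ e = contradiction (trans e (start P)) (interior P (toℕ j) (Finₚ.toℕ<n j))
      previous (suc k) i≡ e = pathAdj⇐ʳ {i = i} {j} (trans (cong suc (distinct P (toℕ j) k (Finₚ.toℕ<n j)
        (ℕₚ.<-trans (ℕₚ.n<1+n k) (subst (ℕ._< 2 ℕ.+ p P) i≡ (Finₚ.toℕ<n i))) e)) (≡-sym i≡))
    ... | inj₂ forth with suc (toℕ i) ℕ.<? 2 ℕ.+ p P
    ...   | yes lt = pathAdj⇐ˡ {i = i} {j} (distinct P (suc (toℕ i)) (toℕ j) lt (Finₚ.toℕ<n j) (≡-sym forth))
    ...   | no ≮   = contradiction (trans forth (trans (cong (λ k → path P (suc k)) (ℕₚ.≤-antisym (Finₚ.toℕ<n i) (ℕₚ.≮⇒≥ ≮))) (end P)))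
                                   (interior P (toℕ j) (Finₚ.toℕ<n j))
    backwards : pathAdj i j ≡ true → adj G (vertex P i) (vertex P j) ≡ true
    backwards e with pathAdj⇒ {i = i} {j} e
    ... | inj₁ q = subst (λ k → adj G (vertex P i) (path P (suc k)) ≡ true) q (consecutive P (suc (toℕ i)) (Finₚ.toℕ<n i))
    ... | inj₂ q = flip (subst (λ k → adj G (vertex P j) (path P (suc k)) ≡ true) q (consecutive P (suc (toℕ j)) (Finₚ.toℕ<n j)))

  centre-adj : ∀ P j → adj G c (vertex P j) ≡ isEnd j
  centre-adj P j = bool-iff forwards backwards
    where
    ∨-introʳ : ∀ a {b} → b ≡ true → a ∨ b ≡ true
    ∨-introʳ true  e = refl
    ∨-introʳ false e = e
    forwards : adj G c (vertex P j) ≡ true → isEnd j ≡ true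
    forwards e with neighbours P (toℕ j) (Finₚ.toℕ<n j) (flip e)
    ... | inj₁ back = cong (_∨ isLast j) (isFirst⇐ (previous (toℕ j) (Finₚ.toℕ<n j) back))
      where
      previous : ∀ k → k ℕ.< 2 ℕ.+ p P → c ≡ path P k → k ≡ 0
      previous zero    lt e = refl
      previous (suc k) lt e = contradiction (≡-sym e) (interior P k (ℕₚ.<-trans (ℕₚ.n<1+n k) lt))
    ... | inj₂ forth with suc (toℕ j) ℕ.<? 2 ℕ.+ p P
    ...   | yes lt = contradiction (≡-sym forth) (interior P (suc (toℕ j)) lt)
    ...   | no ≮   = ∨-introʳ (isFirst j) (isLast⇐ (ℕₚ.≤-antisym (Finₚ.toℕ<n j) (ℕₚ.≮⇒≥ ≮)))
    backwards : isEnd j ≡ true → adj G c (vertex P j) ≡ true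
    backwards e with isFirst j in first
    ... | true  = subst (λ k → adj G c (path P (suc k)) ≡ true) (≡-sym (isFirst⇒ first))
                    (subst (λ x → adj G x (path P 1) ≡ true) (start P) (consecutive P 0 z≤n))
    ... | false = flip (subst (λ x → adj G (vertex P j) x ≡ true) (trans (cong (λ k → path P (suc k)) (isLast⇒ e)) (end P))
                    (consecutive P (suc (toℕ j)) (Finₚ.toℕ<n j)))

  sizes : List Petal → List ℕ
  sizes L = petalSizes (map p L)

  enum : ∀ L → Fin (suc (size (sizes L))) → Fin (n G)
  place : ∀ P L → Fin (suc (size (sizes L))) ⊎ Fin (2 ℕ.+ p P) → Fin (n G)
  enum []      i = c
  enum (P ∷ L) i = place P L (Fin.splitAt (suc (size (sizes L))) i)
  place P L (inj₁ i) = enum L i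
  place P L (inj₂ j) = vertex P j

  enum-zero : ∀ L → enum L zero ≡ c
  enum-zero []      = refl
  enum-zero (P ∷ L) = enum-zero L

  enum-ˡ : ∀ P L (i : Fin (suc (size (sizes L)))) → enum (P ∷ L) (i ↑ˡ (2 ℕ.+ p P)) ≡ enum L i
  enum-ˡ P L i = cong (place P L) (Finₚ.splitAt-↑ˡ (suc (size (sizes L))) i (2 ℕ.+ p P))

  enum-ʳ : ∀ P L (j : Fin (2 ℕ.+ p P)) → enum (P ∷ L) (suc (size (sizes L)) ↑ʳ j) ≡ vertex P j
  enum-ʳ P L j = cong (place P L) (Finₚ.splitAt-↑ʳ (suc (size (sizes L))) (2 ℕ.+ p P) j)

  enum-covered : ∀ L i → i ≢ zero → Covered L (enum L i)
  enum-covered []      zero i≢0 = contradiction refl i≢0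
  enum-covered (P ∷ L) i    i≢0 with split-view (suc (size (sizes L))) (2 ℕ.+ p P) i
  ... | inj₁ (i′ , refl) = there (subst (Covered L) (≡-sym (enum-ˡ P L i′)) (enum-covered L i′ (λ { refl → i≢0 refl })))
  ... | inj₂ (j , refl)  = here (j , ≡-sym (enum-ʳ P L j))

  covered-≢c : ∀ {L v} → Covered L v → v ≢ c
  covered-≢c (here {P} ∈P) = ∈ₚ-≢c P ∈P
  covered-≢c (there cov)   = covered-≢c cov

  covered-disjoint : ∀ P {L v} → All (Before P) L → v ∈ₚ P → ¬ Covered L v
  covered-disjoint P ((_ , d) ∷ _) ∈P (here ∈Q)   = d _ ∈P ∈Q
  covered-disjoint P (_ ∷ bs)      ∈P (there cov) = covered-disjoint P bs ∈P cov

  enum-not-vertex : ∀ P {L} → All (Before P) L → ∀ i j → enum L i ≢ vertex P j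
  enum-not-vertex P {L} bs zero    j e = interior P (toℕ j) (Finₚ.toℕ<n j) (trans (≡-sym e) (enum-zero L))
  enum-not-vertex P {L} bs (suc i) j e = covered-disjoint P bs (j , ≡-sym e) (enum-covered L (suc i) λ ())

  enum-injective : ∀ {L} → AllPairs Before L → ∀ i j → enum L i ≡ enum L j → i ≡ j
  enum-injective {[]}    []       zero zero e = refl
  enum-injective {P ∷ L} (b ∷ bs) i    j    e with split-view (suc (size (sizes L))) (2 ℕ.+ p P) i | split-view (suc (size (sizes L))) (2 ℕ.+ p P) j
  ... | inj₁ (i′ , refl) | inj₁ (j′ , refl) = cong (_↑ˡ (2 ℕ.+ p P)) (enum-injective bs i′ j′ (trans (≡-sym (enum-ˡ P L i′)) (trans e (enum-ˡ P L j′))))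
  ... | inj₁ (i′ , refl) | inj₂ (j′ , refl) = contradiction (trans (≡-sym (enum-ˡ P L i′)) (trans e (enum-ʳ P L j′))) (enum-not-vertex P b i′ j′)
  ... | inj₂ (i′ , refl) | inj₁ (j′ , refl) = contradiction (trans (≡-sym (enum-ˡ P L j′)) (trans (≡-sym e) (enum-ʳ P L i′))) (enum-not-vertex P b j′ i′)
  ... | inj₂ (i′ , refl) | inj₂ (j′ , refl) = cong (suc (size (sizes L)) ↑ʳ_) (Finₚ.toℕ-injective
      (distinct P (toℕ i′) (toℕ j′) (Finₚ.toℕ<n i′) (Finₚ.toℕ<n j′) (trans (≡-sym (enum-ʳ P L i′)) (trans e (enum-ʳ P L j′)))))

  enum-surjective : ∀ {L v} → Covered L v → ∃ λ i → enum L i ≡ v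
  enum-surjective {P ∷ L} (here (j , e))  = suc (size (sizes L)) ↑ʳ j , trans (enum-ʳ P L j) e
  enum-surjective {P ∷ L} (there cov) with enum-surjective cov
  ... | i , e = i ↑ˡ (2 ℕ.+ p P) , trans (enum-ˡ P L i) e

  enum-vertex-adj : ∀ P {L} → All (Before P) L → ∀ i j → adj G (enum L i) (vertex P j) ≡ isFirst i ∧ isEnd j
  enum-vertex-adj P {L} b zero    j = trans (cong (λ x → adj G x (vertex P j)) (enum-zero L)) (centre-adj P j)
  enum-vertex-adj P {L} b (suc i) j = bool-iff absurd (λ ())
    where
    absurd : ∀ {b′} → adj G (enum L (suc i)) (vertex P j) ≡ true → b′ ≡ true
    absurd e with petal-closed P (j , refl) (flip e)
    ... | inj₁ ≡c = contradiction ≡c (covered-≢c (enum-covered L (suc i) λ ()))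
    ... | inj₂ ∈P = contradiction (enum-covered L (suc i) λ ()) (covered-disjoint P b ∈P)

  enum-adj : ∀ {L} → AllPairs Before L → ∀ i j → adj G (enum L i) (enum L j) ≡ roseAdj (sizes L) i j
  enum-adj {[]}    []       i j = irrefl G c
  enum-adj {P ∷ L} (b ∷ bs) i j with split-view (suc (size (sizes L))) (2 ℕ.+ p P) i | split-view (suc (size (sizes L))) (2 ℕ.+ p P) j
  ... | inj₁ (i′ , refl) | inj₁ (j′ , refl) = trans (cong₂ (adj G) (enum-ˡ P L i′) (enum-ˡ P L j′)) (trans (enum-adj bs i′ j′) (≡-sym (roseAdj-ˡˡ (2 ℕ.+ p P) (sizes L) i′ j′)))
  ... | inj₁ (i′ , refl) | inj₂ (j′ , refl) = trans (cong₂ (adj G) (enum-ˡ P L i′) (enum-ʳ P L j′)) (trans (enum-vertex-adj P b i′ j′) (≡-sym (roseAdj-ˡʳ (2 ℕ.+ p P) (sizes L) i′ j′)))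
  ... | inj₂ (i′ , refl) | inj₁ (j′ , refl) = trans (cong₂ (adj G) (enum-ʳ P L i′) (enum-ˡ P L j′)) (trans (trans (sym G _ _) (enum-vertex-adj P b j′ i′)) (≡-sym (roseAdj-ʳˡ (2 ℕ.+ p P) (sizes L) i′ j′)))
  ... | inj₂ (i′ , refl) | inj₂ (j′ , refl) = trans (cong₂ (adj G) (enum-ʳ P L i′) (enum-ʳ P L j′)) (trans (vertex-adj P i′ j′) (≡-sym (roseAdj-ʳʳ (2 ℕ.+ p P) (sizes L) i′ j′)))

  Inside : List Petal → Fin (n G) → Set
  Inside L v = v ≡ c ⊎ Covered L v

  inside? : ∀ L v → Dec (Inside L v)
  inside? L v = (v Fin.≟ c) ⊎-dec covered? L v

  rose-form : ∀ {L} → AllPairs Before L → (∀ v → Inside L v) → RoseForm G c (map p L)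
  rose-form {L} pairs cover = record
    { to = enum L ; from = λ v → proj₁ (located v) ; to-from = λ v → proj₂ (located v)
    ; injective = λ {i} {j} → enum-injective pairs i j ; centre = enum-zero L ; to-adj = enum-adj pairs }
    where
    located : ∀ v → ∃ λ i → enum L i ≡ v
    located v with cover v
    ... | inj₁ refl = zero , enum-zero L
    ... | inj₂ cov  = enum-surjective cov

  petals-closed : ∀ {L} → (∀ {v} → adj G c v ≡ true → Covered L v) → ∀ {v x} → Inside L v → adj G v x ≡ true → Inside L x
  petals-closed at-c (inj₁ refl) e = inj₂ (at-c e)
  petals-closed {L} at-c (inj₂ cov) e = inside cov e
    where
    inside : ∀ {L v x} → Covered L v → adj G v x ≡ true → Inside L x
    inside (here {P} ∈P) e with petal-closed P ∈P e
    ... | inj₁ ≡c = inj₁ ≡c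
    ... | inj₂ ∈P′ = inj₂ (here ∈P′)
    inside (there cov) e with inside cov e
    ... | inj₁ ≡c   = inj₁ ≡c
    ... | inj₂ cov′ = inj₂ (there cov′)

  sorted-sizes : ∀ {L} → AllPairs Before L → AllPairs _≤_ (map p L)
  sorted-sizes []       = []
  sorted-sizes {P ∷ L} (b ∷ bs) = heads P b ∷ sorted-sizes bs
    where
    heads : ∀ P {L} → All (Before P) L → All (p P ≤_) (map p L)
    heads P []             = []
    heads P ((le , _) ∷ b) = le ∷ heads P b

-- Transport along bijections and comparison of cospectral graphs

module _ {N m} (e : Fin N → Fin m) (e⁻¹ : Fin m → Fin N) (left : ∀ i → e⁻¹ (e i) ≡ i) (right : ∀ j → e (e⁻¹ j) ≡ j) where

  private
    e-injective : ∀ {i j} → e i ≡ e j → i ≡ j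
    e-injective {i} {j} p = trans (≡-sym (left i)) (trans (cong e⁻¹ p) (left j))

    e⁻¹-injective : ∀ {i j} → e⁻¹ i ≡ e⁻¹ j → i ≡ j
    e⁻¹-injective {i} {j} p = trans (≡-sym (right i)) (trans (cong e p) (right j))

  bijection-size : N ≡ m
  bijection-size = ℕₚ.≤-antisym (Finₚ.injective⇒≤ e-injective) (Finₚ.injective⇒≤ e⁻¹-injective)

  δ-bijection : ∀ i j → δ (e i) (e j) ≡ δ i j
  δ-bijection = δ-injective e-injective

  -- Each `f j` is spread out as a sum over `i` against `δ (e i) j`, and the two sums are exchanged;
  -- no induction on permutations is involved.
  ∑-bijection : ∀ f → ∑ f ≡ ∑ (λ i → f (e i))
  ∑-bijection f = begin
    ∑ f                                        ≡⟨ ∑-cong (λ j → trans (≡-sym (∑-δ (e⁻¹ j) (λ _ → f j))) (∑-cong (λ i → cong (f j *_) (move i j)))) ⟩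
    ∑ (λ j → ∑ (λ i → f j * δ (e i) j))        ≡⟨ ∑-swap (λ j i → f j * δ (e i) j) ⟩
    ∑ (λ i → ∑ (λ j → f j * δ (e i) j))        ≡⟨ ∑-cong (λ i → ∑-δ (e i) f) ⟩
    ∑ (λ i → f (e i))                          ∎
    where
    open ≡-Reasoning
    move : ∀ i j → δ (e⁻¹ j) i ≡ δ (e i) j
    move i j = trans (δ-sym (e⁻¹ j) i) (trans (≡-sym (δ-bijection i (e⁻¹ j))) (cong (δ (e i)) (right j)))

det-bijection : ∀ {N m} (e : Fin N → Fin m) (e⁻¹ : Fin m → Fin N) → (∀ i → e⁻¹ (e i) ≡ i) → (∀ j → e (e⁻¹ j) ≡ j) →
                ∀ M → det N (λ i j → M (e i) (e j)) ≡ det m M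
det-bijection e e⁻¹ left right with bijection-size e e⁻¹ left right
... | refl = det-relabel e e⁻¹ left right

∑-roseAdj : ∀ ps → ∑ (λ i → bit (roseAdj (petalSizes ps) zero i)) ≡ + 2 * + length ps
∑-roseAdj []       = refl
∑-roseAdj (p ∷ ps) = begin
  ∑ (λ i → bit (roseAdj (m ∷ ms) zero i))                                  ≡⟨ ∑-split r (λ i → bit (roseAdj (m ∷ ms) zero i)) ⟩
  ∑ (λ (i : Fin r) → bit (roseAdj (m ∷ ms) zero (i ↑ˡ m))) + ∑ (λ j → bit (roseAdj (m ∷ ms) zero (r ↑ʳ j)))
    ≡⟨ cong₂ _+_ (trans (∑-cong (λ i → cong bit (roseAdj-ˡˡ m ms zero i))) (∑-roseAdj ps)) (∑-cong (λ j → trans (cong bit (roseAdj-ˡʳ m ms zero j)) (ends j))) ⟩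
  + 2 * + length ps + ∑ (λ j → 1ℤ * bit (isFirst {m} j) + 1ℤ * bit (isLast {m} j))
    ≡⟨ cong (_+_ (+ 2 * + length ps)) (trans (∑-+ (λ j → 1ℤ * bit (isFirst {m} j)) (λ j → 1ℤ * bit (isLast {m} j)))
         (cong₂ _+_ (∑-isFirst {suc p} (λ _ → 1ℤ)) (∑-isLast {suc p} (λ _ → 1ℤ)))) ⟩
  + 2 * + length ps + + 2                                                  ≡⟨ collect (+ length ps) ⟩
  + 2 * (1ℤ + + length ps)                                                 ≡⟨ cong (+ 2 *_) (ℤₚ.pos-+ 1 (length ps)) ⟨
  + 2 * + suc (length ps)                                                  ∎
  where
  open ≡-Reasoning
  m r : ℕ
  m = suc (suc p)
  ms = petalSizes ps
  r = suc (size ms)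
  collect : ∀ x → + 2 * x + + 2 ≡ + 2 * (1ℤ + x)
  collect = solve-∀
  ends : ∀ (j : Fin m) → bit (isEnd j) ≡ 1ℤ * bit (isFirst j) + 1ℤ * bit (isLast j)
  ends zero    = refl
  ends (suc j) = ≡-sym (trans (ℤₚ.+-identityˡ (1ℤ * bit (isLast j))) (ℤₚ.*-identityˡ (bit (isLast j))))

-- The diagonal entry s - 2ku of the centre at s = (1 - y)², u = - y.
central-entry : ℕ → ℤ → ℤ
central-entry k y = (1ℤ - y) * (1ℤ - y) + + 2 * + k * y

module _ {k : ℕ} {G : Graph} {c : Fin (n G)} (degrees : HasDegrees k G c) {ps : List ℕ} (F : RoseForm G c ps) where
  open RoseForm F

  rose-length : k ≡ length ps
  rose-length = ℤₚ.+-injective (*-cancelˡ (+ 2) {+ k} {+ length ps} (begin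
    + 2 * + k                                              ≡⟨ ℤₚ.pos-* 2 k ⟨
    + (2 ℕ.* k)                                            ≡⟨ cong +_ (proj₁ degrees) ⟨
    𝒟 G c                                                  ≡⟨ 𝒟-∑ G c ⟩
    ∑ (𝒜 G c)                                              ≡⟨ ∑-bijection to from from-to to-from (𝒜 G c) ⟩
    ∑ (λ i → 𝒜 G c (to i))                                 ≡⟨ ∑-cong (λ i → cong bit (trans (cong (λ x → adj G x (to i)) (≡-sym centre)) (to-adj zero i))) ⟩
    ∑ (λ i → bit (roseAdj (petalSizes ps) zero i))         ≡⟨ ∑-roseAdj ps ⟩
    + 2 * + length ps                                      ∎))
    where open ≡-Reasoning

  P-rose : ∀ v → let y = + v in P G ((1ℤ - y) * (1ℤ - y)) (- y) ≡ rose-det v (central-entry k y) ps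
  P-rose v = trans (≡-sym (det-bijection to from from-to to-from (λ a b → (1ℤ - y) * (1ℤ - y) * δ a b - - y * ℒ G a b))) (det-cong entry)
    where
    y = + v
    open RoseMatrix y
    expand : ∀ y d D a → (1ℤ - y) * (1ℤ - y) * d - - y * (D * d - a) ≡ ((1ℤ - y) * (1ℤ - y) + D * y) * d - y * a
    expand = solve-∀
    complete : ∀ y → (1ℤ - y) * (1ℤ - y) + + 2 * y ≡ 1ℤ + y * y
    complete = solve-∀
    diagonal : ∀ i → (1ℤ - y) * (1ℤ - y) + 𝒟 G (to i) * y ≡ (central-entry k y ◂ (λ _ → ρ)) i
    diagonal zero    = cong (λ d → (1ℤ - y) * (1ℤ - y) + d * y) (trans (cong (λ x → 𝒟 G x) centre) (trans (cong +_ (proj₁ degrees)) (ℤₚ.pos-* 2 k)))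
    diagonal (suc i) = trans (cong (λ d → (1ℤ - y) * (1ℤ - y) + + d * y) (proj₂ degrees (to (suc i)) (λ e → case injective (trans e (≡-sym centre)) of λ ()))) (complete y)
    entry : ∀ i j → (1ℤ - y) * (1ℤ - y) * δ (to i) (to j) - - y * ℒ G (to i) (to j) ≡ roseMat (central-entry k y) (petalSizes ps) i j
    entry i j = trans (expand y (δ (to i) (to j)) (𝒟 G (to i)) (𝒜 G (to i) (to j)))
                      (cong₂ _-_ (cong₂ _*_ (diagonal i) (δ-bijection to from from-to to-from i j)) (cong (λ b → y * bit b) (to-adj i j)))

roses-isomorphic : ∀ {G H c d ps} → RoseForm G c ps → RoseForm H d ps → G ≅ H
roses-isomorphic {G} {H} F F′ = mk↔ₛ′ (F′.to ∘ F.from) (F.to ∘ F′.from)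
    (λ v → trans (cong F′.to (F.from-to (F′.from v))) (F′.to-from v))
    (λ v → trans (cong F.to (F′.from-to (F.from v))) (F.to-from v)) ,
  λ i j → trans (F′.to-adj (F.from i) (F.from j)) (trans (≡-sym (F.to-adj (F.from i) (F.from j))) (cong₂ (adj G) (F.to-from i) (F.to-from j)))
  where
  module F = RoseForm F
  module F′ = RoseForm F′

SortedRose : (G : Graph) → Fin (n G) → Set
SortedRose G c = Σ (List ℕ) λ ps → AllPairs _≤_ ps × RoseForm G c ps

connected-rose : ∀ G c → (∀ v → v ≢ c → deg G v ≡ 2) → Connected G → SortedRose G c
connected-rose G c two connected with Petals.all-petals G c two
... | L , pairs , at-c = map (Petals.p {G} {c} {two}) L , sorted-sizes G c two pairs , rose-form G c two pairs
        (λ v → reach-closed G (Inside G c two L) (petals-closed G c two at-c) (connected c v) (inj₁ refl))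

-- Either the petals exhaust the graph, or their union with the centre is a proper union of components.
rose-or-disconnected : ∀ G c → (∀ v → v ≢ c → deg G v ≡ 2) → SortedRose G c ⊎ (∀ s u → ∃ λ q → P G s u ≡ s * s * q)
rose-or-disconnected G c two with Petals.all-petals G c two
... | L , pairs , at-c with Finₚ.all? (inside? G c two L)
... | yes cover = inj₁ (map (Petals.p {G} {c} {two}) L , sorted-sizes G c two pairs , rose-form G c two pairs cover)
... | no ¬cover with Finₚ.¬∀⟶∃¬ (n G) _ (inside? G c two L) ¬cover
... | w , w∉ = inj₂ (λ s u → disconnected-divides G s u χ constant c w χ-c χ-w)
  where
  S = Inside G c two L
  S? = inside? G c two L
  closed : ∀ {v x} → S v → adj G v x ≡ true → S x
  closed = petals-closed G c two at-c
  χ : Fin (n G) → ℤ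
  χ v = + indicator (S? v)
  indicator-yes : ∀ {A : Set} (d : Dec A) → A → indicator d ≡ 1
  indicator-yes (yes _) a = refl
  indicator-yes (no ¬a) a = contradiction a ¬a
  indicator-no : ∀ {A : Set} (d : Dec A) → ¬ A → indicator d ≡ 0
  indicator-no (yes a) ¬a = contradiction a ¬a
  indicator-no (no _)  ¬a = refl
  χ-c : χ c ≡ 1ℤ
  χ-c = cong +_ (indicator-yes (S? c) (inj₁ refl))
  χ-w : χ w ≡ 0ℤ
  χ-w = cong +_ (indicator-no (S? w) w∉)
  constant : ∀ {i j} → adj G i j ≡ true → χ i ≡ χ j
  constant {i} {j} e with S? i
  ... | yes s = cong +_ (≡-sym (indicator-yes (S? j) (closed s e)))
  ... | no ¬s = cong +_ (≡-sym (indicator-no (S? j) (λ s → ¬s (closed s (trans (sym G j i) e)))))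

same-P-isomorphic : ∀ {k G H c d} → HasDegrees k G c → HasDegrees k H d → (∀ s u → P G s u ≡ P H s u) →
                    SortedRose G c → SortedRose H d → G ≅ H
same-P-isomorphic {k} {G} {H} {c} {d} degG degH same (ps , sorted-ps , FG) (qs , sorted-qs , FH) =
  roses-isomorphic FG (subst (RoseForm H d) (≡-sym sizes-agree) FH)
  where
  X : ℤ → ℤ
  X = central-entry k
  lengths : length ps ≡ length qs
  lengths = trans (≡-sym (rose-length {k} degG FG)) (rose-length {k} degH FH)
  profile : ∀ v rs → (1ℤ - + v * + v) ^ length rs * rose-det v (X (+ v)) rs ≡ Profile X (λ _ → 1ℤ) (λ _ → 0ℤ) (+ v) rs
  profile v rs = trans (rose-det-D̃ v (X (+ v)) rs) (identity (D̃ (+ v) (X (+ v)) rs) (Ã (+ v) rs))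
    where
    identity : ∀ d a → d ≡ 1ℤ * d - 0ℤ * a
    identity = solve-∀
  -- The normalising power of 1 - y² is the same for both graphs because each has k petals.
  agree : ∀ v → Profile X (λ _ → 1ℤ) (λ _ → 0ℤ) (+ v) ps ≡ Profile X (λ _ → 1ℤ) (λ _ → 0ℤ) (+ v) qs
  agree v = trans (≡-sym (profile v ps)) (trans (cong₂ (λ l d → (1ℤ - + v * + v) ^ l * d) lengths
    (trans (≡-sym (P-rose {k} degG FG v)) (trans (same ((1ℤ - + v) * (1ℤ - + v)) (- (+ v))) (P-rose {k} degH FH v)))) (profile v qs))
  sizes-agree : ps ≡ qs
  sizes-agree = profile-injective {X} {λ _ → 1ℤ} {λ _ → 0ℤ} (λ y → ≈-refl) sorted-ps sorted-qs lengths agree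

theorem5p3 : ∀ (k : ℕ) → 3 ≤ k → ∀ (G : Graph) → IsRose k G → DLS G
theorem5p3 k 3≤k G (connected , c , degrees) H cospectral = compare (rose-or-disconnected H d (proj₂ degrees-H))
  where
  same : n G ≡ n H × (∀ s u → P G s u ≡ P H s u)
  same = cospectral-P G H cospectral
  moments = same-moments G H (proj₂ same)
  H-degrees : ∃ (HasDegrees k H)
  H-degrees = degrees-determined {k} 3≤k G c degrees (triangles-bound G {k} connected c degrees) H (proj₁ same)
    (proj₁ moments) (proj₁ (proj₂ moments)) (proj₂ (proj₂ moments))
  d = proj₁ H-degrees
  degrees-H = proj₂ H-degrees
  rose-G : SortedRose G c
  rose-G = connected-rose G c (proj₂ degrees) connected
  compare : SortedRose H d ⊎ (∀ s u → ∃ λ q → P H s u ≡ s * s * q) → G ≅ H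
  compare (inj₁ rose-H)  = same-P-isomorphic {k} degrees degrees-H (proj₂ same) rose-G rose-H
  -- At s = z² the divisor s² is z⁴. Since `G` and `H` share P, this would be a zero of order 4 for
  -- the connected rose `G`.
  compare (inj₂ divides) = ⊥-elim (rose-simple-zero ps (λ v → let y = + suc (suc v) ; z = 1ℤ - y in
      proj₁ (divides (z * z) (- y)) ,
      trans (cong (λ l → rose-det (suc (suc v)) (z * z + + 2 * + l * y) ps) (≡-sym (rose-length {k} degrees FG)))
        (trans (≡-sym (P-rose {k} degrees FG (suc (suc v)))) (trans (proj₂ same (z * z) (- y)) (proj₂ (divides (z * z) (- y)))))))
    where
    ps = proj₁ rose-G
    FG = proj₂ (proj₂ rose-G)
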